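{- Let $I=\{1\le i_1<\dots<i_k\le n\}$ be the pivot indices (the indices of the boundary sources) for the plabic network $(\mathcal N,\mathcal O,\mathfrak l)$. Let $E_e$ be the system of edge vectors on $(\mathcal N,\mathcal O,\mathfrak l)$ satisfying the boundary conditions $E_j$ (the $j$-th canonical basis vector) at the boundary sinks $b_j$, $j\in\bar I=[n]\setminus I$. Assume that we change the orientation along a simple closed directed cycle $\mathcal Q_0$ and let $(\mathcal N,\hat{\mathcal O},\mathfrak l)$ be the newly oriented network. Then the system of vectors $$\hat E_e=\begin{cases}(-1)^{\gamma(e)}E_e&\text{if }e\notin\mathcal Q_0,\\ \dfrac{(-1)^{\gamma(e)}}{w_e}E_e&\text{if }e\in\mathcal Q_0,\end{cases}$$ is the system of edge vectors on $(\mathcal N,\hat{\mathcal O},\mathfrak l)$ satisfying the same boundary conditions $E_j$ at the boundary sinks $j\in\bar I$.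
   Context: Networks. Fix positive integers $k<n$. A plabic graph $\mathcal G$ of type $(k,n)$ is a finite directed graph drawn planarly in a disk, with no component isolated from the boundary, such that: it has $n$ boundary vertices $b_1,\dots,b_n$ labelled clockwise, all on a common straight interval of the boundary of the disk, each of degree 1 (a boundary source if its edge is outgoing, a boundary sink if incoming; exactly $k$ are sources); all other (internal) vertices are strictly inside the disk and are bivalent or trivalent; each internal vertex either has exactly one incoming edge (white) or exactly one outgoing edge (black), bivalent vertices being assigned either colour. Edges are straight segments, regarded as vectors directed by the orientation. A plabic network $\mathcal N$ is a plabic graph with a positive weight $w_e$ on each edge; $\mathcal O$ denotes its orientation. Gauge rays. A gauge ray direction $\mathfrak l$ is an oriented direction such that the ray in direction $\mathfrak l$ from any boundary vertex points inside the disk, no internal edge is parallel to $\mathfrak l$, and the rays starting at boundary vertices contain no internal vertices. The gauge rays are the rays $\mathfrak l_{i_r}$ starting at the boundary sources. For plane vectors $s(u,v)=+1,0,-1$ if $(u,v)$ is positively (counterclockwise) oriented, parallel, negatively oriented. For consecutive edges, $\mathrm{wind}(e,f)=\pm1$ if $s(e,f)=s(e,\mathfrak l)=s(\mathfrak l,f)=\pm1$, and $0$ otherwise. $\mathrm{int}(e)$ is the number of intersections of $e$ with the gauge rays (the common starting point of $\mathfrak l_{i_r}$ and the edge at $b_{i_r}$ is not counted). System of edge vectors. The system of edge vectors with boundary conditions $B_j$ at the sinks is the unique solution of: $E_{e_j}=(-1)^{\mathrm{int}(e_j)}w_{e_j}B_j$ at the edge $e_j$ ending at each boundary sink $b_j$;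 $E_e=(-1)^{\mathrm{int}(e)+\mathrm{wind}(e,f)}w_eE_f$ for each incoming edge $e$ at a bivalent or black vertex with outgoing edge $f$; $E_{e_3}=(-1)^{\mathrm{int}(e_3)+\mathrm{wind}(e_3,e_1)}w_{e_3}E_{e_1}+(-1)^{\mathrm{int}(e_3)+\mathrm{wind}(e_3,e_2)}w_{e_3}E_{e_2}$ at each trivalent white vertex with incoming edge $e_3$ and outgoing edges $e_1,e_2$. Change of orientation. All edges of $\mathcal Q_0$ are reversed and their weights replaced by the reciprocals; other edges and weights are unchanged. A reversed edge is identified with the original one; $w_e$ in the formula is the initial weight. Index $\gamma$, computed in the initial orientation. The cycle $\mathcal Q_0$ divides the disk into two regions: the external one is marked $+$ and the internal one $-$. If $e\notin\mathcal Q_0$, $\gamma(e)=0$ (resp. $1$) if the starting vertex of $e$ belongs to the $+$ (resp. $-$) region, where a starting vertex on $\mathcal Q_0$ is first shifted infinitesimally in the direction of $e$. If $e\in\mathcal Q_0$, $\gamma(e)=\gamma_1(e)+\gamma_2(e)+\mathrm{int}(e)$, with $\gamma_1(e)=0$ (resp. $1$) if the region to the left of $e$ near its ending point is marked $+$ (resp. $-$), and $\gamma_2(e)=\frac{1-s(e,\mathfrak l)}2$. -}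

module Defs where

open import Algebra.Bundles using (CommutativeRing)
import Algebra.Properties.Ring as RingProperties
import Algebra.Properties.Semiring.Exp as Exp
import Algebra.Solver.Ring.NaturalCoefficients.Default as SemiringSolver
open import Data.Bool using (if_then_else_)
open import Data.Fin as Fin using (Fin; toℕ)
import Data.Fin.Properties as Fin
open import Data.Integer as ℤ using (ℤ; 0ℤ; 1ℤ; -1ℤ)
open import Data.Nat as ℕ using (ℕ; suc; ⌊_/2⌋)
open import Data.Nat.DivMod using (_mod_)
open import Data.Product using (∃-syntax; _×_; _,_)
open import Data.Sign using (Sign)
open import Data.Sum using (_⊎_; inj₁; inj₂)
import Data.Sum.Properties as Sum
open import Data.Vec using (allFin; count)
open import Data.Vec.Functional using (Vector)
open import Function.Bundles using (_⇔_)
open import Function.Definitions using (Injective)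
open import Level using (_⊔_) renaming (suc to lsuc)
open import Relation.Binary.Construct.Closure.Equivalence using (EqClosure)
open import Relation.Binary.Construct.Closure.ReflexiveTransitive using (Star)
import Relation.Binary.Construct.StrictToNonStrict as StrictToNonStrict
open import Relation.Binary.Core using (Rel)
open import Relation.Binary.Definitions using (DecidableEquality; tri<; tri≈; tri>)
open import Relation.Binary.PropositionalEquality as ≡ using (_≡_; _≢_)
open import Relation.Binary.Structures using (IsStrictTotalOrder)
open import Relation.Nullary using (¬_; Dec; yes; no; does; _×-dec_; _⊎-dec_)
open import Relation.Nullary.Decidable using (map′)
open import Relation.Unary using (Pred; Decidable)

-- The scalars.  Only the ordered field structure of the real line enters,
-- so the plane, the weights and the edge vectors are taken over an
-- arbitrary (totally) ordered field.

record OrderedField c ℓ₁ ℓ₂ : Set (lsuc (c ⊔ ℓ₁ ⊔ ℓ₂)) where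
  infix 4 _<_
  infix 9 _⁻¹
  field
    commutativeRing : CommutativeRing c ℓ₁
  open CommutativeRing commutativeRing public
  field
    _<_                : Rel Carrier ℓ₂
    isStrictTotalOrder : IsStrictTotalOrder _≈_ _<_
    0<1                : 0# < 1#
    +-monoˡ-<          : ∀ z {x y} → x < y → x + z < y + z
    *-pos              : ∀ {x y} → 0# < x → 0# < y → 0# < x * y
    -- total, with an unspecified value at 0#
    _⁻¹                : Carrier → Carrier
    ⁻¹-inverseʳ        : ∀ {x} → ¬ (x ≈ 0#) → x * x ⁻¹ ≈ 1#
  open IsStrictTotalOrder isStrictTotalOrder public
    using (compare; _<?_; <-respˡ-≈; <-respʳ-≈) renaming (_≟_ to _≈?_)
  open StrictToNonStrict _≈_ _<_ public using (_≤_)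

  ≤-respʳ-≈ : ∀ {x y z} → y ≈ z → x ≤ y → x ≤ z
  ≤-respʳ-≈ = StrictToNonStrict.≤-respʳ-≈ _≈_ _<_ trans <-respʳ-≈

  ≤-respˡ-≈ : ∀ {x y z} → x ≈ y → x ≤ z → y ≤ z
  ≤-respˡ-≈ = StrictToNonStrict.≤-respˡ-≈ _≈_ _<_ sym trans <-respˡ-≈

  open Exp semiring public using (_^_)

data Colour : Set where
  white black : Colour

countFin : ∀ {m p} {P : Pred (Fin m) p} → Decidable P → ℕ
countFin P? = count P? (allFin _)

next : ∀ {m} → Fin (suc m) → Fin (suc m)
next {m} i = suc (toℕ i) mod suc m

bit : Sign → ℕ
bit Sign.+ = 0
bit Sign.- = 1

module Plabic {c ℓ₁ ℓ₂} (F : OrderedField c ℓ₁ ℓ₂) where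
  open OrderedField F

  Point : Set c
  Point = Carrier × Carrier

  infix 4 _≈ₚ_
  _≈ₚ_ : Rel Point ℓ₁
  (x , y) ≈ₚ (x′ , y′) = x ≈ x′ × y ≈ y′

  infixl 6 _+ₚ_ _-ₚ_
  infixr 7 _*ₚ_
  _+ₚ_ _-ₚ_ : Point → Point → Point
  (x , y) +ₚ (x′ , y′) = x + x′ , y + y′
  (x , y) -ₚ (x′ , y′) = x - x′ , y - y′

  _*ₚ_ : Carrier → Point → Point
  t *ₚ (x , y) = t * x , t * y

  rotate90 : Point → Point
  rotate90 (x , y) = - y , x

  sgn : Carrier → ℤ
  sgn x with compare 0# x
  ... | tri< _ _ _ = 1ℤ
  ... | tri≈ _ _ _ = 0ℤ
  ... | tri> _ _ _ = -1ℤ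

  cross : Point → Point → Carrier
  cross (x , y) (x′ , y′) = x * y′ - y * x′

  s : Point → Point → ℤ
  s u v = sgn (cross u v)

  along : Point → Point → Carrier → Point
  along p q t = p +ₚ t *ₚ (q -ₚ p)

  infix 4 _∈[_,_]
  _∈[_,_] : Point → Point → Point → Set (c ⊔ ℓ₁ ⊔ ℓ₂)
  x ∈[ p , q ] = ∃[ t ] (0# ≤ t × t ≤ 1# × x ≈ₚ along p q t)

  Near : Carrier → Rel Point ℓ₂
  Near r (x , y) (x′ , y′) = (- r < x′ - x × x′ - x < r) × (- r < y′ - y × y′ - y < r)

  origin : Point
  origin = 0# , 0#

  PathIn : ∀ {ℓ} → Pred Point ℓ → Rel Point (c ⊔ ℓ₁ ⊔ ℓ₂ ⊔ ℓ)
  PathIn S = Star λ p q → ∀ x → x ∈[ p , q ] → S x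

  Eventually : ∀ {ℓ} → Pred Carrier ℓ → Set (c ⊔ ℓ₂ ⊔ ℓ)
  Eventually P = ∃[ η ] (0# < η × (∀ ε → 0# < ε → ε < η → P ε))

  -- A bounded simply connected domain, together with a straight interval
  -- from A to B in its boundary, run through clockwise: the domain lies to
  -- the right of the interval.  Since the domain is open, polygonal paths
  -- suffice for connectedness, and simple connectedness says that no closed
  -- polygon in the domain encloses a point outside it.
  record Disk ℓ : Set (lsuc ℓ ⊔ c ⊔ ℓ₁ ⊔ ℓ₂) where
    field
      Interior : Pred Point ℓ
      A B      : Point

    OnInterval : Pred Point (c ⊔ ℓ₁ ⊔ ℓ₂)
    OnInterval p = ∃[ t ] (0# < t × t < 1# × p ≈ₚ along A B t)

    InDisk : Pred Point (c ⊔ ℓ₁ ⊔ ℓ₂ ⊔ ℓ)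
    InDisk p = Interior p ⊎ OnInterval p

    field
      resp      : ∀ {p q} → p ≈ₚ q → Interior p → Interior q
      isOpen    : ∀ p → Interior p → ∃[ ε ] (0# < ε × (∀ q → Near ε p q → Interior q))
      bounded   : ∃[ r ] (∀ p → Interior p → Near r origin p)
      connected : ∀ p q → Interior p → Interior q → PathIn Interior p q
      simplyConnected :
        ∀ {m} (P : Fin (suc m) → Point) →
        (∀ i x → x ∈[ P i , P (next i) ] → Interior x) →
        ∀ x → ¬ Interior x → ∀ r →
        ∃[ y ] (¬ Near r origin y ×
                PathIn (λ z → ¬ (∃[ i ] z ∈[ P i , P (next i) ])) x y)
      A≉B       : ¬ (A ≈ₚ B)
      flat      : ∀ p → OnInterval p →
                  ∃[ ε ] (0# < ε × (∀ q → Near ε p q →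
                    (Interior q ⇔ s (B -ₚ A) (q -ₚ p) ≡ -1ℤ)))

  record Network (n : ℕ) : Set c where
    field
      #internal : ℕ
      #edges    : ℕ

    Vertex : Set
    Vertex = Fin n ⊎ Fin #internal

    Edge : Set
    Edge = Fin #edges

    field
      src tgt : Edge → Vertex
      pos     : Vertex → Point
      colour  : Fin #internal → Colour
      weight  : Edge → Carrier

    pattern boundary j = inj₁ j
    pattern internal v = inj₂ v

    infix 4 _≟ᵛ_
    _≟ᵛ_ : DecidableEquality Vertex
    _≟ᵛ_ = Sum.≡-dec Fin._≟_ Fin._≟_

    dir : Edge → Point
    dir e = pos (tgt e) -ₚ pos (src e)

    OnEdge : Edge → Pred Point (c ⊔ ℓ₁ ⊔ ℓ₂)
    OnEdge e x = x ∈[ pos (src e) , pos (tgt e) ]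

    inDegree outDegree degree : Vertex → ℕ
    inDegree v  = countFin λ e → tgt e ≟ᵛ v
    outDegree v = countFin λ e → src e ≟ᵛ v
    degree v    = inDegree v ℕ.+ outDegree v

    IsSource : Fin n → Set
    IsSource j = ∃[ e ] src e ≡ boundary j

    isSource? : Decidable IsSource
    isSource? j = Fin.any? λ e → src e ≟ᵛ boundary j

    Adjacent : Rel Vertex _
    Adjacent u v = ∃[ e ] (src e ≡ u × tgt e ≡ v)

  record IsPlabicNetwork {ℓ} (D : Disk ℓ) (k : ℕ) {n} (N : Network n)
      : Set (c ⊔ ℓ₁ ⊔ ℓ₂ ⊔ ℓ) where
    open Disk D
    open Network N
    field
      boundary-degree : ∀ j → degree (boundary j) ≡ 1
      sources         : countFin isSource? ≡ k
      internal-degree : ∀ v → degree (internal v) ≡ 2 ⊎ degree (internal v) ≡ 3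
      white-in        : ∀ v → colour v ≡ white → inDegree (internal v) ≡ 1
      black-out       : ∀ v → colour v ≡ black → outDegree (internal v) ≡ 1
      not-isolated    : ∀ v → ∃[ j ] EqClosure Adjacent v (boundary j)
      weight-pos      : ∀ e → 0# < weight e

      -- the boundary vertices occur in order along the interval
      param           : Fin n → Carrier
      param-range     : ∀ j → 0# < param j × param j < 1#
      param-mono      : ∀ i j → i Fin.< j → param i < param j
      pos-boundary    : ∀ j → pos (boundary j) ≈ₚ along A B (param j)

      pos-internal    : ∀ v → Interior (pos (internal v))
      pos-injective   : ∀ u v → pos u ≈ₚ pos v → u ≡ v
      no-loops        : ∀ e → src e ≢ tgt e
      edges-inside    : ∀ e t → 0# < t → t < 1# →
                        Interior (along (pos (src e)) (pos (tgt e)) t)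
      planar          : ∀ e f x → e ≢ f → OnEdge e x → OnEdge f x →
                        ∃[ v ] ((src e ≡ v ⊎ tgt e ≡ v) × (src f ≡ v ⊎ tgt f ≡ v) ×
                                x ≈ₚ pos v)

  record IsGaugeDirection {ℓ} (D : Disk ℓ) {n} (N : Network n) (𝔩 : Point)
      : Set (c ⊔ ℓ₁ ⊔ ℓ₂ ⊔ ℓ) where
    open Disk D
    open Network N
    field
      points-inside     : ∀ j → Eventually λ ε → Interior (pos (boundary j) +ₚ ε *ₚ 𝔩)
      not-parallel      : ∀ e u v → src e ≡ internal u → tgt e ≡ internal v →
                          s (dir e) 𝔩 ≢ 0ℤ
      avoids-internal   : ∀ j v t → 0# ≤ t → ¬ (pos (internal v) ≈ₚ pos (boundary j) +ₚ t *ₚ 𝔩)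

  wind : Point → Point → Point → ℤ
  wind 𝔩 u v =
    if does (s u v ℤ.≟ s u 𝔩 ×-dec s u 𝔩 ℤ.≟ s 𝔩 v) then s u v else 0ℤ

  -- The ray from b in direction 𝔩 meets the segment from p to q at a point
  -- other than b.  An edge of a plabic network is never parallel to a gauge
  -- direction, so it meets a gauge ray at most once; parallel segments are
  -- excluded here since they have no isolated intersection point.
  record Crosses (𝔩 b p q : Point) : Set (c ⊔ ℓ₁ ⊔ ℓ₂) where
    constructor crosses
    field
      transversal : s (q -ₚ p) 𝔩 ≢ 0ℤ
      meets       : ∃[ t ] (0# < t × (b +ₚ t *ₚ 𝔩) ∈[ p , q ])

  module CrossingSolution where
    open SemiringSolver commutativeSemiring using (solve; _:=_; _:+_; _:*_; con)
    open RingProperties ring using (-1*x≈-x; +-cancelʳ)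

    m : Carrier
    m = - 1#

    -- The semiring solver does not cancel, so subtraction is multiplication
    -- by m, and multiples of 1# + m are removed by hand.
    cross′ : Point → Point → Carrier
    cross′ (x , y) (x′ , y′) = x * y′ + m * (y * x′)

    cross≈cross′ : ∀ u v → cross u v ≈ cross′ u v
    cross≈cross′ u v = +-congˡ (sym (-1*x≈-x _))

    [1+m]*z≈0 : ∀ z → (1# + m) * z ≈ 0#
    [1+m]*z≈0 z = trans (*-congʳ (-‿inverseʳ 1#)) (zeroˡ z)

    cancel : ∀ {x y} z w → x + (1# + m) * z ≈ y + (1# + m) * w → x ≈ y
    cancel z w eq = trans (sym (drop z)) (trans eq (drop w))
      where
      drop : ∀ {x} z → x + (1# + m) * z ≈ x
      drop z = trans (+-congˡ ([1+m]*z≈0 z)) (+-identityʳ _)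

    sgn≢0⇒≉0 : ∀ {x} → sgn x ≢ 0ℤ → ¬ (x ≈ 0#)
    sgn≢0⇒≉0 {x} sgn≢0 x≈0 with compare 0# x
    ... | tri< _ 0≉x _ = 0≉x (sym x≈0)
    ... | tri≈ _ _ _   = sgn≢0 ≡.refl
    ... | tri> _ 0≉x _ = 0≉x (sym x≈0)

    module Cramer (bx by lx ly px py dx dy : Carrier) where

      Δ T U : Carrier
      Δ = cross′ (dx , dy) (lx , ly)
      T = cross′ (dx , dy) (px + m * bx , py + m * by)
      U = cross′ (lx , ly) (px + m * bx , py + m * by)

      exists-x : Δ * bx + T * lx ≈ Δ * px + U * dx
      exists-x = cancel (dx * ly * px + m * dx * ly * bx) (m * dy * lx * bx + dx * ly * bx)
        (solve 9 (λ bx by lx ly px py dx dy m →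
          let Δ = dx :* ly :+ m :* (dy :* lx)
              T = dx :* (py :+ m :* by) :+ m :* (dy :* (px :+ m :* bx))
              U = lx :* (py :+ m :* by) :+ m :* (ly :* (px :+ m :* bx)) in
          Δ :* bx :+ T :* lx :+ (con 1 :+ m) :* (dx :* ly :* px :+ m :* dx :* ly :* bx) :=
          Δ :* px :+ U :* dx :+ (con 1 :+ m) :* (m :* dy :* lx :* bx :+ dx :* ly :* bx))
          refl bx by lx ly px py dx dy m)

      exists-y : Δ * by + T * ly ≈ Δ * py + U * dy
      exists-y = cancel (lx * py * dy) (dx * by * ly)
        (solve 9 (λ bx by lx ly px py dx dy m →
          let Δ = dx :* ly :+ m :* (dy :* lx)
              T = dx :* (py :+ m :* by) :+ m :* (dy :* (px :+ m :* bx))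
              U = lx :* (py :+ m :* by) :+ m :* (ly :* (px :+ m :* bx)) in
          Δ :* by :+ T :* ly :+ (con 1 :+ m) :* (lx :* py :* dy) :=
          Δ :* py :+ U :* dy :+ (con 1 :+ m) :* (dx :* by :* ly))
          refl bx by lx ly px py dx dy m)

      module _ {t u} (eqx : bx + t * lx ≈ px + u * dx)
                     (eqy : by + t * ly ≈ py + u * dy) where

        unique-t : t * Δ ≈ T
        unique-t = cancel (dx * by + m * dy * bx) (u * dx * dy)
          (+-cancelʳ (cross′ (dx , dy) (px + u * dx , py + u * dy)) _ _
            (trans
              (solve 11 (λ bx by lx ly px py dx dy t u m →
                let Δ = dx :* ly :+ m :* (dy :* lx)
                    T = dx :* (py :+ m :* by) :+ m :* (dy :* (px :+ m :* bx))
                    L = dx :* (by :+ t :* ly) :+ m :* (dy :* (bx :+ t :* lx))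
                    R = dx :* (py :+ u :* dy) :+ m :* (dy :* (px :+ u :* dx)) in
                t :* Δ :+ (con 1 :+ m) :* (dx :* by :+ m :* dy :* bx) :+ R :=
                T :+ (con 1 :+ m) :* (u :* dx :* dy) :+ L)
                refl bx by lx ly px py dx dy t u m)
              (+-congˡ (+-cong (*-congˡ eqy) (*-congˡ (*-congˡ eqx))))))

        unique-u : u * Δ ≈ U
        unique-u = cancel
          (cross′ (lx , ly) (bx + t * lx , by + t * ly))
          (u * dx * ly + u * lx * dy + m * t * lx * ly)
          (+-cancelʳ (cross′ (lx , ly) (px + u * dx , py + u * dy)) _ _
            (trans
              (solve 11 (λ bx by lx ly px py dx dy t u m →
                let Δ = dx :* ly :+ m :* (dy :* lx)
                    U = lx :* (py :+ m :* by) :+ m :* (ly :* (px :+ m :* bx))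
                    L = lx :* (by :+ t :* ly) :+ m :* (ly :* (bx :+ t :* lx))
                    R = lx :* (py :+ u :* dy) :+ m :* (ly :* (px :+ u :* dx)) in
                u :* Δ :+ (con 1 :+ m) :* L :+ R :=
                U :+ (con 1 :+ m) :*
                  (u :* dx :* ly :+ u :* lx :* dy :+ m :* t :* lx :* ly) :+ L)
                refl bx by lx ly px py dx dy t u m)
              (+-congˡ (+-cong (*-congˡ eqy) (*-congˡ (*-congˡ eqx))))))

      module _ {i} (Δi≈1 : Δ * i ≈ 1#) where

        scale : ∀ {X b l p d} → Δ * b + T * l ≈ Δ * p + X * d →
                b + (T * i) * l ≈ p + (X * i) * d
        scale {X} {b} {l} {p} {d} eq = trans (sym (half T b l)) (trans (*-congʳ eq) (half X p d))
          where
          half : ∀ Y x y → (Δ * x + Y * y) * i ≈ x + (Y * i) * y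
          half Y x y = trans
            (solve 5 (λ Δ Y x y i →
              (Δ :* x :+ Y :* y) :* i := (Δ :* i) :* x :+ (Y :* i) :* y) refl Δ Y x y i)
            (+-congʳ (trans (*-congʳ Δi≈1) (*-identityˡ x)))

        divide : ∀ {r X} → r * Δ ≈ X → r ≈ X * i
        divide {r} eq = trans (sym (trans (*-congˡ Δi≈1) (*-identityʳ r)))
                              (trans (sym (*-assoc r Δ i)) (*-congʳ eq))

  infix 4 _≤?_
  _≤?_ : ∀ x y → Dec (x ≤ y)
  x ≤? y = x <? y ⊎-dec x ≈? y

  crosses? : ∀ 𝔩 b p q → Dec (Crosses 𝔩 b p q)
  crosses? 𝔩@(lx , ly) b@(bx , by) p@(px , py) q@(qx , qy) with s (q -ₚ p) 𝔩 ℤ.≟ 0ℤ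
  ... | yes par = no λ (crosses transversal _) → transversal par
  ... | no ¬par = map′ to from (0# <? T * i ×-dec 0# ≤? U * i ×-dec U * i ≤? 1#)
    where
    open CrossingSolution
    open Cramer bx by lx ly px py (qx - px) (qy - py)
    i = Δ ⁻¹

    Δi≈1 : Δ * i ≈ 1#
    Δi≈1 = ⁻¹-inverseʳ λ Δ≈0 → sgn≢0⇒≉0 ¬par (trans (cross≈cross′ (q -ₚ p) 𝔩) Δ≈0)

    to : 0# < T * i × 0# ≤ U * i × U * i ≤ 1# → Crosses 𝔩 b p q
    to (0<t , 0≤u , u≤1) = crosses ¬par
      (T * i , 0<t , U * i , 0≤u , u≤1 , scale Δi≈1 exists-x , scale Δi≈1 exists-y)

    from : Crosses 𝔩 b p q → 0# < T * i × 0# ≤ U * i × U * i ≤ 1#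
    from (crosses _ (t , 0<t , u , 0≤u , u≤1 , eqx , eqy)) =
      <-respʳ-≈ t≈ 0<t , ≤-respʳ-≈ u≈ 0≤u , ≤-respˡ-≈ u≈ u≤1
      where
      t≈ = divide Δi≈1 (unique-t eqx eqy)
      u≈ = divide Δi≈1 (unique-u eqx eqy)

  module _ {n} (N : Network n) (𝔩 : Point) where
    open Network N

    int : Edge → ℕ
    int e = countFin λ j →
      isSource? j ×-dec crosses? 𝔩 (pos (boundary j)) (pos (src e)) (pos (tgt e))

    windₑ : Edge → Edge → ℤ
    windₑ e f = wind 𝔩 (dir e) (dir f)

  infix 4 _≈ᵥ_
  _≈ᵥ_ : ∀ {n} → Rel (Vector Carrier n) ℓ₁
  u ≈ᵥ v = ∀ i → u i ≈ v i

  infixl 6 _+ᵥ_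
  _+ᵥ_ : ∀ {n} → Vector Carrier n → Vector Carrier n → Vector Carrier n
  (u +ᵥ v) i = u i + v i

  infixr 7 _*ᵥ_
  _*ᵥ_ : ∀ {n} → Carrier → Vector Carrier n → Vector Carrier n
  (a *ᵥ u) i = a * u i

  basis : ∀ {n} → Fin n → Vector Carrier n
  basis j i = if does (i Fin.≟ j) then 1# else 0#

  -- ∣ z ∣ has the parity of z.
  -1^_ : ℤ → Carrier
  -1^ z = (- 1#) ^ ℤ.∣ z ∣

  module _ {n} (N : Network n) (𝔩 : Point) where
    open Network N

    -- The coefficient of E f in the relation for E e, where e and f are
    -- consecutive.
    coefficient : Edge → Edge → Carrier
    coefficient e f = -1^ (ℤ.+ int N 𝔩 e ℤ.+ windₑ N 𝔩 e f) * weight e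

    record Solves {d} (B : Fin n → Vector Carrier d) (E : Edge → Vector Carrier d)
        : Set ℓ₁ where
      field
        sink          : ∀ e j → tgt e ≡ boundary j →
                        E e ≈ᵥ (-1^ (ℤ.+ int N 𝔩 e) * weight e) *ᵥ B j
        bivalentBlack : ∀ v e f →
                        degree (internal v) ≡ 2 ⊎ colour v ≡ black →
                        tgt e ≡ internal v → src f ≡ internal v →
                        E e ≈ᵥ coefficient e f *ᵥ E f
        trivalentWhite : ∀ v e₃ e₁ e₂ →
                        degree (internal v) ≡ 3 → colour v ≡ white →
                        tgt e₃ ≡ internal v →
                        src e₁ ≡ internal v → src e₂ ≡ internal v → e₁ ≢ e₂ →
                        E e₃ ≈ᵥ coefficient e₃ e₁ *ᵥ E e₁ +ᵥ coefficient e₃ e₂ *ᵥ E e₂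

    -- The vectors B j matter only for sinks b_j.
    record IsEdgeVectorSystem {d} (B : Fin n → Vector Carrier d)
        (E : Edge → Vector Carrier d) : Set (c ⊔ ℓ₁) where
      field
        solves : Solves B E
        unique : ∀ E′ → Solves B E′ → ∀ e → E′ e ≈ᵥ E e

  record SimpleCycle {n} (N : Network n) : Set where
    open Network N
    field
      {length-1} : ℕ
      edge       : Fin (suc length-1) → Edge
      directed   : ∀ i → tgt (edge i) ≡ src (edge (next i))
      simple     : Injective _≡_ _≡_ (λ i → src (edge i))

    infix 4 _∈Q _∈Q?
    _∈Q : Pred Edge _
    e ∈Q = ∃[ i ] edge i ≡ e

    _∈Q? : Decidable _∈Q
    e ∈Q? = Fin.any? λ i → edge i Fin.≟ e

    VertexOf : Pred Vertex _
    VertexOf v = ∃[ i ] src (edge i) ≡ v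

    OnCycle : Pred Point (c ⊔ ℓ₁ ⊔ ℓ₂)
    OnCycle x = ∃[ i ] OnEdge (edge i) x

  changeOrientation : ∀ {n} (N : Network n) → SimpleCycle N → Network n
  changeOrientation N Q = record
    { #internal = #internal
    ; #edges    = #edges
    ; src       = λ e → if does (e ∈Q?) then tgt e else src e
    ; tgt       = λ e → if does (e ∈Q?) then src e else tgt e
    ; pos       = pos
    ; colour    = colour
    ; weight    = λ e → if does (e ∈Q?) then weight e ⁻¹ else weight e
    }
    where
    open Network N
    open SimpleCycle Q

  -- The marking of the two regions into which the cycle divides the disk:
  -- two points off the cycle carry the same mark exactly when they lie in the
  -- same region, and the region adjacent to the boundary is marked +.
  record RegionMarking {ℓ} (D : Disk ℓ) {n} (N : Network n) (Q : SimpleCycle N)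
      : Set (c ⊔ ℓ₁ ⊔ ℓ₂ ⊔ ℓ) where
    open Disk D
    open SimpleCycle Q

    OffCycle : Pred Point (c ⊔ ℓ₁ ⊔ ℓ₂ ⊔ ℓ)
    OffCycle x = InDisk x × ¬ OnCycle x

    field
      mark        : Point → Sign
      same-region : ∀ p q → OffCycle p → OffCycle q →
                    (mark p ≡ mark q ⇔ PathIn OffCycle p q)
      external    : ∀ p → OnInterval p → mark p ≡ Sign.+

  module _ {ℓ} {D : Disk ℓ} {n} (N : Network n) (𝔩 : Point)
           (Q : SimpleCycle N) (M : RegionMarking D N Q) where
    open Network N
    open SimpleCycle Q
    open RegionMarking M

    data StartRegion (e : Edge) (σ : Sign) : Set (c ⊔ ℓ₂) where
      off-cycle : ¬ VertexOf (src e) → mark (pos (src e)) ≡ σ → StartRegion e σ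
      on-cycle  : VertexOf (src e) →
                  Eventually (λ ε → mark (pos (src e) +ₚ ε *ₚ dir e) ≡ σ) →
                  StartRegion e σ

    -- Step back from the end of e by τ, then move to the left of e by δ,
    -- where δ is small compared with τ.
    LeftRegion : Edge → Sign → Set (c ⊔ ℓ₂)
    LeftRegion e σ = Eventually λ τ → Eventually λ δ →
      mark (pos (tgt e) -ₚ τ *ₚ dir e +ₚ δ *ₚ rotate90 (dir e)) ≡ σ

    -- (1 - s(e, 𝔩)) / 2, an exact division since s(e, 𝔩) = ±1.
    γ₂ : Edge → ℕ
    γ₂ e = ⌊ ℤ.∣ 1ℤ ℤ.- s (dir e) 𝔩 ∣ /2⌋

    data IndexIs (e : Edge) : ℕ → Set (c ⊔ ℓ₂) where
      off-cycle : ∀ {σ} → ¬ (e ∈Q) → StartRegion e σ → IndexIs e (bit σ)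
      on-cycle  : ∀ {σ} → e ∈Q → LeftRegion e σ →
                  IndexIs e (bit σ ℕ.+ γ₂ e ℕ.+ int N 𝔩 e)

  transformed : ∀ {n d} (N : Network n) (Q : SimpleCycle N) →
                (γ : Network.Edge N → ℕ) →
                (Network.Edge N → Vector Carrier d) →
                Network.Edge N → Vector Carrier d
  transformed N Q γ E e =
    if does (e ∈Q?)
    then (-1^ (ℤ.+ γ e) * weight e ⁻¹) *ᵥ E e
    else -1^ (ℤ.+ γ e) *ᵥ E e
    where
    open Network N
    open SimpleCycle Q

{-# OPTIONS --safe #-}

-- The number of edges of the cycle crossed by a ray from x, taken mod 2, is
-- constant along segments that avoid the cycle and changes across each edge
-- of the cycle.  Points with the same mark are joined by a path off the
-- cycle, so the two marks are the two parities; no path has to be constructed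
-- for this, and the inside of the cycle need not be known to lie in the
-- disk.  Hence γ₁ is constant along the cycle, and the index of a further
-- edge at a vertex of the cycle depends only on the sector that contains it,
-- which is read off from orientations of pairs of directions.  A check of the
-- finitely many sign patterns of the two edges of the cycle, the further edge
-- and 𝔩 then gives the parity identities that turn the relation at a vertex
-- for one orientation into the relation for the other.  These identities are
-- symmetric in the two orientations, so that uniqueness carries over as well.
module Submission where

open import Data.Fin using (Fin)

open import Data.Vec.Functional using (Vector)
open import Level using (Level)
open import Defs

open import Algebra.Bundles using (CommutativeRing; RawRing)
import Algebra.Properties.AbelianGroup as AbelianGroupProperties
import Algebra.Properties.CommutativeMonoid.Sum as Sum
import Algebra.Properties.Ring as RingProperties
import Algebra.Properties.Semiring.Mult.TCOptimised as Multiples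
import Algebra.Solver.Ring as RingSolver
open import Algebra.Solver.Ring.AlmostCommutativeRing using (_-Raw-AlmostCommutative⟶_; fromCommutativeRing)
open import Data.Bool as Bool using (Bool; true; false; not; _∧_; _∨_; _xor_; if_then_else_)
import Data.Bool.Properties as Bool
open import Data.Bool.Solver using (module xor-∧-Solver)
open import Data.Empty using (⊥; ⊥-elim)
open import Data.Fin as Fin using (fromℕ; inject₁; punchIn; punchOut)
open import Data.Fin.Permutation using (Permutation′; permutation)
import Data.Fin.Properties as Fin
open import Data.Fin.Relation.Unary.Top using (view; ‵fromℕ; ‵inject₁)
open import Data.Integer as ℤ using (ℤ; +_; -[1+_]; 0ℤ; 1ℤ; -1ℤ)
import Data.Integer.Properties as ℤ
open import Data.Maybe using (Maybe; just; nothing)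
open import Data.Nat as ℕ using (ℕ; zero; suc; s≤s; ⌊_/2⌋)
open import Data.Nat.DivMod using (_%_; m<n⇒m%n≡m; n%n≡0)
import Data.Nat.Properties as ℕ
open import Data.Product using (∃-syntax; _×_; _,_; proj₁; proj₂)
open import Data.Sign as Sign using (Sign)
open import Data.Sum using (_⊎_; inj₁; inj₂; [_,_]′; map₁)
open import Data.Vec using (tabulate; count)
open import Data.Vec.Functional using (removeAt)
open import Function using (id; _∘_; case_of_)
open import Function.Bundles using (_⇔_; module Equivalence; mk⇔)
open import Level using (_⊔_)
open import Relation.Binary.Construct.Closure.ReflexiveTransitive using (Star; _◅_)
open import Relation.Binary.Definitions using (tri<; tri≈; tri>)
open import Relation.Binary.PropositionalEquality as ≡ using (_≡_; _≢_)
import Relation.Binary.Reasoning.Setoid as SetoidReasoning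
open import Relation.Binary.Structures using (IsStrictTotalOrder)
open import Relation.Nullary using (¬_; Dec; yes; no; does; _×-dec_; _⊎-dec_; _→-dec_; ¬?; contradiction)
open import Relation.Nullary.Decidable using (does-⇔; dec-true; dec-false; map′; toWitness)
open import Relation.Unary using (Pred; Decidable)

open xor-∧-Solver using ()
  renaming (solve to xor-solve; _:+_ to _⊕_; _:=_ to _⊜_; con to bit-con)

-- An ordered field offers no continuity along which a crossing number could be followed, so its
-- constancy is obtained algebraically. Let the base point move from `x` to `y` without meeting an
-- edge. The contribution of that edge then changes only by what is seen from its two ends: the
-- change is the difference of one function `σ` at the two vertices. Around a closed polygon such
-- differences cancel, whatever `σ` is. An edge that is crossed violates this rule once and flips
-- the parity. Topology enters only through strict inequalities: edges are kept away by half planes,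
-- and a point is near a vertex when it lies on the right side of finitely many fixed walls. The ray
-- that defines the parity has nothing to do with the gauge rays. The numbers `int` occur in pairs
-- in each sign identity at a vertex of the cycle and drop out, so only windings, `γ₂` and the
-- sector remain to be compared.

-- With integer coefficients the ring solver cancels opposite terms.
module IntegerCoefficients {c ℓ} (R : CommutativeRing c ℓ) where
  open CommutativeRing R
  open RingProperties ring using (-‿distribˡ-*; -‿distribʳ-*; -0#≈0#; -‿involutive)
  open AbelianGroupProperties +-abelianGroup using (⁻¹-∙-comm)
  open Multiples semiring renaming (_×_ to _·_)
  open SetoidReasoning setoid

  -- The optimised multiple makes `⟦ 1ℤ ⟧` reduce to `1#`, so that solver equations with `con 1ℤ`
  -- match field expressions as they are written.
  ⟦_⟧ : ℤ → Carrier
  ⟦ + n ⟧      = n · 1#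
  ⟦ -[1+ n ] ⟧ = - (suc n · 1#)

  suc-homo : ∀ n → suc n · 1# ≈ 1# + n · 1#
  suc-homo n = ×-homo-+ 1# 1 n

  ⊖-homo : ∀ m n → ⟦ m ℤ.⊖ n ⟧ ≈ m · 1# - n · 1#
  ⊖-homo zero    zero    = sym (-‿inverseʳ 0#)
  ⊖-homo (suc m) zero    = sym (trans (+-congˡ -0#≈0#) (+-identityʳ _))
  ⊖-homo zero    (suc n) = sym (+-identityˡ _)
  ⊖-homo (suc m) (suc n) = begin
    ⟦ suc m ℤ.⊖ suc n ⟧               ≡⟨ ≡.cong ⟦_⟧ (ℤ.[1+m]⊖[1+n]≡m⊖n m n) ⟩
    ⟦ m ℤ.⊖ n ⟧                       ≈⟨ ⊖-homo m n ⟩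
    x - y                             ≈⟨ +-identityˡ _ ⟨
    0# + (x - y)                      ≈⟨ +-congʳ (-‿inverseʳ 1#) ⟨
    (1# - 1#) + (x - y)               ≈⟨ +-assoc _ _ _ ⟩
    1# + (- 1# + (x - y))             ≈⟨ +-congˡ (+-assoc _ _ _) ⟨
    1# + ((- 1# + x) - y)             ≈⟨ +-congˡ (+-congʳ (+-comm _ _)) ⟩
    1# + ((x - 1#) - y)               ≈⟨ +-congˡ (+-assoc _ _ _) ⟩
    1# + (x + (- 1# - y))             ≈⟨ +-assoc _ _ _ ⟨
    (1# + x) + (- 1# - y)             ≈⟨ +-congˡ (⁻¹-∙-comm _ _) ⟩
    (1# + x) - (1# + y)               ≈⟨ +-cong (suc-homo m) (-‿cong (suc-homo n)) ⟨
    suc m · 1# - suc n · 1#           ∎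
    where
    x = m · 1#
    y = n · 1#

  +-homo : ∀ i j → ⟦ i ℤ.+ j ⟧ ≈ ⟦ i ⟧ + ⟦ j ⟧
  +-homo (+ m)    (+ n)    = ×-homo-+ 1# m n
  +-homo (+ m)    -[1+ n ] = ⊖-homo m (suc n)
  +-homo -[1+ m ] (+ n)    = trans (⊖-homo n (suc m)) (+-comm _ _)
  +-homo -[1+ m ] -[1+ n ] = begin
    - (suc (suc (m ℕ.+ n)) · 1#)      ≡⟨ ≡.cong (λ k → - (k · 1#)) (≡.cong suc (ℕ.+-suc m n)) ⟨
    - ((suc m ℕ.+ suc n) · 1#)        ≈⟨ -‿cong (×-homo-+ 1# (suc m) (suc n)) ⟩
    - (suc m · 1# + suc n · 1#)       ≈⟨ ⁻¹-∙-comm _ _ ⟨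
    - (suc m · 1#) + - (suc n · 1#)   ∎

  neg-homo : ∀ i → ⟦ ℤ.- i ⟧ ≈ - ⟦ i ⟧
  neg-homo (+ zero)  = sym -0#≈0#
  neg-homo (+ suc n) = refl
  neg-homo -[1+ n ]  = sym (-‿involutive _)

  pos-*-homo : ∀ m j → ⟦ + m ℤ.* j ⟧ ≈ m · 1# * ⟦ j ⟧
  pos-*-homo m (+ n) = trans (reflexive (≡.cong ⟦_⟧ (≡.sym (ℤ.pos-* m n)))) (×1-homo-* m n)
  pos-*-homo m -[1+ n ] = begin
    ⟦ + m ℤ.* ℤ.- (+ suc n) ⟧   ≡⟨ ≡.cong ⟦_⟧ (ℤ.neg-distribʳ-* (+ m) (+ suc n)) ⟨
    ⟦ ℤ.- (+ m ℤ.* + suc n) ⟧   ≈⟨ neg-homo (+ m ℤ.* + suc n) ⟩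
    - ⟦ + m ℤ.* + suc n ⟧       ≈⟨ -‿cong (pos-*-homo m (+ suc n)) ⟩
    - (m · 1# * (suc n · 1#))   ≈⟨ -‿distribʳ-* _ _ ⟩
    m · 1# * - (suc n · 1#)     ∎

  *-homo : ∀ i j → ⟦ i ℤ.* j ⟧ ≈ ⟦ i ⟧ * ⟦ j ⟧
  *-homo (+ m)    j = pos-*-homo m j
  *-homo -[1+ m ] j = begin
    ⟦ ℤ.- (+ suc m) ℤ.* j ⟧   ≡⟨ ≡.cong ⟦_⟧ (ℤ.neg-distribˡ-* (+ suc m) j) ⟨
    ⟦ ℤ.- (+ suc m ℤ.* j) ⟧   ≈⟨ neg-homo (+ suc m ℤ.* j) ⟩
    - ⟦ + suc m ℤ.* j ⟧       ≈⟨ -‿cong (pos-*-homo (suc m) j) ⟩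
    - (suc m · 1# * ⟦ j ⟧)    ≈⟨ -‿distribˡ-* _ _ ⟩
    - (suc m · 1#) * ⟦ j ⟧    ∎

  ℤ-rawRing : RawRing _ _
  ℤ-rawRing = CommutativeRing.rawRing ℤ.+-*-commutativeRing

  homomorphism : ℤ-rawRing -Raw-AlmostCommutative⟶ fromCommutativeRing R
  homomorphism = record
    { ⟦_⟧    = ⟦_⟧
    ; +-homo = +-homo
    ; *-homo = *-homo
    ; -‿homo = neg-homo
    ; 0-homo = refl
    ; 1-homo = refl
    }

  ≟-coefficients : ∀ i j → Maybe (⟦ i ⟧ ≈ ⟦ j ⟧)
  ≟-coefficients i j with i ℤ.≟ j
  ... | yes i≡j = just (reflexive (≡.cong ⟦_⟧ i≡j))
  ... | no _    = nothing

  open RingSolver ℤ-rawRing (fromCommutativeRing R) homomorphism ≟-coefficients public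
    using (solve; _:=_; _:+_; _:*_; _:-_; :-_; con)

-- Ordered fields and signs

module OrderedFieldProperties {c ℓ₁ ℓ₂} (F : OrderedField c ℓ₁ ℓ₂) where
  open OrderedField F public
  open IntegerCoefficients commutativeRing public using (solve; _:=_; _:+_; _:*_; _:-_; :-_; con)
  open IsStrictTotalOrder isStrictTotalOrder using () renaming (trans to <-trans; irrefl to <-irrefl)

  ≤-refl : ∀ {x} → x ≤ x
  ≤-refl = inj₂ refl

  -0≈0 : ∀ {x} → x ≈ 0# → - x ≈ 0#
  -0≈0 e = trans (-‿cong e) (solve 0 (:- con 0ℤ := con 0ℤ) refl)

  0<-resp-≈ : ∀ {x y} → x ≈ y → 0# < x → 0# < y
  0<-resp-≈ = <-respʳ-≈

  0<⇒≉0 : ∀ {x} → 0# < x → ¬ (x ≈ 0#)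
  0<⇒≉0 0<x x≈0 = <-irrefl (sym x≈0) 0<x

  <⇒0<- : ∀ {x y} → x < y → 0# < y - x
  <⇒0<- {x} {y} x<y = <-respˡ-≈ (-‿inverseʳ x) (+-monoˡ-< (- x) x<y)

  0<-⇒< : ∀ {x y} → 0# < y - x → x < y
  0<-⇒< {x} {y} 0<y-x = <-respˡ-≈ (+-identityˡ x)
    (<-respʳ-≈ (solve 2 (λ x y → y :- x :+ x := y) refl x y) (+-monoˡ-< x 0<y-x))

  +-pos : ∀ {x y} → 0# < x → 0# < y → 0# < x + y
  +-pos {x} {y} 0<x 0<y = <-trans 0<y (<-respˡ-≈ (+-identityˡ y) (+-monoˡ-< y 0<x))

  0<∧0<-⇒⊥ : ∀ {x} → 0# < x → 0# < - x → ⊥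
  0<∧0<-⇒⊥ {x} 0<x 0<-x = 0<⇒≉0 (+-pos 0<x 0<-x) (-‿inverseʳ x)

  -- Evidence for a value of `sgn`, kept as an inequality that arithmetic lemmas can consume. A
  -- negative `x` is recorded through `- x`, so that every strict case is a positivity.
  data SignOf (x : Carrier) : ℤ → Set (ℓ₁ Level.⊔ ℓ₂) where
    positive : 0# < x → SignOf x 1ℤ
    null     : x ≈ 0# → SignOf x 0ℤ
    negative : 0# < - x → SignOf x -1ℤ

  <0⇒0<- : ∀ {x} → x < 0# → 0# < - x
  <0⇒0<- {x} x<0 = 0<-resp-≈ (+-identityˡ (- x)) (<⇒0<- x<0)

  signOf : ∀ x → ∃[ i ] SignOf x i
  signOf x with compare 0# x
  ... | tri< 0<x _ _ = _ , positive 0<x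
  ... | tri≈ _ 0≈x _ = _ , null (sym 0≈x)
  ... | tri> _ _ x<0 = _ , negative (<0⇒0<- x<0)

  SignOf-resp-≈ : ∀ {x y i} → x ≈ y → SignOf x i → SignOf y i
  SignOf-resp-≈ x≈y (positive p) = positive (0<-resp-≈ x≈y p)
  SignOf-resp-≈ x≈y (null p)     = null (trans (sym x≈y) p)
  SignOf-resp-≈ x≈y (negative p) = negative (0<-resp-≈ (-‿cong x≈y) p)

  SignOf-unique : ∀ {x i j} → SignOf x i → SignOf x j → i ≡ j
  SignOf-unique (positive p) (positive q) = ≡.refl
  SignOf-unique (positive p) (null q)     = ⊥-elim (0<⇒≉0 p q)
  SignOf-unique (positive p) (negative q) = ⊥-elim (0<∧0<-⇒⊥ p q)
  SignOf-unique (null p)     (positive q) = ⊥-elim (0<⇒≉0 q p)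
  SignOf-unique (null p)     (null q)     = ≡.refl
  SignOf-unique {x} (null p) (negative q) = ⊥-elim (0<⇒≉0 q (-0≈0 p))
  SignOf-unique (negative p) (positive q) = ⊥-elim (0<∧0<-⇒⊥ q p)
  SignOf-unique (negative p) (null q)     = ⊥-elim (0<⇒≉0 p (-0≈0 q))
  SignOf-unique (negative p) (negative q) = ≡.refl

  SignOf-neg : ∀ {x i} → SignOf x i → SignOf (- x) (ℤ.- i)
  SignOf-neg {x} (positive p) = negative (0<-resp-≈ (solve 1 (λ x → x := :- (:- x)) refl x) p)
  SignOf-neg {x} (null p)     = null (-0≈0 p)
  SignOf-neg     (negative p) = positive p

  square-nonneg : ∀ x → 0# ≤ x * x
  square-nonneg x with signOf x
  ... | _ , positive p = inj₁ (*-pos p p)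
  ... | _ , null p     = inj₂ (sym (trans (*-congʳ p) (zeroˡ x)))
  ... | _ , negative p = inj₁ (0<-resp-≈ (solve 1 (λ x → :- x :* :- x := x :* x) refl x) (*-pos p p))

  square-pos : ∀ {x} → ¬ (x ≈ 0#) → 0# < x * x
  square-pos {x} x≉0 with signOf x
  ... | _ , positive p = *-pos p p
  ... | _ , null p     = ⊥-elim (x≉0 p)
  ... | _ , negative p = 0<-resp-≈ (solve 1 (λ x → :- x :* :- x := x :* x) refl x) (*-pos p p)

  +-pos-nonneg : ∀ {x y} → 0# < x → 0# ≤ y → 0# < x + y
  +-pos-nonneg 0<x (inj₁ 0<y) = +-pos 0<x 0<y
  +-pos-nonneg 0<x (inj₂ 0≈y) = 0<-resp-≈ (sym (trans (+-congˡ (sym 0≈y)) (+-identityʳ _))) 0<x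

  +-nonneg : ∀ {x y} → 0# ≤ x → 0# ≤ y → 0# ≤ x + y
  +-nonneg (inj₁ p) q = inj₁ (+-pos-nonneg p q)
  +-nonneg (inj₂ p) q = ≤-respʳ-≈ (trans (sym (+-identityˡ _)) (+-congʳ p)) q

  *-nonneg : ∀ {x y} → 0# ≤ x → 0# ≤ y → 0# ≤ x * y
  *-nonneg (inj₁ p) (inj₁ q) = inj₁ (*-pos p q)
  *-nonneg (inj₁ p) (inj₂ q) = inj₂ (sym (trans (*-congˡ (sym q)) (zeroʳ _)))
  *-nonneg (inj₂ p) q        = inj₂ (sym (trans (*-congʳ (sym p)) (zeroˡ _)))

  ≤⇒0≤- : ∀ {x y} → x ≤ y → 0# ≤ y - x
  ≤⇒0≤- (inj₁ p) = inj₁ (<⇒0<- p)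
  ≤⇒0≤- {x} {y} (inj₂ p) = inj₂ (sym (trans (+-congˡ (-‿cong p)) (-‿inverseʳ y)))

  0≤-⇒≤ : ∀ {x y} → 0# ≤ y - x → x ≤ y
  0≤-⇒≤ (inj₁ p) = inj₁ (0<-⇒< p)
  0≤-⇒≤ {x} {y} (inj₂ p) = inj₂ (sym (trans (solve 2 (λ x y → y := y :- x :+ x) refl x y) (trans (+-congʳ (sym p)) (+-identityˡ x))))

  ⁻¹-inverseˡ : ∀ {x} → ¬ (x ≈ 0#) → x ⁻¹ * x ≈ 1#
  ⁻¹-inverseˡ x≉0 = trans (*-comm _ _) (⁻¹-inverseʳ x≉0)

  1≉0 : ¬ (1# ≈ 0#)
  1≉0 = 0<⇒≉0 0<1

  ⁻¹-pos : ∀ {x} → 0# < x → 0# < x ⁻¹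
  ⁻¹-pos {x} 0<x with signOf (x ⁻¹)
  ... | _ , positive p = p
  ... | _ , null p     = ⊥-elim (1≉0 (trans (sym (⁻¹-inverseʳ (0<⇒≉0 0<x))) (trans (*-congˡ p) (zeroʳ x))))
  ... | _ , negative p = ⊥-elim (0<∧0<-⇒⊥ 0<1 (0<-resp-≈
      (trans (solve 2 (λ x y → x :* (:- y) := :- (x :* y)) refl x (x ⁻¹)) (-‿cong (⁻¹-inverseʳ (0<⇒≉0 0<x))))
      (*-pos 0<x p)))

  0<½ : 0# < (1# + 1#) ⁻¹
  0<½ = ⁻¹-pos (+-pos 0<1 0<1)

  ½+½≈1 : (1# + 1#) ⁻¹ + (1# + 1#) ⁻¹ ≈ 1#
  ½+½≈1 = trans (solve 1 (λ h → h :+ h := (con 1ℤ :+ con 1ℤ) :* h) refl ((1# + 1#) ⁻¹)) (⁻¹-inverseʳ (0<⇒≉0 (+-pos 0<1 0<1)))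

  half : ∀ {x} → 0# < x → ∃[ y ] (0# < y × y < x)
  half {x} 0<x = x * ½ , *-pos 0<x 0<½ , 0<-⇒< (0<-resp-≈ eq (*-pos 0<x 0<½))
    where
    ½ = (1# + 1#) ⁻¹
    eq : x * ½ ≈ x - x * ½
    eq = trans (solve 2 (λ x h → x :* h := x :* (h :+ h) :- x :* h) refl x ½)
               (+-congʳ (trans (*-congˡ ½+½≈1) (*-identityʳ x)))

  *-≈0 : ∀ {x} y → x ≈ 0# → y * x ≈ 0#
  *-≈0 y e = trans (*-congˡ e) (zeroʳ y)

  *-cancel-pos : ∀ {a x} → 0# < a → 0# < a * x → 0# < x
  *-cancel-pos {a} {x} 0<a 0<ax = 0<-resp-≈
    (trans (sym (*-assoc _ _ _)) (trans (*-congʳ (⁻¹-inverseˡ (0<⇒≉0 0<a))) (*-identityˡ x)))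
    (*-pos (⁻¹-pos 0<a) 0<ax)

  *-cancel-zero : ∀ {a x} → 0# < a → a * x ≈ 0# → x ≈ 0#
  *-cancel-zero {a} {x} 0<a e = trans (sym (trans (sym (*-assoc _ _ _))
    (trans (*-congʳ (⁻¹-inverseˡ (0<⇒≉0 0<a))) (*-identityˡ x)))) (trans (*-congˡ e) (zeroʳ _))

  -- Serves to compare the orientations of vectors that are positive multiples of each other: the
  -- polynomial identities available have positive factors on both sides.
  scaled-sign : ∀ {a b x y k} → 0# < a → 0# < b → a * x ≈ b * y → SignOf y k → SignOf x k
  scaled-sign 0<a 0<b e (positive p) = positive (*-cancel-pos 0<a (0<-resp-≈ (sym e) (*-pos 0<b p)))
  scaled-sign {b = b} 0<a 0<b e (null p) = null (*-cancel-zero 0<a (trans e (*-≈0 b p)))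
  scaled-sign {a} {b} {x} {y} 0<a 0<b e (negative p) = negative (*-cancel-pos 0<a (0<-resp-≈
    (trans (solve 2 (λ b y → b :* (:- y) := :- (b :* y)) refl b y)
      (trans (-‿cong (sym e)) (solve 2 (λ a x → :- (a :* x) := a :* (:- x)) refl a x))) (*-pos 0<b p)))

  SignOf-* : ∀ {x y i j} → SignOf x i → SignOf y j → SignOf (x * y) (i ℤ.* j)
  SignOf-* (positive p) (positive q) = positive (*-pos p q)
  SignOf-* {x} {y} (positive p) (negative q) = negative (0<-resp-≈ (solve 2 (λ x y → x :* (:- y) := :- (x :* y)) refl x y) (*-pos p q))
  SignOf-* {x} {y} (negative p) (positive q) = negative (0<-resp-≈ (solve 2 (λ x y → (:- x) :* y := :- (x :* y)) refl x y) (*-pos p q))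
  SignOf-* {x} {y} (negative p) (negative q) = positive (0<-resp-≈ (solve 2 (λ x y → (:- x) :* (:- y) := x :* y) refl x y) (*-pos p q))
  SignOf-* (null p)     (positive q) = null (trans (*-congʳ p) (zeroˡ _))
  SignOf-* (null p)     (null q)     = null (trans (*-congʳ p) (zeroˡ _))
  SignOf-* (null p)     (negative q) = null (trans (*-congʳ p) (zeroˡ _))
  SignOf-* (positive p) (null q)     = null (*-≈0 _ q)
  SignOf-* (negative p) (null q)     = null (*-≈0 _ q)

-- Statements about all sufficiently small positive scalars

module EventuallyProperties {c ℓ₁ ℓ₂} (F : OrderedField c ℓ₁ ℓ₂) where
  open OrderedFieldProperties F
  open Plabic F using (Eventually)
  open IsStrictTotalOrder isStrictTotalOrder using () renaming (trans to <-trans)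

  private variable
    p q : Level
    P : Pred Carrier p
    Q : Pred Carrier q

  always : (∀ ε → 0# < ε → P ε) → Eventually P
  always f = 1# , 0<1 , λ ε 0<ε _ → f ε 0<ε

  eventually-map : (∀ ε → 0# < ε → P ε → Q ε) → Eventually P → Eventually Q
  eventually-map f (η , 0<η , g) = η , 0<η , λ ε 0<ε ε<η → f ε 0<ε (g ε 0<ε ε<η)

  eventually-× : Eventually P → Eventually Q → Eventually (λ ε → P ε × Q ε)
  eventually-× (η , 0<η , f) (θ , 0<θ , g) with compare η θ
  ... | tri< η<θ _ _ = η , 0<η , λ ε 0<ε ε<η → f ε 0<ε ε<η , g ε 0<ε (<-trans ε<η η<θ)
  ... | tri≈ _ η≈θ _ = η , 0<η , λ ε 0<ε ε<η → f ε 0<ε ε<η , g ε 0<ε (<-respʳ-≈ η≈θ ε<η)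
  ... | tri> _ _ θ<η = θ , 0<θ , λ ε 0<ε ε<θ → f ε 0<ε (<-trans ε<θ θ<η) , g ε 0<ε ε<θ

  eventually-∃ : Eventually P → ∃[ ε ] (0# < ε × P ε)
  eventually-∃ (η , 0<η , f) with half 0<η
  ... | ε , 0<ε , ε<η = ε , 0<ε , f ε 0<ε ε<η

  -- Finiteness of the family keeps the common bound positive.
  eventually-∀ : ∀ {n} {P : Fin n → Pred Carrier p} →
                 (∀ i → Eventually (P i)) → Eventually (λ ε → ∀ i → P i ε)
  eventually-∀ {n = zero}  f = always λ _ _ ()
  eventually-∀ {n = suc n} f =
    eventually-map (λ { _ _ (p , q) Fin.zero → p ; _ _ (p , q) (Fin.suc i) → q i })
      (eventually-× (f Fin.zero) (eventually-∀ λ i → f (Fin.suc i)))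

  eventually-< : ∀ {a} → 0# < a → Eventually (_< a)
  eventually-< {a} 0<a = a , 0<a , λ _ _ ε<a → ε<a

  eventually-pos : ∀ {a} b → 0# < a → Eventually (λ ε → 0# < a + ε * b)
  eventually-pos {a} b 0<a with signOf b
  ... | _ , positive 0<b = always λ ε 0<ε → +-pos 0<a (*-pos 0<ε 0<b)
  ... | _ , null b≈0     = always λ ε _ → 0<-resp-≈ (sym (trans (+-congˡ (trans (*-congˡ b≈0) (zeroʳ ε))) (+-identityʳ a))) 0<a
  -- With a negative slope the affine function is positive up to its zero `a * (- b) ⁻¹`, which is
  -- the bound.
  ... | _ , negative 0<-b = a * i , *-pos 0<a (⁻¹-pos 0<-b) , λ ε 0<ε ε<η →
      0<-resp-≈ (trans (solve 4 (λ a i b ε → (a :* i :- ε) :* (:- b) := a :* (:- b :* i) :+ ε :* b) refl a i b ε)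
                       (+-congʳ (trans (*-congˡ (⁻¹-inverseʳ (0<⇒≉0 0<-b))) (*-identityʳ a))))
                (*-pos (<⇒0<- ε<η) 0<-b)
    where i = (- b) ⁻¹

-- Crossings of a segment with a fixed ray from the origin

module CrossingParity {c ℓ₁ ℓ₂} (F : OrderedField c ℓ₁ ℓ₂) where
  open OrderedFieldProperties F
  open Plabic F

  -ₚ_ : Point → Point
  -ₚ (x , y) = - x , - y

  dot : Point → Point → Carrier
  dot (x , y) (x′ , y′) = x * x′ + y * y′

  -- Only one half of the boundary line is included, so that exactly one of
  -- v and - v is Up, for v ≉ 0.
  Up : Point → Set (ℓ₁ ⊔ ℓ₂)
  Up (x , y) = 0# < y ⊎ y ≈ 0# × 0# < x

  up? : ∀ v → Dec (Up v)
  up? (x , y) = 0# <? y ⊎-dec (y ≈? 0# ×-dec 0# <? x)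

  Up-resp-≈ : ∀ {u v} → u ≈ₚ v → Up u → Up v
  Up-resp-≈ (_ , y≈) (inj₁ p)        = inj₁ (0<-resp-≈ y≈ p)
  Up-resp-≈ (x≈ , y≈) (inj₂ (p , q)) = inj₂ (trans (sym y≈) p , 0<-resp-≈ x≈ q)

  Up-+ : ∀ {u v} → Up u → Up v → Up (u +ₚ v)
  Up-+ (inj₁ p) (inj₁ q)       = inj₁ (+-pos p q)
  Up-+ (inj₁ p) (inj₂ (q , _)) = inj₁ (0<-resp-≈ (sym (trans (+-congˡ q) (+-identityʳ _))) p)
  Up-+ (inj₂ (p , _)) (inj₁ q) = inj₁ (0<-resp-≈ (sym (trans (+-congʳ p) (+-identityˡ _))) q)
  Up-+ (inj₂ (p , r)) (inj₂ (q , s)) = inj₂ (trans (+-cong p q) (+-identityˡ 0#) , +-pos r s)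

  Up-* : ∀ {t v} → 0# < t → Up v → Up (t *ₚ v)
  Up-* 0<t (inj₁ p)       = inj₁ (*-pos 0<t p)
  Up-* 0<t (inj₂ (p , q)) = inj₂ (trans (*-congˡ p) (zeroʳ _) , *-pos 0<t q)

  ¬Up-origin : ∀ {v} → v ≈ₚ origin → ¬ Up v
  ¬Up-origin (_ , y≈0) (inj₁ p)       = 0<⇒≉0 p y≈0
  ¬Up-origin (x≈0 , _) (inj₂ (_ , p)) = 0<⇒≉0 p x≈0

  ¬Up⇒Up- : ∀ v → ¬ Up v → v ≈ₚ origin ⊎ Up (-ₚ v)
  ¬Up⇒Up- (x , y) ¬up with signOf y
  ... | _ , positive p = ⊥-elim (¬up (inj₁ p))
  ... | _ , negative p = inj₂ (inj₁ p)
  ... | _ , null y≈0 with signOf x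
  ...   | _ , positive q = ⊥-elim (¬up (inj₂ (y≈0 , q)))
  ...   | _ , null x≈0   = inj₁ (x≈0 , y≈0)
  ...   | _ , negative q = inj₂ (inj₂ (-0≈0 y≈0 , q))

  -- A segment that changes half planes meets the dividing line on one side of the origin. It is the
  -- positive side exactly when the segment runs counterclockwise about the origin on its way up, or
  -- clockwise on its way down.
  cutᵇ : Bool → Bool → Bool → Bool
  cutᵇ up-u up-v ccw = (up-u xor up-v) ∧ not (ccw xor up-v)

  -- Whether the segment from u to v crosses the positive x-axis, tilted
  -- downwards by an infinitesimal angle; only meaningful if the segment
  -- avoids the origin.
  opaque
    cut : Point → Point → Bool
    cut u v = cutᵇ (does (up? u)) (does (up? v)) (does (0# <? cross u v))
  -- The coefficients are not normalised, which spares a division. Degenerate triangles and boundary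
  -- points are included, so the negation excludes every position in which `cut` would be
  -- meaningless.
  record OriginInTriangle (u v w : Point) : Set (c ⊔ ℓ₁ ⊔ ℓ₂) where
    constructor combination
    field
      α β γ   : Carrier
      0≤α     : 0# ≤ α
      0≤β     : 0# ≤ β
      0≤γ     : 0# ≤ γ
      0<sum   : 0# < α + β + γ
      vanishes : α *ₚ u +ₚ β *ₚ v +ₚ γ *ₚ w ≈ₚ origin

  swap₂₃ : ∀ {u v w} → OriginInTriangle u w v → OriginInTriangle u v w
  swap₂₃ (combination α β γ a b g s (ex , ey)) = combination α γ β a g b
    (0<-resp-≈ (solve 3 (λ α β γ → α :+ β :+ γ := α :+ γ :+ β) refl α β γ) s)
    (trans (solve 3 (λ α β γ → α :+ β :+ γ := α :+ γ :+ β) refl _ _ _) ex ,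
     trans (solve 3 (λ α β γ → α :+ β :+ γ := α :+ γ :+ β) refl _ _ _) ey)

  swap₁₂ : ∀ {u v w} → OriginInTriangle v u w → OriginInTriangle u v w
  swap₁₂ (combination α β γ a b g s (ex , ey)) = combination β α γ b a g
    (0<-resp-≈ (solve 3 (λ α β γ → α :+ β :+ γ := β :+ α :+ γ) refl α β γ) s)
    (trans (solve 3 (λ α β γ → α :+ β :+ γ := β :+ α :+ γ) refl _ _ _) ex ,
     trans (solve 3 (λ α β γ → α :+ β :+ γ := β :+ α :+ γ) refl _ _ _) ey)

  negate-all : ∀ {u v w} → OriginInTriangle (-ₚ u) (-ₚ v) (-ₚ w) → OriginInTriangle u v w
  negate-all {ux , uy} {vx , vy} {wx , wy} (combination α β γ a b g s (ex , ey)) = combination α β γ a b g s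
    (neg ex , neg ey)
    where
    neg : ∀ {u v w} → α * - u + β * - v + γ * - w ≈ 0# → α * u + β * v + γ * w ≈ 0#
    neg {u} {v} {w} e = trans
      (solve 6 (λ α β γ u v w → α :* u :+ β :* v :+ γ :* w := :- (α :* (:- u) :+ β :* (:- v) :+ γ :* (:- w))) refl α β γ u v w)
      (-0≈0 e)

  origin-corner : ∀ {u v w} → u ≈ₚ origin → OriginInTriangle u v w
  origin-corner {u} {v} {w} (ex , ey) = combination 1# 0# 0# (inj₁ 0<1) ≤-refl ≤-refl
    (0<-resp-≈ (solve 0 (con 1ℤ := con 1ℤ :+ con 0ℤ :+ con 0ℤ) refl) 0<1) (z ex , z ey)
    where
    z : ∀ {u v w} → u ≈ 0# → 1# * u + 0# * v + 0# * w ≈ 0#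
    z {u} {v} {w} e = trans (solve 3 (λ u v w → con 1ℤ :* u :+ con 0ℤ :* v :+ con 0ℤ :* w := u) refl u v w) e

  cross-anti : ∀ u v → - cross u v ≈ cross v u
  cross-anti (ux , uy) (vx , vy) =
    solve 4 (λ ux uy vx vy → :- (ux :* vy :- uy :* vx) := vx :* uy :- vy :* ux) refl ux uy vx vy

  -- Parallel vectors in opposite half planes point in opposite ways, so the origin lies between
  -- them. The weights are the second coordinates, or the first ones when both vectors lie on the
  -- axis.
  parallel-opposite : ∀ {m a w} → cross m a ≈ 0# → Up m → Up (-ₚ a) → OriginInTriangle m a w
  parallel-opposite {mx , my} {ax , ay} {wx , wy} par (inj₁ 0<my) up-a =
    combination (- ay) my 0# (0≤-ay up-a) (inj₁ 0<my) ≤-refl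
      (0<-resp-≈ (solve 2 (λ ay my → my :+ ay := ay :+ my :+ con 0ℤ) refl (- ay) my) (+-pos-nonneg 0<my (0≤-ay up-a)))
      ( trans (solve 5 (λ mx my ax ay wx → (:- ay) :* mx :+ my :* ax :+ con 0ℤ :* wx := :- (mx :* ay :- my :* ax)) refl mx my ax ay wx) (-0≈0 par)
      , solve 3 (λ my ay wy → (:- ay) :* my :+ my :* ay :+ con 0ℤ :* wy := con 0ℤ) refl my ay wy)
    where
    0≤-ay : Up (- ax , - ay) → 0# ≤ - ay
    0≤-ay (inj₁ p)       = inj₁ p
    0≤-ay (inj₂ (p , _)) = inj₂ (sym p)
  parallel-opposite {mx , my} {ax , ay} {wx , wy} par (inj₂ (my≈0 , 0<mx)) (inj₁ 0<-ay) =
    ⊥-elim (0<⇒≉0 (*-pos 0<mx 0<-ay) (trans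
      (solve 4 (λ mx my ax ay → mx :* (:- ay) := :- (mx :* ay :- my :* ax) :- my :* ax) refl mx my ax ay)
      (trans (+-cong (-0≈0 par) (-0≈0 (trans (*-congʳ my≈0) (zeroˡ ax)))) (+-identityˡ 0#))))
  parallel-opposite {mx , my} {ax , ay} {wx , wy} par (inj₂ (my≈0 , 0<mx)) (inj₂ (_ , 0<-ax)) =
    combination (- ax) mx 0# (inj₁ 0<-ax) (inj₁ 0<mx) ≤-refl
      (0<-resp-≈ (solve 2 (λ ax mx → ax :+ mx := ax :+ mx :+ con 0ℤ) refl (- ax) mx) (+-pos 0<-ax 0<mx))
      ( solve 3 (λ mx ax wx → (:- ax) :* mx :+ mx :* ax :+ con 0ℤ :* wx := con 0ℤ) refl mx ax wx
      , trans (solve 5 (λ mx my ax ay wy → (:- ax) :* my :+ mx :* ay :+ con 0ℤ :* wy := mx :* ay :- my :* ax) refl mx my ax ay wy) par)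

  -- Cramer's rule for three plane vectors. When the coefficients are nonnegative and not all zero,
  -- they place the origin in the triangle.
  plücker : ∀ m a b → cross a b *ₚ m +ₚ cross b m *ₚ a +ₚ cross m a *ₚ b ≈ₚ origin
  plücker (mx , my) (ax , ay) (bx , by) =
    solve 6 (λ mx my ax ay bx by →
      (ax :* by :- ay :* bx) :* mx :+ (bx :* my :- by :* mx) :* ax :+ (mx :* ay :- my :* ax) :* bx := con 0ℤ)
      refl mx my ax ay bx by ,
    solve 6 (λ mx my ax ay bx by →
      (ax :* by :- ay :* bx) :* my :+ (bx :* my :- by :* mx) :* ay :+ (mx :* ay :- my :* ax) :* by := con 0ℤ)
      refl mx my ax ay bx by

  straddle : ∀ {m a b} → Up m → Up (-ₚ a) → Up (-ₚ b) →
             0# < cross m a → 0# < cross b m → OriginInTriangle m a b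
  straddle {m@(mx , my)} {a@(ax , ay)} {b@(bx , by)} up-m up-a up-b ma bm with signOf (cross a b)
  ... | _ , positive ab = combination (cross a b) (cross b m) (cross m a) (inj₁ ab) (inj₁ bm) (inj₁ ma)
                            (+-pos (+-pos ab bm) ma) (plücker m a b)
  ... | _ , null ab     = combination (cross a b) (cross b m) (cross m a) (inj₂ (sym ab)) (inj₁ bm) (inj₁ ma)
                            (0<-resp-≈ (sym (trans (+-congʳ (trans (+-congʳ ab) (+-identityˡ _))) refl)) (+-pos bm ma))
                            (plücker m a b)
  -- Here the relation would write the origin as a positive combination of `m`, `-ₚ a` and `-ₚ b`,
  -- all of which are `Up`.
  ... | _ , negative ab = ⊥-elim (¬Up-origin
      ( trans (eq (cross a b) (cross b m) (cross m a) mx ax bx) (-0≈0 (proj₁ (plücker m a b)))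
      , trans (eq (cross a b) (cross b m) (cross m a) my ay by) (-0≈0 (proj₂ (plücker m a b))))
      (Up-+ (Up-+ (Up-* ab up-m) (Up-* bm up-a)) (Up-* ma up-b)))
    where
    eq : ∀ α β γ u v w → (- α) * u + β * - v + γ * - w ≈ - (α * u + β * v + γ * w)
    eq = solve 6 (λ α β γ u v w → (:- α) :* u :+ β :* (:- v) :+ γ :* (:- w) := :- (α :* u :+ β :* v :+ γ :* w)) refl

  SameSide : Point → Point → Point → Set ℓ₂
  SameSide m a b = 0# < cross m a × 0# < cross m b ⊎ 0# < cross a m × 0# < cross b m

  -- Both sides of the triangle at `m` cross the dividing line. Unless the triangle contains the
  -- origin they pass it on the same side, which shows in equal orientations.
  opposite′ : ∀ {m a b} → Up m → Up (-ₚ a) → Up (-ₚ b) →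
              OriginInTriangle m a b ⊎ SameSide m a b
  opposite′ {m} {a} {b} up-m up-a up-b with signOf (cross m a) | signOf (cross m b)
  ... | _ , null ma     | _ = inj₁ (parallel-opposite ma up-m up-a)
  ... | _ | _ , null mb     = inj₁ (swap₂₃ (parallel-opposite mb up-m up-b))
  ... | _ , positive ma | _ , positive mb = inj₂ (inj₁ (ma , mb))
  ... | _ , positive ma | _ , negative mb = inj₁ (straddle up-m up-a up-b ma (0<-resp-≈ (cross-anti m b) mb))
  ... | _ , negative ma | _ , positive mb = inj₁ (swap₂₃ (straddle up-m up-b up-a mb (0<-resp-≈ (cross-anti m a) ma)))
  ... | _ , negative ma | _ , negative mb = inj₂ (inj₂ (0<-resp-≈ (cross-anti m a) ma , 0<-resp-≈ (cross-anti m b) mb))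

  opposite⁺ : ∀ {m a b} → Up m → ¬ Up a → ¬ Up b → OriginInTriangle m a b ⊎ SameSide m a b
  opposite⁺ {m} {a} {b} up-m ¬up-a ¬up-b with ¬Up⇒Up- a ¬up-a | ¬Up⇒Up- b ¬up-b
  ... | inj₁ a≈0 | _        = inj₁ (swap₁₂ (origin-corner a≈0))
  ... | inj₂ _   | inj₁ b≈0 = inj₁ (swap₂₃ (swap₁₂ (origin-corner b≈0)))
  ... | inj₂ up-a | inj₂ up-b = opposite′ up-m up-a up-b

  -‿-‿ₚ : ∀ u → u ≈ₚ -ₚ (-ₚ u)
  -‿-‿ₚ (x , y) = solve 1 (λ x → x := :- (:- x)) refl x , solve 1 (λ x → x := :- (:- x)) refl y

  cross-neg : ∀ u v → cross (-ₚ u) (-ₚ v) ≈ cross u v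
  cross-neg (ux , uy) (vx , vy) =
    solve 4 (λ ux uy vx vy → (:- ux) :* (:- vy) :- (:- uy) :* (:- vx) := ux :* vy :- uy :* vx) refl ux uy vx vy

  opposite⁻ : ∀ {m a b} → ¬ Up m → Up a → Up b → OriginInTriangle m a b ⊎ SameSide m a b
  opposite⁻ {m} {a} {b} ¬up-m up-a up-b with ¬Up⇒Up- m ¬up-m
  ... | inj₁ m≈0 = inj₁ (origin-corner m≈0)
  ... | inj₂ up-m with opposite′ { -ₚ m} { -ₚ a} { -ₚ b} up-m (Up-resp-≈ (-‿-‿ₚ a) up-a) (Up-resp-≈ (-‿-‿ₚ b) up-b)
  ...   | inj₁ t              = inj₁ (negate-all t)
  ...   | inj₂ (inj₁ (p , q)) = inj₂ (inj₁ (0<-resp-≈ (cross-neg m a) p , 0<-resp-≈ (cross-neg m b) q))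
  ...   | inj₂ (inj₂ (p , q)) = inj₂ (inj₂ (0<-resp-≈ (cross-neg a m) p , 0<-resp-≈ (cross-neg b m) q))

  <?-true : ∀ {x} → 0# < x → does (0# <? x) ≡ true
  <?-true {x} = dec-true (0# <? x)

  cross<?-false : ∀ u v → 0# < cross v u → does (0# <? cross u v) ≡ false
  cross<?-false u v p = dec-false (0# <? cross u v) λ q → 0<∧0<-⇒⊥ q (0<-resp-≈ (sym (cross-anti u v)) p)

  SameSide⇒ : ∀ {m a b} → SameSide m a b → does (0# <? cross m a) ≡ does (0# <? cross m b)
  SameSide⇒ (inj₁ (p , q)) = ≡.trans (<?-true p) (≡.sym (<?-true q))
  SameSide⇒ {m} {a} {b} (inj₂ (p , q)) = ≡.trans (cross<?-false m a p) (≡.sym (cross<?-false m b q))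

  SameSide⇒ʳ : ∀ {m a b} → SameSide m a b → does (0# <? cross a m) ≡ does (0# <? cross b m)
  SameSide⇒ʳ (inj₂ (p , q)) = ≡.trans (<?-true p) (≡.sym (<?-true q))
  SameSide⇒ʳ {m} {a} {b} (inj₁ (p , q)) = ≡.trans (cross<?-false a m p) (≡.sym (cross<?-false b m q))

  SameSide⇒ᵐ : ∀ {m a b} → SameSide m a b → does (0# <? cross a m) ≡ not (does (0# <? cross m b))
  SameSide⇒ᵐ {m} {a} {b} (inj₁ (p , q)) = ≡.trans (cross<?-false a m p) (≡.cong not (≡.sym (<?-true q)))
  SameSide⇒ᵐ {m} {a} {b} (inj₂ (p , q)) = ≡.trans (<?-true p) (≡.cong not (≡.sym (cross<?-false m b q)))

  opaque
    unfolding cut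

    -- Either no side or exactly two sides of a triangle change half planes. Two such sides share
    -- the vertex that is alone in its half plane, and they pass the origin on the same side, so the
    -- ray meets both or neither.
    cut-triangle : ∀ {u v w} → ¬ OriginInTriangle u v w → cut u w ≡ cut u v xor cut v w
    cut-triangle {u} {v} {w} ¬0 = cases (up? u) (up? v) (up? w)
      where
      uv vw uw : Bool
      uv = does (0# <? cross u v)
      vw = does (0# <? cross v w)
      uw = does (0# <? cross u w)

      from-u : OriginInTriangle u v w ⊎ SameSide u v w → uv ≡ uw
      from-u = [ (λ t → contradiction t ¬0) , SameSide⇒ ]′

      from-v : OriginInTriangle v u w ⊎ SameSide v u w → uv ≡ not vw
      from-v = [ (λ t → contradiction (swap₁₂ t) ¬0) , SameSide⇒ᵐ ]′

      from-w : OriginInTriangle w u v ⊎ SameSide w u v → uw ≡ vw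
      from-w = [ (λ t → contradiction (swap₂₃ (swap₁₂ t)) ¬0) , SameSide⇒ʳ ]′

      xor-falseʳ : ∀ b → b ≡ b xor false
      xor-falseʳ true  = ≡.refl
      xor-falseʳ false = ≡.refl

      cases : (du : Dec (Up u)) (dv : Dec (Up v)) (dw : Dec (Up w)) →
              cutᵇ (does du) (does dw) uw ≡
              cutᵇ (does du) (does dv) uv xor cutᵇ (does dv) (does dw) vw
      cases (yes _)  (yes _)  (yes _)  = ≡.refl
      cases (no _)   (no _)   (no _)   = ≡.refl
      cases (yes pu) (no pv)  (no pw)  =
        ≡.trans (≡.cong (cutᵇ true false) (≡.sym (from-u (opposite⁺ pu pv pw)))) (xor-falseʳ _)
      cases (no pu)  (yes pv) (yes pw) =
        ≡.trans (≡.cong (cutᵇ false true) (≡.sym (from-u (opposite⁻ pu pv pw)))) (xor-falseʳ _)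
      cases (no pu)  (yes pv) (no pw)  = ≡.sym (≡.trans
        (≡.cong (λ b → cutᵇ false true b xor cutᵇ true false vw) (from-v (opposite⁺ pv pu pw))) (cancel vw))
        where
        cancel : ∀ b → cutᵇ false true (not b) xor cutᵇ true false b ≡ false
        cancel true  = ≡.refl
        cancel false = ≡.refl
      cases (yes pu) (no pv)  (yes pw) = ≡.sym (≡.trans
        (≡.cong (λ b → cutᵇ true false b xor cutᵇ false true vw) (from-v (opposite⁻ pv pu pw))) (cancel vw))
        where
        cancel : ∀ b → cutᵇ true false (not b) xor cutᵇ false true b ≡ false
        cancel true  = ≡.refl
        cancel false = ≡.refl
      cases (no pu)  (no pv)  (yes pw) = ≡.cong (cutᵇ false true) (from-w (opposite⁺ pw pu pv))
      cases (yes pu) (yes pv) (no pw)  = ≡.cong (cutᵇ true false) (from-w (opposite⁻ pw pu pv))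

  Meet : (p q x y : Point) → Set (c ⊔ ℓ₁ ⊔ ℓ₂)
  Meet p q x y = ∃[ z ] (z ∈[ p , q ] × z ∈[ x , y ])

  -- `N` is a common denominator: the weights of an `OriginInTriangle` can be used as they stand,
  -- and the division is carried out here once.
  weights⇒Meet : ∀ p q x y {N s t} → 0# < N →
    0# ≤ s → 0# ≤ N - s → 0# ≤ t → 0# ≤ N - t →
    N *ₚ (p -ₚ x) +ₚ s *ₚ (q -ₚ p) ≈ₚ t *ₚ (y -ₚ x) → Meet p q x y
  weights⇒Meet p@(px , py) q@(qx , qy) x@(xx , xy) y@(yx , yy) {N} {s} {t} 0<N 0≤s s≤N 0≤t t≤N (ex , ey) =
    along p q (s * N ⁻¹) ,
    (s * N ⁻¹ , *-nonneg 0≤s 0≤i , le s≤N , refl , refl) ,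
    (t * N ⁻¹ , *-nonneg 0≤t 0≤i , le t≤N , eq ex , eq ey)
    where
    i = N ⁻¹
    Ni = ⁻¹-inverseʳ (0<⇒≉0 0<N)

    0≤i : 0# ≤ i
    0≤i = inj₁ (⁻¹-pos 0<N)

    le : ∀ {s} → 0# ≤ N - s → s * i ≤ 1#
    le {s} h = 0≤-⇒≤ (≤-respʳ-≈
      (trans (solve 3 (λ N s i → (N :- s) :* i := N :* i :- s :* i) refl N s i) (+-congʳ Ni)) (*-nonneg h 0≤i))

    eq : ∀ {p q x y} → N * (p - x) + s * (q - p) ≈ t * (y - x) →
         p + s * i * (q - p) ≈ x + t * i * (y - x)
    eq {p} {q} {x} {y} e = trans (trans (+-congʳ (trans
        (solve 2 (λ p x → p := x :+ con 1ℤ :* (p :- x)) refl p x) (+-congˡ (*-congʳ (sym Ni)))))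
        (solve 6 (λ p q x s N i → x :+ (N :* i) :* (p :- x) :+ s :* i :* (q :- p) :=
                                  x :+ i :* (N :* (p :- x) :+ s :* (q :- p))) refl p q x s N i))
        (trans (+-congˡ (*-congˡ e))
          (solve 5 (λ x y t N i → x :+ i :* (t :* (y :- x)) := x :+ t :* i :* (y :- x)) refl x y t N i))

  -- The four differences form a parallelogram, which the diagonal from `p -ₚ x` to `q -ₚ y` splits
  -- into two triangles. A triangle containing the origin would yield a common point of the two
  -- segments. So `cut-triangle` evaluates the diagonal in two ways.
  cut-parallelogram : ∀ p q x y → ¬ Meet p q x y →
    cut (p -ₚ x) (q -ₚ x) xor cut (p -ₚ y) (q -ₚ y) ≡
    cut (p -ₚ x) (p -ₚ y) xor cut (q -ₚ x) (q -ₚ y)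
  cut-parallelogram p q x y disjoint =
    lemma (cut (p -ₚ x) (q -ₚ x)) (cut (p -ₚ y) (q -ₚ y)) (cut (p -ₚ x) (p -ₚ y)) (cut (q -ₚ x) (q -ₚ y))
      (≡.trans (≡.sym (cut-triangle {p -ₚ x} {q -ₚ x} {q -ₚ y} lower)) (cut-triangle {p -ₚ x} {p -ₚ y} {q -ₚ y} upper))
    where
    0≤-split : ∀ {α β γ} → 0# ≤ α → 0# ≤ α + β + γ - (β + γ)
    0≤-split {α} {β} {γ} = ≤-respʳ-≈ (solve 3 (λ α β γ → α := α :+ β :+ γ :- (β :+ γ)) refl α β γ)

    lower : ¬ OriginInTriangle (p -ₚ x) (q -ₚ x) (q -ₚ y)
    lower (combination α β γ a b g s (ex , ey)) = disjoint
      (weights⇒Meet p q x y s (+-nonneg b g) (0≤-split a) g (0≤-sum (+-nonneg a b)) (eq ex , eq ey))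
      where
      0≤-sum : 0# ≤ α + β → 0# ≤ α + β + γ - γ
      0≤-sum = ≤-respʳ-≈ (solve 2 (λ u γ → u := u :+ γ :- γ) refl (α + β) γ)
      eq : ∀ {p q x y} → α * (p - x) + β * (q - x) + γ * (q - y) ≈ 0# →
           (α + β + γ) * (p - x) + (β + γ) * (q - p) ≈ γ * (y - x)
      eq {p} {q} {x} {y} e = trans (solve 7 (λ α β γ p q x y →
        (α :+ β :+ γ) :* (p :- x) :+ (β :+ γ) :* (q :- p) :=
        (α :* (p :- x) :+ β :* (q :- x) :+ γ :* (q :- y)) :+ γ :* (y :- x)) refl α β γ p q x y)
        (trans (+-congʳ e) (+-identityˡ _))

    upper : ¬ OriginInTriangle (p -ₚ x) (p -ₚ y) (q -ₚ y)
    upper (combination α β γ a b g s (ex , ey)) = disjoint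
      (weights⇒Meet p q x y s g (0≤-sum (+-nonneg a b)) (+-nonneg b g) (0≤-split a) (eq ex , eq ey))
      where
      0≤-sum : 0# ≤ α + β → 0# ≤ α + β + γ - γ
      0≤-sum = ≤-respʳ-≈ (solve 2 (λ u γ → u := u :+ γ :- γ) refl (α + β) γ)
      eq : ∀ {p q x y} → α * (p - x) + β * (p - y) + γ * (q - y) ≈ 0# →
           (α + β + γ) * (p - x) + γ * (q - p) ≈ (β + γ) * (y - x)
      eq {p} {q} {x} {y} e = trans (solve 7 (λ α β γ p q x y →
        (α :+ β :+ γ) :* (p :- x) :+ γ :* (q :- p) :=
        (α :* (p :- x) :+ β :* (p :- y) :+ γ :* (q :- y)) :+ (β :+ γ) :* (y :- x)) refl α β γ p q x y)
        (trans (+-congʳ e) (+-identityˡ _))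

    lemma : ∀ a b c d → a xor d ≡ c xor b → a xor b ≡ c xor d
    lemma false false false false _ = ≡.refl
    lemma false false true  true  _ = ≡.refl
    lemma false true  false true  _ = ≡.refl
    lemma false true  true  false _ = ≡.refl
    lemma true  false false true  _ = ≡.refl
    lemma true  false true  false _ = ≡.refl
    lemma true  true  false false _ = ≡.refl
    lemma true  true  true  true  _ = ≡.refl

  -- The origin is a proper convex combination of the vertices of the
  -- parallelogram, whose boundary u → v → v′ → u′ runs counterclockwise
  -- around it.  So the sides neither all stay on one half plane nor, by
  -- v - u = v′ - u′, alternate between the half planes.
  opaque
    unfolding cut

    cut-crossing : ∀ p q x y {s t} → 0# < s → 0# < 1# - s → 0# < t → 0# < 1# - t →
      along p q s ≈ₚ along x y t →
      0# < cross (p -ₚ x) (q -ₚ x) → 0# < cross (q -ₚ x) (q -ₚ y) →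
      0# < cross (q -ₚ y) (p -ₚ y) → 0# < cross (p -ₚ y) (p -ₚ x) →
      cut (p -ₚ x) (q -ₚ x) xor cut (p -ₚ y) (q -ₚ y) ≡
      not (cut (p -ₚ x) (p -ₚ y) xor cut (q -ₚ x) (q -ₚ y))
    cut-crossing p@(px , py) q@(qx , qy) x@(xx , xy) y@(yx , yy) {s} {t} 0<s s<1 0<t t<1 (ex , ey) uv vv′ v′u′ u′u =
      ≡.trans (≡.cong₂ _xor_ (cut≡ u v (<?-true uv)) (cut≡ u′ v′ (cross<?-false u′ v′ v′u′)))
        (≡.trans (cases (up? u) (up? v) (up? u′) (up? v′)) (≡.cong not (≡.sym
          (≡.cong₂ _xor_ (cut≡ u u′ (cross<?-false u u′ u′u)) (cut≡ v v′ (<?-true vv′))))))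
      where
      u v u′ v′ : Point
      u = p -ₚ x
      v = q -ₚ x
      u′ = p -ₚ y
      v′ = q -ₚ y

      cut≡ : ∀ u v {ccw} → does (0# <? cross u v) ≡ ccw →
             cut u v ≡ cutᵇ (does (up? u)) (does (up? v)) ccw
      cut≡ u v = ≡.cong (cutᵇ (does (up? u)) (does (up? v)))

      -- The products of the weights of `p`, `q` with those of `x`, `y` combine the four vertices to
      -- the difference of the two coinciding points.
      bary-eq : ∀ {p q x y} → p + s * (q - p) ≈ x + t * (y - x) →
        (1# - s) * (1# - t) * (p - x) + s * (1# - t) * (q - x) +
        ((1# - s) * t * (p - y) + s * t * (q - y)) ≈ 0#
      bary-eq {p} {q} {x} {y} e = trans (solve 6 (λ s t p q x y →
        (con 1ℤ :- s) :* (con 1ℤ :- t) :* (p :- x) :+ s :* (con 1ℤ :- t) :* (q :- x) :+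
        ((con 1ℤ :- s) :* t :* (p :- y) :+ s :* t :* (q :- y)) :=
        (p :+ s :* (q :- p)) :- (x :+ t :* (y :- x))) refl s t p q x y)
        (trans (+-congʳ e) (-‿inverseʳ _))

      combo : Point → Point → Point → Point → Point
      combo u v u′ v′ = ((1# - s) * (1# - t)) *ₚ u +ₚ (s * (1# - t)) *ₚ v +ₚ
                        (((1# - s) * t) *ₚ u′ +ₚ (s * t) *ₚ v′)

      Up-combo : ∀ {u v u′ v′} → Up u → Up v → Up u′ → Up v′ → Up (combo u v u′ v′)
      Up-combo a b c d =
        Up-+ (Up-+ (Up-* (*-pos s<1 t<1) a) (Up-* (*-pos 0<s t<1) b))
             (Up-+ (Up-* (*-pos s<1 0<t) c) (Up-* (*-pos 0<s 0<t) d))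

      combo≈0 : combo u v u′ v′ ≈ₚ origin
      combo≈0 = bary-eq ex , bary-eq ey

      neg-eq : ∀ a b c d {u v u′ v′} → a * u + b * v + (c * u′ + d * v′) ≈ 0# →
               a * - u + b * - v + (c * - u′ + d * - v′) ≈ 0#
      neg-eq a b c d {u} {v} {u′} {v′} e = trans (solve 8 (λ a b c d u v u′ v′ →
        a :* (:- u) :+ b :* (:- v) :+ (c :* (:- u′) :+ d :* (:- v′)) :=
        :- (a :* u :+ b :* v :+ (c :* u′ :+ d :* v′))) refl a b c d u v u′ v′) (-0≈0 e)

      ¬all-up : Up u → Up v → Up u′ → Up v′ → ⊥
      ¬all-up a b c d = ¬Up-origin combo≈0 (Up-combo a b c d)

      cross≉0 : ∀ {u v} → u ≈ₚ origin → ¬ (0# < cross u v)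
      cross≉0 {u} {v} (ex , ey) h = 0<⇒≉0 h (trans (+-cong (trans (*-congʳ ex) (zeroˡ _)) (-0≈0 (trans (*-congʳ ey) (zeroˡ _)))) (+-identityˡ 0#))

      down : ∀ {u v} → 0# < cross u v → ¬ Up u → Up (-ₚ u)
      down {u} h ¬up = [ (λ u≈0 → contradiction h (cross≉0 u≈0)) , (λ up → up) ]′ (¬Up⇒Up- u ¬up)

      ¬all-down : ¬ Up u → ¬ Up v → ¬ Up u′ → ¬ Up v′ → ⊥
      ¬all-down a b c d = ¬Up-origin
        (neg-eq _ _ _ _ (proj₁ combo≈0) , neg-eq _ _ _ _ (proj₂ combo≈0))
        (Up-combo (down uv a) (down vv′ b) (down u′u c) (down v′u′ d))

      ¬alternating⁺ : Up u → ¬ Up v → ¬ Up u′ → Up v′ → ⊥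
      ¬alternating⁺ a b c d = ¬Up-origin (eq px qx xx yx , eq py qy xy yy)
        (Up-+ (Up-+ a (down vv′ b)) (Up-+ (down u′u c) d))
        where
        eq : ∀ p q x y → (p - x) + - (q - x) + (- (p - y) + (q - y)) ≈ 0#
        eq = solve 4 (λ p q x y → (p :- x) :+ (:- (q :- x)) :+ (:- (p :- y) :+ (q :- y)) := con 0ℤ) refl

      ¬alternating⁻ : ¬ Up u → Up v → Up u′ → ¬ Up v′ → ⊥
      ¬alternating⁻ a b c d = ¬Up-origin (eq px qx xx yx , eq py qy xy yy)
        (Up-+ (Up-+ (down uv a) b) (Up-+ c (down v′u′ d)))
        where
        eq : ∀ p q x y → - (p - x) + (q - x) + ((p - y) + - (q - y)) ≈ 0#
        eq = solve 4 (λ p q x y → (:- (p :- x)) :+ (q :- x) :+ ((p :- y) :+ (:- (q :- y))) := con 0ℤ) refl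

      cases : (du : Dec (Up u)) (dv : Dec (Up v)) (du′ : Dec (Up u′)) (dv′ : Dec (Up v′)) →
        cutᵇ (does du) (does dv) true xor cutᵇ (does du′) (does dv′) false ≡
        not (cutᵇ (does du) (does du′) false xor cutᵇ (does dv) (does dv′) true)
      cases (yes a) (yes b) (yes c) (yes d) = ⊥-elim (¬all-up a b c d)
      cases (yes _) (yes _) (yes _) (no _)  = ≡.refl
      cases (yes _) (yes _) (no _)  (yes _) = ≡.refl
      cases (yes _) (yes _) (no _)  (no _)  = ≡.refl
      cases (yes _) (no _)  (yes _) (yes _) = ≡.refl
      cases (yes _) (no _)  (yes _) (no _)  = ≡.refl
      cases (yes a) (no b)  (no c)  (yes d) = ⊥-elim (¬alternating⁺ a b c d)
      cases (yes _) (no _)  (no _)  (no _)  = ≡.refl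
      cases (no _)  (yes _) (yes _) (yes _) = ≡.refl
      cases (no a)  (yes b) (yes c) (no d)  = ⊥-elim (¬alternating⁻ a b c d)
      cases (no _)  (yes _) (no _)  (yes _) = ≡.refl
      cases (no _)  (yes _) (no _)  (no _)  = ≡.refl
      cases (no _)  (no _)  (yes _) (yes _) = ≡.refl
      cases (no _)  (no _)  (yes _) (no _)  = ≡.refl
      cases (no _)  (no _)  (no _)  (yes _) = ≡.refl
      cases (no a)  (no b)  (no c)  (no d)  = ⊥-elim (¬all-down a b c d)

-- Half planes and separation

module PlaneGeometry {c ℓ₁ ℓ₂} (F : OrderedField c ℓ₁ ℓ₂) where
  open OrderedFieldProperties F
  open Plabic F
  open EventuallyProperties F
  open CrossingParity F

  -- An inner normal, of any length, and a point of the bounding line.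
  HalfPlane : Set c
  HalfPlane = Point × Point

  opaque
    height : HalfPlane → Point → Carrier
    height (n , b) z = dot n (z -ₚ b)

  ≈ₚ-sym : ∀ {p q} → p ≈ₚ q → q ≈ₚ p
  ≈ₚ-sym (a , b) = sym a , sym b

  ≈ₚ-trans : ∀ {p q r} → p ≈ₚ q → q ≈ₚ r → p ≈ₚ r
  ≈ₚ-trans (a , b) (c , d) = trans a c , trans b d

  ≈ₚ-refl : ∀ {p} → p ≈ₚ p
  ≈ₚ-refl = refl , refl

  -ₚ-flip : ∀ p q → p -ₚ q ≈ₚ -ₚ (q -ₚ p)
  -ₚ-flip (px , py) (qx , qy) = eq px qx , eq py qy
    where
    eq : ∀ p q → p - q ≈ - (q - p)
    eq = solve 2 (λ p q → p :- q := :- (q :- p)) refl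

  cross-cong : ∀ {u u′ v v′} → u ≈ₚ u′ → v ≈ₚ v′ → cross u v ≈ cross u′ v′
  cross-cong (a , b) (c , d) = +-cong (*-cong a d) (-‿cong (*-cong b c))

  cross-negˡ : ∀ u v → cross (-ₚ u) v ≈ - cross u v
  cross-negˡ (ux , uy) (vx , vy) = solve 4 (λ ux uy vx vy → (:- ux) :* vy :- (:- uy) :* vx := :- (ux :* vy :- uy :* vx)) refl ux uy vx vy

  dot-negˡ : ∀ u v → dot (-ₚ u) v ≈ - dot u v
  dot-negˡ (ux , uy) (vx , vy) = solve 4 (λ ux uy vx vy → (:- ux) :* vx :+ (:- uy) :* vy := :- (ux :* vx :+ uy :* vy)) refl ux uy vx vy

  dot-cong : ∀ {u u′ v v′} → u ≈ₚ u′ → v ≈ₚ v′ → dot u v ≈ dot u′ v′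
  dot-cong (a , b) (c , d) = +-cong (*-cong a c) (*-cong b d)

  -ₚ-cong : ∀ {u u′ v v′} → u ≈ₚ u′ → v ≈ₚ v′ → u -ₚ v ≈ₚ u′ -ₚ v′
  -ₚ-cong (a , b) (c , d) = +-cong a (-‿cong c) , +-cong b (-‿cong d)

  opaque
    unfolding height

    height-cong : ∀ H {y z} → y ≈ₚ z → height H y ≈ height H z
    height-cong (n , b) e = dot-cong (≈ₚ-refl {n}) (-ₚ-cong e (≈ₚ-refl {b}))

    height-along : ∀ H p q t → height H (along p q t) ≈ (1# - t) * height H p + t * height H q
    height-along ((nx , ny) , (bx , by)) (px , py) (qx , qy) t =
      solve 9 (λ nx ny bx by px py qx qy t →
        nx :* (px :+ t :* (qx :- px) :- bx) :+ ny :* (py :+ t :* (qy :- py) :- by) :=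
        (con 1ℤ :- t) :* (nx :* (px :- bx) :+ ny :* (py :- by)) :+ t :* (nx :* (qx :- bx) :+ ny :* (qy :- by)))
        refl nx ny bx by px py qx qy t

    height-+ : ∀ H z t w → height H (z +ₚ t *ₚ w) ≈ height H z + t * dot (proj₁ H) w
    height-+ ((nx , ny) , (bx , by)) (zx , zy) t (wx , wy) =
      solve 9 (λ nx ny bx by zx zy t wx wy →
        nx :* (zx :+ t :* wx :- bx) :+ ny :* (zy :+ t :* wy :- by) :=
        nx :* (zx :- bx) :+ ny :* (zy :- by) :+ t :* (nx :* wx :+ ny :* wy))
        refl nx ny bx by zx zy t wx wy

    height-- : ∀ H z t w → height H (z -ₚ t *ₚ w) ≈ height H z + t * - dot (proj₁ H) w
    height-- ((nx , ny) , (bx , by)) (zx , zy) t (wx , wy) =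
      solve 9 (λ nx ny bx by zx zy t wx wy →
        nx :* (zx :- t :* wx :- bx) :+ ny :* (zy :- t :* wy :- by) :=
        nx :* (zx :- bx) :+ ny :* (zy :- by) :+ t :* (:- (nx :* wx :+ ny :* wy)))
        refl nx ny bx by zx zy t wx wy

  convex-pos : ∀ {a b t} → 0# < a → 0# < b → 0# ≤ t → t ≤ 1# → 0# < (1# - t) * a + t * b
  convex-pos {a} {b} {t} 0<a 0<b (inj₁ 0<t) t≤1 =
    0<-resp-≈ (+-comm _ _) (+-pos-nonneg (*-pos 0<t 0<b) (*-nonneg (≤⇒0≤- t≤1) (inj₁ 0<a)))
  convex-pos {a} {b} {t} 0<a 0<b (inj₂ 0≈t) t≤1 = 0<-resp-≈
    (trans (solve 2 (λ a b → a := (con 1ℤ :- con 0ℤ) :* a :+ con 0ℤ :* b) refl a b)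
           (+-cong (*-congʳ (+-congˡ (-‿cong 0≈t))) (*-congʳ 0≈t))) 0<a

  convex-nonneg : ∀ {a b t} → 0# ≤ a → 0# ≤ b → 0# ≤ t → t ≤ 1# → 0# ≤ (1# - t) * a + t * b
  convex-nonneg 0≤a 0≤b 0≤t t≤1 = +-nonneg (*-nonneg (≤⇒0≤- t≤1) 0≤a) (*-nonneg 0≤t 0≤b)

  -- Weak inequalities on the segment, to be set against strict ones elsewhere: the line through an
  -- edge can then serve as a wall for that edge.
  record Separates (H : HalfPlane) (p q : Point) : Set (ℓ₁ ⊔ ℓ₂) where
    constructor separates
    field
      below-p : 0# ≤ - height H p
      below-q : 0# ≤ - height H q

  separated⇒disjoint : ∀ {p q x y} H → Separates H p q → 0# < height H x → 0# < height H y → ¬ Meet p q x y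
  separated⇒disjoint {p} {q} {x} {y} H (separates hp hq) hx hy (z , (s , 0≤s , s≤1 , z≈) , (t , 0≤t , t≤1 , z≈′)) =
    0<⇒≉0 (+-pos-nonneg above below) (-‿inverseʳ _)
    where
    above : 0# < height H z
    above = 0<-resp-≈ (trans (sym (height-along H x y t)) (sym (height-cong H z≈′))) (convex-pos hx hy 0≤t t≤1)
    below : 0# ≤ - height H z
    below = ≤-respʳ-≈ (trans (solve 3 (λ t a b → (con 1ℤ :- t) :* (:- a) :+ t :* (:- b) := :- ((con 1ℤ :- t) :* a :+ t :* b)) refl s (height H p) (height H q))
      (-‿cong (trans (sym (height-along H p q s)) (sym (height-cong H z≈))))) (convex-nonneg hp hq 0≤s s≤1)

  dot-self-pos : ∀ {d} → ¬ (d ≈ₚ origin) → 0# < dot d d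
  dot-self-pos {x , y} d≉0 with x ≈? 0#
  ... | no x≉0  = +-pos-nonneg (square-pos x≉0) (square-nonneg y)
  ... | yes x≈0 = 0<-resp-≈ (+-comm _ _) (+-pos-nonneg (square-pos λ y≈0 → d≉0 (x≈0 , y≈0)) (square-nonneg x))

  difference≉0 : ∀ {p q} → ¬ (p ≈ₚ q) → ¬ (q -ₚ p ≈ₚ origin)
  difference≉0 p≉q (ex , ey) = p≉q (eq ex , eq ey)
    where
    eq : ∀ {x y} → y - x ≈ 0# → x ≈ y
    eq {x} {y} e = trans (trans (sym (+-identityˡ x)) (+-congʳ (sym e))) (solve 2 (λ x y → y :- x :+ x := y) refl x y)

  -- The coefficient is that of the orthogonal projection onto `d`, which fixes every vector
  -- parallel to `d`.
  parallel⇒multiple : ∀ {d w} → ¬ (d ≈ₚ origin) → cross d w ≈ 0# → w ≈ₚ (dot d w * dot d d ⁻¹) *ₚ d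
  parallel⇒multiple {d@(dx , dy)} {w@(wx , wy)} d≉0 col =
    divide {r = - dy} (solve 4 (λ dx dy wx wy → (dx :* dx :+ dy :* dy) :* wx :=
      (dx :* wx :+ dy :* wy) :* dx :+ (:- dy) :* (dx :* wy :- dy :* wx)) refl dx dy wx wy) ,
    divide {r = dx} (solve 4 (λ dx dy wx wy → (dx :* dx :+ dy :* dy) :* wy :=
      (dx :* wx :+ dy :* wy) :* dy :+ dx :* (dx :* wy :- dy :* wx)) refl dx dy wx wy)
    where
    D i : Carrier
    D = dot d d
    i = D ⁻¹
    divide : ∀ {x y r} → D * x ≈ dot d w * y + r * cross d w → x ≈ dot d w * i * y
    divide {x} {y} {r} h = trans (trans (sym (*-identityˡ x)) (*-congʳ (sym (⁻¹-inverseˡ (0<⇒≉0 (dot-self-pos d≉0))))))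
      (trans (*-assoc i D x) (trans (*-congˡ (trans h (trans (+-congˡ (*-≈0 r col)) (+-identityʳ _))))
        (solve 3 (λ i t y → i :* (t :* y) := t :* i :* y) refl i (dot d w) y)))

  -ₚ⇒+ₚ : ∀ {z p u} → z -ₚ p ≈ₚ u → z ≈ₚ p +ₚ u
  -ₚ⇒+ₚ (ex , ey) = eq ex , eq ey
    where
    eq : ∀ {z p u} → z - p ≈ u → z ≈ p + u
    eq {z} {p} h = trans (solve 2 (λ z p → z := p :+ (z :- p)) refl z p) (+-congˡ h)

  -- The side of the line through p with direction d on which ω = ±1 times
  -- the counterclockwise normal points.
  side : Carrier → Point → Point → HalfPlane
  side ω p d = ω *ₚ rotate90 d , p

  opaque
    unfolding height

    height-side : ∀ ω p d z → height (side ω p d) z ≈ ω * cross d (z -ₚ p)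
    height-side ω (px , py) (dx , dy) (zx , zy) =
      solve 7 (λ ω px py dx dy zx zy →
        ω :* (:- dy) :* (zx :- px) :+ ω :* dx :* (zy :- py) := ω :* (dx :* (zy :- py) :- dy :* (zx :- px)))
        refl ω px py dx dy zx zy

  ≈0⇒0≤- : ∀ {x} → x ≈ 0# → 0# ≤ - x
  ≈0⇒0≤- e = inj₂ (sym (-0≈0 e))

  opaque
    unfolding height

    -- A point off the line of the segment is cut off by that line. A point on the line lies beyond
    -- one of the ends and is cut off by the perpendicular there.
    separate : ∀ {p q z} → ¬ (p ≈ₚ q) → ¬ (z ∈[ p , q ]) → ∃[ H ] (Separates H p q × 0# < height H z)
    separate {p@(px , py)} {q@(qx , qy)} {z@(zx , zy)} p≉q z∉ = go (signOf _) (signOf _) (signOf _)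
      where
      d : Point
      d = q -ₚ p
      D : Carrier
      D = dot d d
      0<D : 0# < D
      0<D = dot-self-pos (difference≉0 p≉q)

      base₀ : ∀ ω → Separates (side ω p d) p q
      base₀ ω = separates
        (≈0⇒0≤- (solve 5 (λ ω px py qx qy →
          ω :* (:- (qy :- py)) :* (px :- px) :+ ω :* (qx :- px) :* (py :- py) := con 0ℤ) refl ω px py qx qy))
        (≈0⇒0≤- (solve 5 (λ ω px py qx qy →
          ω :* (:- (qy :- py)) :* (qx :- px) :+ ω :* (qx :- px) :* (qy :- py) := con 0ℤ) refl ω px py qx qy))

      inside : cross d (z -ₚ p) ≈ 0# → 0# ≤ dot d (z -ₚ p) → 0# ≤ dot d (q -ₚ z) → z ∈[ p , q ]
      inside col 0≤a 0≤b = dot d (z -ₚ p) * i , *-nonneg 0≤a 0≤i , 0≤-⇒≤ (≤-respʳ-≈ eq (*-nonneg 0≤b 0≤i)) ,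
        -ₚ⇒+ₚ (parallel⇒multiple (difference≉0 p≉q) col)
        where
        i : Carrier
        i = D ⁻¹
        0≤i : 0# ≤ i
        0≤i = inj₁ (⁻¹-pos 0<D)
        eq : dot d (q -ₚ z) * i ≈ 1# - dot d (z -ₚ p) * i
        eq = trans (solve 7 (λ px py qx qy zx zy i →
            let dx = qx :- px; dy = qy :- py in
            (dx :* (qx :- zx) :+ dy :* (qy :- zy)) :* i :=
            (dx :* dx :+ dy :* dy) :* i :- (dx :* (zx :- px) :+ dy :* (zy :- py)) :* i)
            refl px py qx qy zx zy i) (+-congʳ (⁻¹-inverseʳ (0<⇒≉0 0<D)))

      go : ∃[ i ] SignOf (cross d (z -ₚ p)) i → ∃[ i ] SignOf (dot d (z -ₚ p)) i → ∃[ i ] SignOf (dot d (q -ₚ z)) i →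
           ∃[ H ] (Separates H p q × 0# < height H z)
      go (_ , positive h) _ _ = side 1# p d , base₀ 1# ,
        0<-resp-≈ (trans (sym (*-identityˡ _)) (sym (height-side 1# p d z))) h
      go (_ , negative h) _ _ = side (- 1#) p d , base₀ (- 1#) ,
        0<-resp-≈ (trans (solve 1 (λ x → :- x := (:- con 1ℤ) :* x) refl _) (sym (height-side (- 1#) p d z))) h
      go (_ , null col) (_ , negative h) _ = (-ₚ d , p) , separates
        (≈0⇒0≤- (solve 4 (λ px py qx qy →
          (:- (qx :- px)) :* (px :- px) :+ (:- (qy :- py)) :* (py :- py) := con 0ℤ) refl px py qx qy))
        (inj₁ (0<-resp-≈ (solve 2 (λ dx dy → dx :* dx :+ dy :* dy := :- ((:- dx) :* dx :+ (:- dy) :* dy)) refl (qx - px) (qy - py)) 0<D)) ,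
        0<-resp-≈ (solve 4 (λ dx dy wx wy → :- (dx :* wx :+ dy :* wy) := (:- dx) :* wx :+ (:- dy) :* wy) refl _ _ _ _) h
      go (_ , null col) _ (_ , negative h) = (d , q) , separates
        (inj₁ (0<-resp-≈ (solve 4 (λ px py qx qy →
          (qx :- px) :* (qx :- px) :+ (qy :- py) :* (qy :- py) :=
          :- ((qx :- px) :* (px :- qx) :+ (qy :- py) :* (py :- qy))) refl px py qx qy) 0<D))
        (≈0⇒0≤- (solve 4 (λ px py qx qy →
          (qx :- px) :* (qx :- qx) :+ (qy :- py) :* (qy :- qy) := con 0ℤ) refl px py qx qy)) ,
        0<-resp-≈ (solve 6 (λ dx dy zx zy qx qy → :- (dx :* (qx :- zx) :+ dy :* (qy :- zy)) :=
          dx :* (zx :- qx) :+ dy :* (zy :- qy)) refl (qx - px) (qy - py) zx zy qx qy) h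
      go (_ , null col) (_ , positive a) (_ , positive b) = contradiction (inside col (inj₁ a) (inj₁ b)) z∉
      go (_ , null col) (_ , positive a) (_ , null b)     = contradiction (inside col (inj₁ a) (inj₂ (sym b))) z∉
      go (_ , null col) (_ , null a)     (_ , positive b) = contradiction (inside col (inj₂ (sym a)) (inj₁ b)) z∉
      go (_ , null col) (_ , null a)     (_ , null b)     = contradiction (inside col (inj₂ (sym a)) (inj₂ (sym b))) z∉

  positive⇒¬OriginInTriangle : ∀ {n u v w} → 0# < dot n u → 0# < dot n v → 0# < dot n w → ¬ OriginInTriangle u v w
  positive⇒¬OriginInTriangle {nx , ny} {ux , uy} {vx , vy} {wx , wy} hu hv hw (combination α β γ a b g s (ex , ey)) =
    0<⇒≉0 total (trans
      (solve 11 (λ nx ny ux uy vx vy wx wy α β γ →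
        α :* (nx :* ux :+ ny :* uy) :+ β :* (nx :* vx :+ ny :* vy) :+ γ :* (nx :* wx :+ ny :* wy) :=
        nx :* (α :* ux :+ β :* vx :+ γ :* wx) :+ ny :* (α :* uy :+ β :* vy :+ γ :* wy))
        refl nx ny ux uy vx vy wx wy α β γ)
      (trans (+-cong (trans (*-congˡ ex) (zeroʳ nx)) (trans (*-congˡ ey) (zeroʳ ny))) (+-identityˡ 0#)))
    where
    hU hV hW : Carrier
    hU = nx * ux + ny * uy
    hV = nx * vx + ny * vy
    hW = nx * wx + ny * wy
    total : 0# < α * hU + β * hV + γ * hW
    total = go a b g
      where
      go : 0# ≤ α → 0# ≤ β → 0# ≤ γ → 0# < α * hU + β * hV + γ * hW
      go (inj₁ p) q r = +-pos-nonneg (+-pos-nonneg (*-pos p hu) (*-nonneg q (inj₁ hv))) (*-nonneg r (inj₁ hw))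
      go (inj₂ p) (inj₁ q) r = +-pos-nonneg (0<-resp-≈ (+-comm _ _) (+-pos-nonneg (*-pos q hv) (*-nonneg (inj₂ p) (inj₁ hu)))) (*-nonneg r (inj₁ hw))
      go (inj₂ p) (inj₂ q) (inj₁ r) = 0<-resp-≈ (+-comm _ _) (+-pos-nonneg (*-pos r hw) (+-nonneg (*-nonneg (inj₂ p) (inj₁ hu)) (*-nonneg (inj₂ q) (inj₁ hv))))
      go (inj₂ p) (inj₂ q) (inj₂ r) = ⊥-elim (0<⇒≉0 s (trans (+-cong (+-cong (sym p) (sym q)) (sym r)) (trans (+-identityʳ _) (+-identityˡ 0#))))

  eventually-above : ∀ H {z} w → 0# < height H z → Eventually λ ε → 0# < height H (z +ₚ ε *ₚ w)
  eventually-above H {z} w h =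
    eventually-map (λ ε _ → 0<-resp-≈ (sym (height-+ H z ε w))) (eventually-pos (dot (proj₁ H) w) h)

  eventually-above⁻ : ∀ H {z} w → 0# < height H z → Eventually λ ε → 0# < height H (z -ₚ ε *ₚ w)
  eventually-above⁻ H {z} w h =
    eventually-map (λ ε _ → 0<-resp-≈ (sym (height-- H z ε w))) (eventually-pos (- dot (proj₁ H) w) h)

  opaque
    unfolding cut

    cut-cong : ∀ {u u′ v v′} → u ≈ₚ u′ → v ≈ₚ v′ → cut u v ≡ cut u′ v′
    cut-cong {u} {u′} {v} {v′} eu ev = ≡.trans
      (≡.cong₂ (λ a b → cutᵇ a b (does (0# <? cross u v))) (up-cong eu) (up-cong ev))
      (≡.cong (cutᵇ (does (up? u′)) (does (up? v′))) (pos-cong (cross-cong eu ev)))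
      where
      up-cong : ∀ {u v} → u ≈ₚ v → does (up? u) ≡ does (up? v)
      up-cong {u} {v} e = does-⇔ (mk⇔ (Up-resp-≈ e) (Up-resp-≈ (≈ₚ-sym e))) (up? u) (up? v)
      pos-cong : ∀ {x y} → x ≈ y → does (0# <? x) ≡ does (0# <? y)
      pos-cong {x} {y} e = does-⇔ (mk⇔ (0<-resp-≈ e) (0<-resp-≈ (sym e))) (0# <? x) (0# <? y)

-- Cyclic sums modulo 2 and the parity of a closed polygon

private
  module Xor = Sum (CommutativeRing.+-commutativeMonoid Bool.xor-∧-commutativeRing)

prev : ∀ {m} → Fin (suc m) → Fin (suc m)
prev {m} Fin.zero    = fromℕ m
prev     (Fin.suc i) = inject₁ i

next-inject₁ : ∀ {m} (i : Fin m) → next (inject₁ i) ≡ Fin.suc i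
next-inject₁ {m} i = Fin.toℕ-injective (≡.trans (Fin.toℕ-fromℕ< _)
  (≡.trans (≡.cong (λ k → suc k % suc m) (Fin.toℕ-inject₁ i)) (m<n⇒m%n≡m (ℕ.s≤s (Fin.toℕ<n i)))))

next-fromℕ : ∀ m → next (fromℕ m) ≡ Fin.zero
next-fromℕ m = Fin.toℕ-injective (≡.trans (Fin.toℕ-fromℕ< _)
  (≡.trans (≡.cong (λ k → suc k % suc m) (Fin.toℕ-fromℕ m)) (n%n≡0 (suc m))))

next-prev : ∀ {m} (i : Fin (suc m)) → next (prev i) ≡ i
next-prev Fin.zero    = next-fromℕ _
next-prev (Fin.suc i) = next-inject₁ i

prev-next : ∀ {m} (i : Fin (suc m)) → prev (next i) ≡ i
prev-next i with view i
... | ‵fromℕ {n}   = ≡.cong prev (next-fromℕ n)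
... | ‵inject₁ j   = ≡.cong prev (next-inject₁ j)

next-permutation : ∀ m → Permutation′ (suc m)
next-permutation m = permutation next prev next-prev prev-next

next-injective : ∀ {m} {i j : Fin (suc m)} → next i ≡ next j → i ≡ j
next-injective {i = i} {j} eq = ≡.trans (≡.sym (prev-next i)) (≡.trans (≡.cong prev eq) (prev-next j))

⊕-zero : ∀ {n} (t : Fin n → Bool) → (∀ i → t i ≡ false) → Xor.sum t ≡ false
⊕-zero {n} t zeros = ≡.trans (Xor.sum-cong-≗ zeros) (Xor.sum-replicate-zero n)

⊕-single : ∀ {n} (t : Fin n → Bool) k → t k ≡ true → (∀ i → i ≢ k → t i ≡ false) → Xor.sum t ≡ true
⊕-single {suc n} t k one zeros = ≡.trans (Xor.sum-remove {i = k} t)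
  (≡.cong₂ _xor_ one (⊕-zero _ λ i → zeros (punchIn k i) (Fin.punchInᵢ≢i k i)))

xor-same : ∀ {a b} → a ≡ b → a xor b ≡ false
xor-same {a} ≡.refl = Bool.xor-same a

xor-false⇒≡ : ∀ a b → a xor b ≡ false → a ≡ b
xor-false⇒≡ false false _ = ≡.refl
xor-false⇒≡ true  true  _ = ≡.refl

xor-true⇒≡not : ∀ a b → a xor b ≡ true → a ≡ not b
xor-true⇒≡not false true  _ = ≡.refl
xor-true⇒≡not true  false _ = ≡.refl

xor-not : ∀ {a b} → a ≡ not b → a xor b ≡ true
xor-not {b = true}  ≡.refl = ≡.refl
xor-not {b = false} ≡.refl = ≡.refl

-- The second summands are the first ones rearranged by the permutation `next`.
⊕-boundary : ∀ {m} (s : Fin (suc m) → Bool) → Xor.sum (λ i → s i xor s (next i)) ≡ false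
⊕-boundary {m} s = ≡.trans (Xor.∑-distrib-+ s (λ i → s (next i)))
  (xor-same (Xor.sum-permute s (next-permutation m)))

module Polygon {c ℓ₁ ℓ₂} (F : OrderedField c ℓ₁ ℓ₂) {m : ℕ}
  (P : Fin (suc m) → Plabic.Point F) where
  open OrderedFieldProperties F
  open Plabic F
  open CrossingParity F

  cutEdge : Fin (suc m) → Point → Bool
  cutEdge i x = cut (P i -ₚ x) (P (next i) -ₚ x)

  parity : Point → Bool
  parity x = Xor.sum λ i → cutEdge i x

  module _ (x y : Point) (σ : Point → Bool) where

    -- Measures how far the change of one contribution is from the difference of `σ` at the ends of
    -- the edge. The part with `σ` vanishes in total, so the defects add up to the change of parity
    -- for every choice of `σ`.
    defect : Fin (suc m) → Bool
    defect i = (cutEdge i x xor cutEdge i y) xor (σ (P i) xor σ (P (next i)))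

    ⊕-defect : Xor.sum defect ≡ parity x xor parity y
    ⊕-defect = ≡.trans (Xor.∑-distrib-+ (λ i → cutEdge i x xor cutEdge i y) (λ i → σ (P i) xor σ (P (next i))))
      (≡.trans (≡.cong₂ _xor_ (Xor.∑-distrib-+ (λ i → cutEdge i x) (λ i → cutEdge i y)) (⊕-boundary (λ i → σ (P i))))
               (Bool.xor-identityʳ _))

    parity-homotopy : (∀ i → cutEdge i x xor cutEdge i y ≡ σ (P i) xor σ (P (next i))) → parity x ≡ parity y
    parity-homotopy h = xor-false⇒≡ _ _ (≡.trans (≡.sym ⊕-defect) (⊕-zero defect λ i → xor-same (h i)))

  -- Seen from a vertex `r`, a moving base point traces the segment from `r -ₚ x` to `r -ₚ y`; `σ`
  -- records whether this trace crosses the ray.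
  parity-constant : ∀ x y → (∀ i → ¬ Meet (P i) (P (next i)) x y) → parity x ≡ parity y
  parity-constant x y disjoint = parity-homotopy x y (λ r → cut (r -ₚ x) (r -ₚ y)) λ i →
    cut-parallelogram (P i) (P (next i)) x y (disjoint i)

  -- With the same `σ` as for constancy, the crossed edge `k` is the only one with a defect.
  parity-flip : ∀ x y k → (∀ i → i ≢ k → ¬ Meet (P i) (P (next i)) x y) →
    cutEdge k x xor cutEdge k y ≡
      not (cut (P k -ₚ x) (P k -ₚ y) xor cut (P (next k) -ₚ x) (P (next k) -ₚ y)) →
    parity x ≡ not (parity y)
  parity-flip x y k disjoint odd = xor-true⇒≡not _ _ (≡.trans (≡.sym (⊕-defect x y σ))
    (⊕-single (defect x y σ) k (xor-not odd) λ i i≢k →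
      xor-same (cut-parallelogram (P i) (P (next i)) x y (disjoint i i≢k))))
    where
    σ : Point → Bool
    σ r = cut (r -ₚ x) (r -ₚ y)

-- Points on and beside segments

module Segments {c ℓ₁ ℓ₂} (F : OrderedField c ℓ₁ ℓ₂) where
  open OrderedFieldProperties F
  open Plabic F
  open EventuallyProperties F
  open CrossingParity F
  open PlaneGeometry F

  Proper : Carrier → Set ℓ₂
  Proper t = 0# < t × 0# < 1# - t

  ½ : Carrier
  ½ = (1# + 1#) ⁻¹

  ½-proper : Proper ½
  ½-proper = 0<½ , 0<-resp-≈ (trans (solve 1 (λ h → h := h :+ h :- h) refl ½) (+-congʳ ½+½≈1)) 0<½

  1-proper : ∀ {t} → Proper t → Proper (1# - t)
  1-proper {t} (a , b) = b , 0<-resp-≈ (solve 1 (λ t → t := con 1ℤ :- (con 1ℤ :- t)) refl t) a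

  eventually-proper : Eventually Proper
  eventually-proper = eventually-map (λ _ 0<τ τ<1 → 0<τ , <⇒0<- τ<1) (eventually-< 0<1)

  proper⇒∈ : ∀ {p q t} → Proper t → along p q t ∈[ p , q ]
  proper⇒∈ {t = t} (a , b) = t , inj₁ a , inj₁ (0<-⇒< b) , refl , refl

  start∈ : ∀ {p q} → p ∈[ p , q ]
  start∈ {p} {q} = 0# , ≤-refl , inj₁ 0<1 , eq _ _ , eq _ _
    where
    eq : ∀ p q → p ≈ p + 0# * (q - p)
    eq = solve 2 (λ p q → p := p :+ con 0ℤ :* (q :- p)) refl

  end∈ : ∀ {p q} → q ∈[ p , q ]
  end∈ {p} {q} = 1# , inj₁ 0<1 , ≤-refl , eq _ _ , eq _ _
    where
    eq : ∀ p q → q ≈ p + 1# * (q - p)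
    eq = solve 2 (λ p q → q := p :+ con 1ℤ :* (q :- p)) refl

  ∈-resp-≈ : ∀ {p q y z} → y ≈ₚ z → y ∈[ p , q ] → z ∈[ p , q ]
  ∈-resp-≈ e (t , a , b , h) = t , a , b , ≈ₚ-trans (≈ₚ-sym e) h

  private
    cancel : ∀ {t x} → 0# < t → t * x ≈ 0# → x ≈ 0#
    cancel {t} {x} 0<t e = trans (trans (sym (*-identityˡ x)) (*-congʳ (sym (⁻¹-inverseˡ (0<⇒≉0 0<t)))))
      (trans (*-assoc _ _ _) (trans (*-congˡ e) (zeroʳ _)))

  *ₚ≉0 : ∀ {t v} → 0# < t → ¬ (v ≈ₚ origin) → ¬ (t *ₚ v ≈ₚ origin)
  *ₚ≉0 0<t v≉0 (ex , ey) = v≉0 (cancel 0<t ex , cancel 0<t ey)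

  along≉start : ∀ {p q t} → ¬ (p ≈ₚ q) → 0# < t → ¬ (along p q t ≈ₚ p)
  along≉start {p} {q} {t} p≉q 0<t (ex , ey) = *ₚ≉0 0<t (difference≉0 p≉q) (eq ex , eq ey)
    where
    eq : ∀ {p q} → p + t * (q - p) ≈ p → t * (q - p) ≈ 0#
    eq {p} {q} e = trans (solve 3 (λ p q t → t :* (q :- p) := p :+ t :* (q :- p) :- p) refl p q t) (trans (+-congʳ e) (-‿inverseʳ p))

  along≉end : ∀ {p q t} → ¬ (p ≈ₚ q) → 0# < 1# - t → ¬ (along p q t ≈ₚ q)
  along≉end {p} {q} {t} p≉q t<1 (ex , ey) = *ₚ≉0 t<1 (difference≉0 p≉q) (eq ex , eq ey)
    where
    eq : ∀ {p q} → p + t * (q - p) ≈ q → (1# - t) * (q - p) ≈ 0#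
    eq {p} {q} e = trans (solve 3 (λ p q t → (con 1ℤ :- t) :* (q :- p) := q :- (p :+ t :* (q :- p))) refl p q t) (trans (+-congˡ (-‿cong e)) (-‿inverseʳ q))

  -- If `q -ₚ v` is `r` times `p -ₚ v`, the parameters r / (1 + r) and 1 / (1 + r) give the same
  -- point. Both are proper, whichever segment is longer.
  rays-overlap : ∀ v {p q} → ¬ (v ≈ₚ p) → cross (p -ₚ v) (q -ₚ v) ≈ 0# → 0# < dot (p -ₚ v) (q -ₚ v) →
                 ∃[ t ] ∃[ u ] (Proper t × Proper u × along v p t ≈ₚ along v q u)
  rays-overlap v {p} {q} v≉p col 0<dot =
    r * i , i , (*-pos 0<r 0<i , 0<-resp-≈ (sym 1-ri) 0<i) , (0<i , 0<-resp-≈ (sym 1-i) (*-pos 0<r 0<i)) ,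
    +-congˡ (scale (proj₁ multiple)) , +-congˡ (scale (proj₂ multiple))
    where
    a : Point
    a = p -ₚ v
    r i : Carrier
    r = dot a (q -ₚ v) * dot a a ⁻¹
    i = (1# + r) ⁻¹
    multiple : q -ₚ v ≈ₚ r *ₚ a
    multiple = parallel⇒multiple (difference≉0 v≉p) col
    0<r : 0# < r
    0<r = *-pos 0<dot (⁻¹-pos (dot-self-pos (difference≉0 v≉p)))
    0<i : 0# < i
    0<i = ⁻¹-pos (+-pos 0<1 0<r)
    [1+r]i : (1# + r) * i ≈ 1#
    [1+r]i = ⁻¹-inverseʳ (0<⇒≉0 (+-pos 0<1 0<r))
    1-ri : 1# - r * i ≈ i
    1-ri = trans (+-congʳ (sym [1+r]i)) (solve 2 (λ r i → (con 1ℤ :+ r) :* i :- r :* i := i) refl r i)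
    1-i : 1# - i ≈ r * i
    1-i = trans (+-congʳ (sym [1+r]i)) (solve 2 (λ r i → (con 1ℤ :+ r) :* i :- i := r :* i) refl r i)
    scale : ∀ {x y} → y ≈ r * x → r * i * x ≈ i * y
    scale {x} h = trans (solve 3 (λ r i x → r :* i :* x := i :* (r :* x)) refl r i x) (*-congˡ (sym h))

  lagrange : ∀ u v → cross u v * cross u v + dot u v * dot u v ≈ dot u u * dot v v
  lagrange (ux , uy) (vx , vy) = solve 4 (λ ux uy vx vy →
    (ux :* vy :- uy :* vx) :* (ux :* vy :- uy :* vx) :+ (ux :* vx :+ uy :* vy) :* (ux :* vx :+ uy :* vy) :=
    (ux :* ux :+ uy :* uy) :* (vx :* vx :+ vy :* vy)) refl ux uy vx vy

  dot≉0 : ∀ {u v} → ¬ (u ≈ₚ origin) → ¬ (v ≈ₚ origin) → cross u v ≈ 0# → ¬ (dot u v ≈ 0#)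
  dot≉0 {u} {v} u≉0 v≉0 col perp = 0<⇒≉0 (*-pos (dot-self-pos u≉0) (dot-self-pos v≉0))
    (trans (sym (lagrange u v)) (trans (+-cong (trans (*-congʳ col) (zeroˡ _)) (trans (*-congʳ perp) (zeroˡ _))) (+-identityˡ 0#)))

  -- For `ω` equal to 1 this is the point that defines `LeftRegion`; for -1 it is the mirror image
  -- on the right of the edge.
  sidePoint : (p q : Point) (ω τ δ : Carrier) → Point
  sidePoint p q ω τ δ = q -ₚ τ *ₚ (q -ₚ p) +ₚ δ *ₚ (ω *ₚ rotate90 (q -ₚ p))

  foot : (p q : Point) (τ : Carrier) → Point
  foot p q τ = q -ₚ τ *ₚ (q -ₚ p)

  foot≈along : ∀ p q τ → foot p q τ ≈ₚ along p q (1# - τ)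
  foot≈along (px , py) (qx , qy) τ = eq px qx , eq py qy
    where
    eq : ∀ p q → q - τ * (q - p) ≈ p + (1# - τ) * (q - p)
    eq p q = solve 3 (λ p q τ → q :- τ :* (q :- p) := p :+ (con 1ℤ :- τ) :* (q :- p)) refl p q τ

  ∈-swap : ∀ {p q z} → z ∈[ p , q ] → z ∈[ q , p ]
  ∈-swap {p} {q} (t , 0≤t , t≤1 , ex , ey) = 1# - t , ≤⇒0≤- t≤1 ,
    0≤-⇒≤ (≤-respʳ-≈ (solve 1 (λ t → t := con 1ℤ :- (con 1ℤ :- t)) refl t) 0≤t) ,
    trans ex (eq _ _) , trans ey (eq _ _)
    where
    eq : ∀ p q → p + t * (q - p) ≈ q + (1# - t) * (p - q)
    eq p q = solve 3 (λ p q t → p :+ t :* (q :- p) := q :+ (con 1ℤ :- t) :* (p :- q)) refl p q t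

  Eventually² : ∀ {ℓ} → (Carrier → Carrier → Set ℓ) → Set _
  Eventually² P = Eventually λ τ → Eventually λ δ → P τ δ

  eventually²-× : ∀ {a b} {P : Carrier → Carrier → Set a} {Q : Carrier → Carrier → Set b} →
                  Eventually² P → Eventually² Q → Eventually² λ τ δ → P τ δ × Q τ δ
  eventually²-× f g = eventually-map (λ _ _ (x , y) → eventually-× x y) (eventually-× f g)

  eventually²-map : ∀ {a b} {P : Carrier → Carrier → Set a} {Q : Carrier → Carrier → Set b} →
                    (∀ τ δ → 0# < τ → 0# < δ → P τ δ → Q τ δ) → Eventually² P → Eventually² Q
  eventually²-map f = eventually-map λ τ 0<τ → eventually-map λ δ 0<δ → f τ δ 0<τ 0<δ

  eventually²-∃ : ∀ {a} {P : Carrier → Carrier → Set a} → Eventually² P → ∃[ τ ] ∃[ δ ] P τ δ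
  eventually²-∃ f =
    let τ , _ , g = eventually-∃ f
        δ , _ , h = eventually-∃ g
    in τ , δ , h

  above-sidePoint : ∀ H {p q} ω → 0# < height H q → Eventually² λ τ δ → 0# < height H (sidePoint p q ω τ δ)
  above-sidePoint H {p} {q} ω h = eventually-map (λ τ _ → eventually-above H _) (eventually-above⁻ H (q -ₚ p) h)

-- The two sides of an edge of a simple polygon

record IsSimplePolygon {c ℓ₁ ℓ₂} (F : OrderedField c ℓ₁ ℓ₂) {m : ℕ} (P : Fin (suc m) → Plabic.Point F) :
    Set (c ⊔ ℓ₁ ⊔ ℓ₂) where
  open Plabic F
  field
    nondegenerate : ∀ i → ¬ (P i ≈ₚ P (next i))
    simple        : ∀ {i j z} → i ≢ j → z ∈[ P i , P (next i) ] → z ∈[ P j , P (next j) ] →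
                    next j ≡ i × z ≈ₚ P i ⊎ next i ≡ j × z ≈ₚ P j

module SimplePolygon {c ℓ₁ ℓ₂} (F : OrderedField c ℓ₁ ℓ₂) {m : ℕ}
  {P : Fin (suc m) → Plabic.Point F} (polygon : IsSimplePolygon F P) where
  open OrderedFieldProperties F
  open Plabic F
  open IsSimplePolygon polygon
  open EventuallyProperties F
  open CrossingParity F
  open PlaneGeometry F
  open Segments F
  open Polygon F P public

  edgeDir : Fin (suc m) → Point
  edgeDir i = P (next i) -ₚ P i

  edgeDir≉0 : ∀ i → ¬ (edgeDir i ≈ₚ origin)
  edgeDir≉0 i = difference≉0 (nondegenerate i)

  parity-cong : ∀ {x y} → x ≈ₚ y → parity x ≡ parity y
  parity-cong {x} {y} e = parity-homotopy x y (λ _ → false) λ i →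
    xor-same (cut-cong (-ₚ-cong (≈ₚ-refl {P i}) e) (-ₚ-cong (≈ₚ-refl {P (next i)}) e))

  off-others : ∀ {i g t} → i ≢ g → Proper t → ¬ (along (P i) (P (next i)) t ∈[ P g , P (next g) ])
  off-others {i} {g} {t} i≢g t∈ on-g = ends (simple i≢g (proper⇒∈ t∈) on-g)
    where
    z : Point
    z = along (P i) (P (next i)) t
    ends : next g ≡ i × z ≈ₚ P i ⊎ next i ≡ g × z ≈ₚ P g → ⊥
    ends (inj₁ (_ , z≈))      = along≉start (nondegenerate i) (proj₁ t∈) z≈
    ends (inj₂ (≡.refl , z≈)) = along≉end (nondegenerate i) (proj₂ t∈) z≈

  vertex-off : ∀ {i g} → g ≢ i → g ≢ next i → ¬ (P (next i) ∈[ P g , P (next g) ])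
  vertex-off {i} {g} g≢i g≢j on-g =
    [ (λ (_ , z≈) → nondegenerate i (≈ₚ-sym z≈)) , (λ (i≡g , _) → g≢j (≡.sym i≡g)) ]′
      (simple (λ i≡g → g≢i (≡.sym i≡g)) (end∈ {P i}) on-g)

  next≢ : ∀ i → i ≢ next i
  next≢ i eq = nondegenerate i (≡.subst (λ j → P i ≈ₚ P j) eq ≈ₚ-refl)

  foot-off : ∀ {i g τ} → i ≢ g → Proper τ → ¬ (foot (P i) (P (next i)) τ ∈[ P g , P (next g) ])
  foot-off {i} i≢g τ on-g = off-others i≢g (1-proper τ) (∈-resp-≈ (foot≈along (P i) (P (next i)) _) on-g)

  sidePt : Fin (suc m) → (ω τ δ : Carrier) → Point
  sidePt i = sidePoint (P i) (P (next i))

  footOf : Fin (suc m) → Carrier → Point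
  footOf i = foot (P i) (P (next i))

  Clear : Fin (suc m) → (ω τ δ : Carrier) → Set _
  Clear i ω τ δ = ∀ g → i ≢ g → ¬ Meet (P g) (P (next g)) (footOf i τ) (sidePt i ω τ δ)

  eventually-≢ : ∀ {a i} {P : Fin (suc m) → Carrier → Set a} →
                 (∀ g → i ≢ g → Eventually (P g)) → Eventually λ ε → ∀ g → i ≢ g → P g ε
  eventually-≢ {i = i} {P} f = eventually-∀ one
    where
    one : ∀ g → Eventually λ ε → i ≢ g → P g ε
    one g with i Fin.≟ g
    ... | yes i≡g = always λ _ _ i≢g → contradiction i≡g i≢g
    ... | no i≢g  = eventually-map (λ _ _ p _ → p) (f g i≢g)

  eventually-clear : ∀ i ω {τ} → Proper τ → Eventually λ δ → Clear i ω τ δ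
  eventually-clear i ω {τ} τ∈ = eventually-≢ λ g i≢g →
    clear-of g (separate (nondegenerate g) (foot-off i≢g τ∈))
    where
    clear-of : ∀ g → ∃[ H ] (Separates H (P g) (P (next g)) × 0# < height H (footOf i τ)) →
               Eventually λ δ → ¬ Meet (P g) (P (next g)) (footOf i τ) (sidePt i ω τ δ)
    clear-of g (H , sep , h) = eventually-map
      (λ δ _ h′ → separated⇒disjoint {P g} {P (next g)} {footOf i τ} {sidePt i ω τ δ} H sep h h′)
      (eventually-above H {footOf i τ} (ω *ₚ rotate90 (edgeDir i)) h)

  feet-disjoint : ∀ {i g τ τ′} → i ≢ g → Proper τ → Proper τ′ →
                  ¬ Meet (P g) (P (next g)) (footOf i τ) (footOf i τ′)
  feet-disjoint {i} {g} {τ} {τ′} i≢g (a , b) (a′ , b′) (z , on-g , (t , 0≤t , t≤1 , z≈)) =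
    off-others i≢g (u-pos , u<1) (∈-resp-≈ (≈ₚ-trans z≈ (eq _ _ , eq _ _)) on-g)
    where
    u : Carrier
    u = (1# - t) * (1# - τ) + t * (1# - τ′)
    u-pos : 0# < u
    u-pos = convex-pos b b′ 0≤t t≤1
    u<1 : 0# < 1# - u
    u<1 = 0<-resp-≈ (solve 3 (λ t τ τ′ → (con 1ℤ :- t) :* τ :+ t :* τ′ :=
      con 1ℤ :- ((con 1ℤ :- t) :* (con 1ℤ :- τ) :+ t :* (con 1ℤ :- τ′))) refl t τ τ′) (convex-pos a a′ 0≤t t≤1)
    eq : ∀ p q → (q - τ * (q - p)) + t * ((q - τ′ * (q - p)) - (q - τ * (q - p))) ≈ p + u * (q - p)
    eq p q = solve 5 (λ p q t τ τ′ →
      (q :- τ :* (q :- p)) :+ t :* ((q :- τ′ :* (q :- p)) :- (q :- τ :* (q :- p))) :=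
      p :+ ((con 1ℤ :- t) :* (con 1ℤ :- τ) :+ t :* (con 1ℤ :- τ′)) :* (q :- p)) refl p q t τ τ′

  -- Only the square of `ω` matters, so one proof serves the left and the right side.
  Unit : Carrier → Set ℓ₁
  Unit ω = ω * ω ≈ 1#

  opaque
    unfolding height

    side-self : ∀ {ω} → Unit ω → ∀ p q {τ δ} → ¬ (p ≈ₚ q) → 0# < δ →
                0# < height (side ω p (q -ₚ p)) (sidePoint p q ω τ δ)
    side-self {ω} ωω p@(px , py) q@(qx , qy) {τ} {δ} p≉q 0<δ = 0<-resp-≈
      (trans (trans (sym (*-identityˡ _)) (*-congʳ (sym ωω)))
        (solve 7 (λ px py qx qy ω τ δ → let dx = qx :- px ; dy = qy :- py in
          ω :* ω :* (δ :* (dx :* dx :+ dy :* dy)) :=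
          ω :* (:- dy) :* (qx :- τ :* dx :+ δ :* (ω :* (:- dy)) :- px) :+
          ω :* dx :* (qy :- τ :* dy :+ δ :* (ω :* dx) :- py)) refl px py qx qy ω τ δ))
      (*-pos 0<δ (dot-self-pos (difference≉0 p≉q)))

    side-base : ∀ ω p q → Separates (side ω p (q -ₚ p)) p q
    side-base ω (px , py) (qx , qy) = separates
      (≈0⇒0≤- (solve 5 (λ ω px py qx qy →
        ω :* (:- (qy :- py)) :* (px :- px) :+ ω :* (qx :- px) :* (py :- py) := con 0ℤ) refl ω px py qx qy))
      (≈0⇒0≤- (solve 5 (λ ω px py qx qy →
        ω :* (:- (qy :- py)) :* (qx :- px) :+ ω :* (qx :- px) :* (qy :- py) := con 0ℤ) refl ω px py qx qy))

  -- The path x → foot → foot → y stays clear of the other edges, and seen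
  -- from either end of edge i it lies in a half plane.
  tube : ∀ i {ω τ τ′ δ δ′} → Unit ω → Proper τ → Proper τ′ → 0# < δ → 0# < δ′ →
         Clear i ω τ δ → Clear i ω τ′ δ′ → parity (sidePt i ω τ δ) ≡ parity (sidePt i ω τ′ δ′)
  tube i {ω} {τ} {τ′} {δ} {δ′} ωω τ∈ τ′∈ 0<δ 0<δ′ clear clear′ = parity-homotopy x y σ each
    where
    p q x y z w : Point
    p = P i
    q = P (next i)
    x = sidePt i ω τ δ
    y = sidePt i ω τ′ δ′
    z = footOf i τ
    w = footOf i τ′

    sweep : Point → Point → Point → Bool
    sweep a b r = cut (r -ₚ a) (r -ₚ b)

    σ : Point → Bool
    σ r = sweep x z r xor (sweep z w r xor sweep w y r)

    concatenate : ∀ a b c d {s t u s′ t′ u′} → a xor b ≡ s xor s′ → b xor c ≡ t xor t′ → c xor d ≡ u xor u′ →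
                  a xor d ≡ (s xor (t xor u)) xor (s′ xor (t′ xor u′))
    concatenate a b c d {s} {t} {u} {s′} {t′} {u′} e f g = ≡.trans
      (xor-solve 4 (λ a b c d → a ⊕ d ⊜ (a ⊕ b) ⊕ ((b ⊕ c) ⊕ (c ⊕ d))) ≡.refl a b c d)
      (≡.trans (≡.cong₂ _xor_ e (≡.cong₂ _xor_ f g))
        (xor-solve 6 (λ s t u s′ t′ u′ → (s ⊕ s′) ⊕ ((t ⊕ t′) ⊕ (u ⊕ u′)) ⊜ (s ⊕ (t ⊕ u)) ⊕ (s′ ⊕ (t′ ⊕ u′)))
          ≡.refl s t u s′ t′ u′))

    0<D : 0# < dot (edgeDir i) (edgeDir i)
    0<D = dot-self-pos (edgeDir≉0 i)

    -- Within a half plane no triangle formed by points of the path contains the origin, so the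
    -- three pieces cross the ray as often, mod 2, as the direct segment from `x` to `y`.
    contract : ∀ r n → 0# < dot n (r -ₚ x) → 0# < dot n (r -ₚ z) → 0# < dot n (r -ₚ w) → 0# < dot n (r -ₚ y) →
               sweep x y r ≡ σ r
    contract r n hx hz hw hy = ≡.trans
      (cut-triangle {r -ₚ x} (positive⇒¬OriginInTriangle {n} {r -ₚ x} {r -ₚ w} {r -ₚ y} hx hw hy))
      (≡.trans (≡.cong (_xor sweep w y r) (cut-triangle {r -ₚ x} (positive⇒¬OriginInTriangle {n} {r -ₚ x} {r -ₚ z} {r -ₚ w} hx hz hw)))
               (Bool.xor-assoc (sweep x z r) _ _))

    start-x : ∀ p q {τ δ} → 0# < 1# - τ → 0# < dot (q -ₚ p) (q -ₚ p) → 0# < dot (-ₚ (q -ₚ p)) (p -ₚ sidePoint p q ω τ δ)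
    start-x (px , py) (qx , qy) {τ} {δ} h D = 0<-resp-≈
      (solve 7 (λ px py qx qy ω τ δ → let dx = qx :- px ; dy = qy :- py in
        (con 1ℤ :- τ) :* (dx :* dx :+ dy :* dy) :=
        (:- dx) :* (px :- (qx :- τ :* dx :+ δ :* (ω :* (:- dy)))) :+
        (:- dy) :* (py :- (qy :- τ :* dy :+ δ :* (ω :* dx)))) refl px py qx qy ω τ δ) (*-pos h D)

    start-z : ∀ p q {τ} → 0# < 1# - τ → 0# < dot (q -ₚ p) (q -ₚ p) → 0# < dot (-ₚ (q -ₚ p)) (p -ₚ foot p q τ)
    start-z (px , py) (qx , qy) {τ} h D = 0<-resp-≈
      (solve 5 (λ px py qx qy τ → let dx = qx :- px ; dy = qy :- py in
        (con 1ℤ :- τ) :* (dx :* dx :+ dy :* dy) :=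
        (:- dx) :* (px :- (qx :- τ :* dx)) :+ (:- dy) :* (py :- (qy :- τ :* dy))) refl px py qx qy τ) (*-pos h D)

    end-x : ∀ p q {τ δ} → 0# < τ → 0# < dot (q -ₚ p) (q -ₚ p) → 0# < dot (q -ₚ p) (q -ₚ sidePoint p q ω τ δ)
    end-x (px , py) (qx , qy) {τ} {δ} h D = 0<-resp-≈
      (solve 7 (λ px py qx qy ω τ δ → let dx = qx :- px ; dy = qy :- py in
        τ :* (dx :* dx :+ dy :* dy) :=
        dx :* (qx :- (qx :- τ :* dx :+ δ :* (ω :* (:- dy)))) :+
        dy :* (qy :- (qy :- τ :* dy :+ δ :* (ω :* dx)))) refl px py qx qy ω τ δ) (*-pos h D)

    end-z : ∀ p q {τ} → 0# < τ → 0# < dot (q -ₚ p) (q -ₚ p) → 0# < dot (q -ₚ p) (q -ₚ foot p q τ)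
    end-z (px , py) (qx , qy) {τ} h D = 0<-resp-≈
      (solve 5 (λ px py qx qy τ → let dx = qx :- px ; dy = qy :- py in
        τ :* (dx :* dx :+ dy :* dy) :=
        dx :* (qx :- (qx :- τ :* dx)) :+ dy :* (qy :- (qy :- τ :* dy))) refl px py qx qy τ) (*-pos h D)

    each : ∀ g → cutEdge g x xor cutEdge g y ≡ σ (P g) xor σ (P (next g))
    each g with i Fin.≟ g
    ... | no i≢g = concatenate (cutEdge g x) (cutEdge g z) (cutEdge g w) (cutEdge g y)
      {sweep x z (P g)} {sweep z w (P g)} {sweep w y (P g)} {sweep x z (P (next g))} {sweep z w (P (next g))} {sweep w y (P (next g))}
      (cut-parallelogram (P g) (P (next g)) x z λ (v , a , b) → clear g i≢g (v , a , ∈-swap b))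
      (cut-parallelogram (P g) (P (next g)) z w (feet-disjoint i≢g τ∈ τ′∈))
      (cut-parallelogram (P g) (P (next g)) w y (clear′ g i≢g))
    -- The feet lie on edge `i` itself, so for this edge `x` and `y` are compared directly. Both are
    -- strictly on one side of its line, and `contract` then replaces the direct segment by the path
    -- at either end.
    ... | yes ≡.refl = ≡.trans
      (cut-parallelogram p q x y (separated⇒disjoint (side ω p (q -ₚ p)) (side-base ω p q)
        (side-self ωω p q (nondegenerate i) 0<δ) (side-self ωω p q (nondegenerate i) 0<δ′)))
      (≡.cong₂ _xor_
        (contract p (-ₚ (q -ₚ p)) (start-x p q (proj₂ τ∈) 0<D) (start-z p q (proj₂ τ∈) 0<D) (start-z p q (proj₂ τ′∈) 0<D) (start-x p q (proj₂ τ′∈) 0<D))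
        (contract q (q -ₚ p) (end-x p q (proj₁ τ∈) 0<D) (end-z p q (proj₁ τ∈) 0<D) (end-z p q (proj₁ τ′∈) 0<D) (end-x p q (proj₁ τ′∈) 0<D)))

  unit-1 : Unit 1#
  unit-1 = *-identityˡ 1#

  unit--1 : Unit (- 1#)
  unit--1 = solve 0 ((:- con 1ℤ) :* (:- con 1ℤ) := con 1ℤ) refl

  SideParity : Carrier → Fin (suc m) → Bool → Set _
  SideParity ω i b = ∀ τ → Proper τ → Eventually λ δ → parity (sidePt i ω τ δ) ≡ b

  -- The two points are mirror images in the foot. The segment between them therefore crosses edge
  -- `i` at its own midpoint, with parameter `1# - τ` on the edge, and for small `δ` it stays away
  -- from the other edges.
  flips : ∀ i {τ} → Proper τ → Eventually λ δ → parity (sidePt i 1# τ δ) ≡ not (parity (sidePt i (- 1#) τ δ))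
  flips i {τ} τ∈ = eventually-map flip (eventually-≢ λ g i≢g →
      across g (separate (nondegenerate g) (foot-off i≢g τ∈)))
    where
    across : ∀ g → ∃[ H ] (Separates H (P g) (P (next g)) × 0# < height H (footOf i τ)) →
             Eventually λ δ → ¬ Meet (P g) (P (next g)) (sidePt i 1# τ δ) (sidePt i (- 1#) τ δ)
    across g (H , sep , h) = eventually-map
      (λ δ _ (h₁ , h₂) → separated⇒disjoint {P g} {P (next g)} {sidePt i 1# τ δ} {sidePt i (- 1#) τ δ} H sep h₁ h₂)
      (eventually-× (eventually-above H {footOf i τ} (1# *ₚ rotate90 (edgeDir i)) h)
                    (eventually-above H {footOf i τ} (- 1# *ₚ rotate90 (edgeDir i)) h))

    flip : ∀ δ → 0# < δ → (∀ g → i ≢ g → ¬ Meet (P g) (P (next g)) (sidePt i 1# τ δ) (sidePt i (- 1#) τ δ)) →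
           parity (sidePt i 1# τ δ) ≡ not (parity (sidePt i (- 1#) τ δ))
    flip δ 0<δ disjoint = parity-flip (sidePt i 1# τ δ) (sidePt i (- 1#) τ δ) i
      (λ g g≢i → disjoint g λ i≡g → g≢i (≡.sym i≡g)) (crossing (P i) (P (next i)) (nondegenerate i))
      where
      0<τ : 0# < τ
      0<τ = proj₁ τ∈
      0<1-τ : 0# < 1# - τ
      0<1-τ = proj₂ τ∈
      crossing : ∀ p q → ¬ (p ≈ₚ q) → let x = sidePoint p q 1# τ δ ; y = sidePoint p q (- 1#) τ δ in
        cut (p -ₚ x) (q -ₚ x) xor cut (p -ₚ y) (q -ₚ y) ≡ not (cut (p -ₚ x) (p -ₚ y) xor cut (q -ₚ x) (q -ₚ y))
      crossing p@(px , py) q@(qx , qy) p≉q = cut-crossing p q _ _ 0<1-τ (proj₂ (1-proper τ∈)) 0<½ (proj₂ ½-proper)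
        (meet px qx (- (qy - py)) , meet py qy (qx - px))
        (0<-resp-≈ (solve 6 (λ px py qx qy τ δ →
          let dx = qx :- px ; dy = qy :- py
              x₁ = qx :- τ :* dx :+ δ :* (con 1ℤ :* (:- dy)) ; x₂ = qy :- τ :* dy :+ δ :* (con 1ℤ :* dx) in
          δ :* (dx :* dx :+ dy :* dy) := (px :- x₁) :* (qy :- x₂) :- (py :- x₂) :* (qx :- x₁)) refl px py qx qy τ δ)
          (*-pos 0<δ 0<D))
        (0<-resp-≈ (solve 6 (λ px py qx qy τ δ →
          let dx = qx :- px ; dy = qy :- py
              x₁ = qx :- τ :* dx :+ δ :* (con 1ℤ :* (:- dy)) ; x₂ = qy :- τ :* dy :+ δ :* (con 1ℤ :* dx)
              y₁ = qx :- τ :* dx :+ δ :* ((:- con 1ℤ) :* (:- dy)) ; y₂ = qy :- τ :* dy :+ δ :* ((:- con 1ℤ) :* dx) in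
          τ :* (δ :* (dx :* dx :+ dy :* dy)) :+ τ :* (δ :* (dx :* dx :+ dy :* dy)) :=
          (qx :- x₁) :* (qy :- y₂) :- (qy :- x₂) :* (qx :- y₁)) refl px py qx qy τ δ)
          (+-pos (*-pos 0<τ (*-pos 0<δ 0<D)) (*-pos 0<τ (*-pos 0<δ 0<D))))
        (0<-resp-≈ (solve 6 (λ px py qx qy τ δ →
          let dx = qx :- px ; dy = qy :- py
              y₁ = qx :- τ :* dx :+ δ :* ((:- con 1ℤ) :* (:- dy)) ; y₂ = qy :- τ :* dy :+ δ :* ((:- con 1ℤ) :* dx) in
          δ :* (dx :* dx :+ dy :* dy) := (qx :- y₁) :* (py :- y₂) :- (qy :- y₂) :* (px :- y₁)) refl px py qx qy τ δ)
          (*-pos 0<δ 0<D))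
        (0<-resp-≈ (solve 6 (λ px py qx qy τ δ →
          let dx = qx :- px ; dy = qy :- py
              x₁ = qx :- τ :* dx :+ δ :* (con 1ℤ :* (:- dy)) ; x₂ = qy :- τ :* dy :+ δ :* (con 1ℤ :* dx)
              y₁ = qx :- τ :* dx :+ δ :* ((:- con 1ℤ) :* (:- dy)) ; y₂ = qy :- τ :* dy :+ δ :* ((:- con 1ℤ) :* dx) in
          (con 1ℤ :- τ) :* (δ :* (dx :* dx :+ dy :* dy)) :+ (con 1ℤ :- τ) :* (δ :* (dx :* dx :+ dy :* dy)) :=
          (px :- y₁) :* (py :- x₂) :- (py :- y₂) :* (px :- x₁)) refl px py qx qy τ δ)
          (+-pos (*-pos 0<1-τ (*-pos 0<δ 0<D)) (*-pos 0<1-τ (*-pos 0<δ 0<D))))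
        where
        0<D : 0# < dot (q -ₚ p) (q -ₚ p)
        0<D = dot-self-pos (difference≉0 p≉q)
        meet : ∀ p q n → p + (1# - τ) * (q - p) ≈
          (q - τ * (q - p) + δ * (1# * n)) +
          ½ * ((q - τ * (q - p) + δ * (- 1# * n)) - (q - τ * (q - p) + δ * (1# * n)))
        -- The solver knows nothing about `½`. A vanishing multiple (1 - 1) of `δ * n` is inserted,
        -- and its second unit is then replaced by `½ + ½`.
        meet p q n = trans
          (solve 6 (λ p q n τ δ h → p :+ (con 1ℤ :- τ) :* (q :- p) :=
            (q :- τ :* (q :- p)) :+ (con 1ℤ :- con 1ℤ) :* (δ :* n)) refl p q n τ δ ½)
          (trans (+-congˡ (*-congʳ (+-congˡ (-‿cong (sym ½+½≈1)))))
            (solve 6 (λ p q n τ δ h → (q :- τ :* (q :- p)) :+ (con 1ℤ :- (h :+ h)) :* (δ :* n) :=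
              (q :- τ :* (q :- p) :+ δ :* (con 1ℤ :* n)) :+
              h :* ((q :- τ :* (q :- p) :+ δ :* ((:- con 1ℤ) :* n)) :- (q :- τ :* (q :- p) :+ δ :* (con 1ℤ :* n))))
              refl p q n τ δ ½))

  -- One crossing at the midpoint of the edge shows that the sides differ, and `tube` spreads the
  -- two values along the edge.
  sideParities : ∀ i → ∃[ b ] (SideParity 1# i b × SideParity (- 1#) i (not b))
  sideParities i = from (eventually-∃ (eventually-× (flips i ½-proper)
                     (eventually-× (eventually-clear i 1# ½-proper) (eventually-clear i (- 1#) ½-proper))))
    where
    from : ∃[ δ ] (0# < δ × parity (sidePt i 1# ½ δ) ≡ not (parity (sidePt i (- 1#) ½ δ)) ×
                   Clear i 1# ½ δ × Clear i (- 1#) ½ δ) →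
           ∃[ b ] (SideParity 1# i b × SideParity (- 1#) i (not b))
    from (δ₀ , 0<δ₀ , flipped , clear₁ , clear₂) = parity (sidePt i 1# ½ δ₀) ,
      (λ τ τ∈ → eventually-map (λ δ 0<δ clear → tube i unit-1 τ∈ ½-proper 0<δ 0<δ₀ clear clear₁) (eventually-clear i 1# τ∈)) ,
      (λ τ τ∈ → eventually-map (λ δ 0<δ clear →
        ≡.trans (tube i unit--1 τ∈ ½-proper 0<δ 0<δ₀ clear clear₂)
          (≡.trans (≡.sym (Bool.not-involutive _)) (≡.cong not (≡.sym flipped)))) (eventually-clear i (- 1#) τ∈))

-- Parities and tables of sign patterns

odd : ℕ → Bool
odd zero    = false
odd (suc n) = not (odd n)

oddℤ : ℤ → Bool
oddℤ i = odd ℤ.∣ i ∣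

odd-+ : ∀ m n → odd (m ℕ.+ n) ≡ odd m xor odd n
odd-+ zero    n = ≡.refl
odd-+ (suc m) n = ≡.trans (≡.cong not (odd-+ m n)) (Bool.not-distribˡ-xor (odd m) (odd n))

odd-⊖ : ∀ m n → oddℤ (m ℤ.⊖ n) ≡ odd m xor odd n
odd-⊖ zero    zero    = ≡.refl
odd-⊖ zero    (suc n) = ≡.refl
odd-⊖ (suc m) zero    = ≡.sym (Bool.xor-identityʳ _)
odd-⊖ (suc m) (suc n) = ≡.trans (≡.cong oddℤ (ℤ.[1+m]⊖[1+n]≡m⊖n m n)) (≡.trans (odd-⊖ m n)
  (xor-solve 2 (λ a b → a ⊕ b ⊜ (bit-con true ⊕ a) ⊕ (bit-con true ⊕ b)) ≡.refl (odd m) (odd n)))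

oddℤ-+ : ∀ m i → oddℤ (+ m ℤ.+ i) ≡ odd m xor oddℤ i
oddℤ-+ m (+ n)    = odd-+ m n
oddℤ-+ m -[1+ n ] = odd-⊖ m (suc n)

isPositive isNegative : ℤ → Bool
isPositive (+ suc _) = true
isPositive _         = false
isNegative i = isPositive (ℤ.- i)

-- For directions e, f, w with k, m, n the orientations of (e, f), (e, w),
-- (f, w): whether w points to the left of the path that turns from e to f.
leftOf : (k m n : ℤ) → Bool
leftOf k m n = if isNegative k then isPositive m ∨ isPositive n else isPositive m ∧ isPositive n

data IsSign : ℤ → Set where
  plus  : IsSign 1ℤ
  nil   : IsSign 0ℤ
  minus : IsSign -1ℤ

-- Nested uses make a statement about all sign patterns decidable by evaluation, which is how the
-- tables below are proved.
∀sign? : ∀ {p} {P : ℤ → Set p} → (∀ i → Dec (P i)) → Dec (∀ {i} → IsSign i → P i)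
∀sign? P? = map′ (λ { (p , _ , _) plus → p ; (_ , z , _) nil → z ; (_ , _ , m) minus → m })
                 (λ f → f plus , f nil , f minus)
                 (P? 1ℤ ×-dec P? 0ℤ ×-dec P? -1ℤ)

NoGain : (x y z : ℤ) → Set
NoGain x y z = isNegative x ≡ false → isNegative y ≡ false → isNegative z ≡ false →
               isPositive x ∨ isPositive y ∨ isPositive z ≡ false

-- The possible signs of the summands of a vanishing sum.
Balanced : (x y z : ℤ) → Set
Balanced x y z = NoGain x y z × NoGain (ℤ.- x) (ℤ.- y) (ℤ.- z)

balanced? : ∀ x y z → Dec (Balanced x y z)
balanced? x y z = gain? x y z ×-dec gain? (ℤ.- x) (ℤ.- y) (ℤ.- z)
  where
  gain? : ∀ x y z → Dec (NoGain x y z)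
  gain? x y z = (isNegative x Bool.≟ false) →-dec (isNegative y Bool.≟ false) →-dec (isNegative z Bool.≟ false) →-dec
                ((isPositive x ∨ isPositive y ∨ isPositive z) Bool.≟ false)

windOf : (x y z : ℤ) → ℤ
windOf x y z = if does (x ℤ.≟ y ×-dec y ℤ.≟ z) then x else 0ℤ

windParity : (x y z : ℤ) → Bool
windParity x y z = oddℤ (windOf x y z)

-- The parity of γ₂ (e), where a = s (e , 𝔩).
descent : ℤ → Bool
descent a = odd ⌊ ℤ.∣ 1ℤ ℤ.- a ∣ /2⌋

-- The reversed turn runs from `- f` to `- e`: its orientations are `- k`, `- b` and `a`. The
-- winding should change its parity exactly when `γ₂` differs on the two edges.
straightDefect : (k a b : ℤ) → Bool
straightDefect k a b =
  (descent a xor descent b) xor (windParity k a (ℤ.- b) xor windParity (ℤ.- k) (ℤ.- b) a)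

-- Two consecutive edges that are parallel point the same way, whence the premise for `k ≡ 0ℤ`.
straight-table : ∀ {k} → IsSign k → ∀ {a} → IsSign a → ∀ {b} → IsSign b →
                 a ≢ 0ℤ → b ≢ 0ℤ → (k ≡ 0ℤ → a ≡ b) → straightDefect k a b ≡ false
straight-table = toWitness {a? = ∀sign? λ k → ∀sign? λ a → ∀sign? λ b →
  ¬? (a ℤ.≟ 0ℤ) →-dec ¬? (b ℤ.≟ 0ℤ) →-dec (k ℤ.≟ 0ℤ →-dec a ℤ.≟ b) →-dec straightDefect k a b Bool.≟ false} _

-- Here a, b, c are the orientations of (e, 𝔩), (f, 𝔩), (w, 𝔩); reversing an
-- edge negates its orientations.
exitDefect entryDefect : (k m n a b c : ℤ) → Bool
exitDefect k m n a b c =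
  (descent b xor windParity k a (ℤ.- b)) xor
    (windParity m a (ℤ.- c) xor windParity (ℤ.- n) (ℤ.- b) (ℤ.- c))
entryDefect k m n a b c =
  (descent a xor windParity k a (ℤ.- b)) xor
    (windParity n (ℤ.- c) (ℤ.- b) xor windParity (ℤ.- m) (ℤ.- c) a)

-- The premises discard patterns that no vectors at a corner realise. Those on zeros express how
-- parallel edges may point without overlapping; the balance comes from the three-term
-- Grassmann-Plücker relation between e, f, w and 𝔩.
branch-table : ∀ {k} → IsSign k → ∀ {m} → IsSign m → ∀ {n} → IsSign n →
               ∀ {a} → IsSign a → ∀ {b} → IsSign b → ∀ {c} → IsSign c →
               a ≢ 0ℤ → b ≢ 0ℤ → c ≢ 0ℤ → (k ≡ 0ℤ → a ≡ b) → (m ≡ 0ℤ → n ≡ ℤ.- k) → (n ≡ 0ℤ → m ≡ ℤ.- k) →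
               ¬ (m ≡ 0ℤ × n ≡ 0ℤ × k ≡ 0ℤ) → Balanced (k ℤ.* c) (ℤ.- (m ℤ.* b)) (a ℤ.* n) →
               exitDefect k m n a b c ≡ leftOf k m n × entryDefect k m n a b c ≡ not (leftOf k m n)
branch-table = toWitness {a? = ∀sign? λ k → ∀sign? λ m → ∀sign? λ n → ∀sign? λ a → ∀sign? λ b → ∀sign? λ c →
  ¬? (a ℤ.≟ 0ℤ) →-dec ¬? (b ℤ.≟ 0ℤ) →-dec ¬? (c ℤ.≟ 0ℤ) →-dec
  (k ℤ.≟ 0ℤ →-dec a ℤ.≟ b) →-dec (m ℤ.≟ 0ℤ →-dec n ℤ.≟ ℤ.- k) →-dec (n ℤ.≟ 0ℤ →-dec m ℤ.≟ ℤ.- k) →-dec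
  ¬? (m ℤ.≟ 0ℤ ×-dec n ℤ.≟ 0ℤ ×-dec k ℤ.≟ 0ℤ) →-dec
  balanced? (k ℤ.* c) (ℤ.- (m ℤ.* b)) (a ℤ.* n) →-dec
  (exitDefect k m n a b c Bool.≟ leftOf k m n ×-dec entryDefect k m n a b c Bool.≟ not (leftOf k m n))} _

-- Orientations and windings at a turn

module TurnVectors {c ℓ₁ ℓ₂} (F : OrderedField c ℓ₁ ℓ₂) where
  open OrderedFieldProperties F
  open Plabic F
  open CrossingParity F
  open PlaneGeometry F

  cross-self : ∀ u → cross u u ≈ 0#
  cross-self (x , y) = solve 2 (λ x y → x :* y :- y :* x := con 0ℤ) refl x y

  -- Expansions of w along e and its normal.
  expand-cross : ∀ e f w → dot e e * cross f w ≈ dot e f * cross e w - dot e w * cross e f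
  expand-cross (ex , ey) (fx , fy) (wx , wy) = solve 6 (λ ex ey fx fy wx wy →
    (ex :* ex :+ ey :* ey) :* (fx :* wy :- fy :* wx) :=
    (ex :* fx :+ ey :* fy) :* (ex :* wy :- ey :* wx) :- (ex :* wx :+ ey :* wy) :* (ex :* fy :- ey :* fx))
    refl ex ey fx fy wx wy

  expand-dot : ∀ e f w → dot e e * dot f w ≈ dot e f * dot e w + cross e f * cross e w
  expand-dot (ex , ey) (fx , fy) (wx , wy) = solve 6 (λ ex ey fx fy wx wy →
    (ex :* ex :+ ey :* ey) :* (fx :* wx :+ fy :* wy) :=
    (ex :* fx :+ ey :* fy) :* (ex :* wx :+ ey :* wy) :+ (ex :* fy :- ey :* fx) :* (ex :* wy :- ey :* wx))
    refl ex ey fx fy wx wy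

  SignOf⇒IsSign : ∀ {x i} → SignOf x i → IsSign i
  SignOf⇒IsSign (positive _) = plus
  SignOf⇒IsSign (null _)     = nil
  SignOf⇒IsSign (negative _) = minus

  SignOf-sgn : ∀ x → SignOf x (sgn x)
  SignOf-sgn x with compare 0# x
  ... | tri< 0<x _ _ = positive 0<x
  ... | tri≈ _ 0≈x _ = null (sym 0≈x)
  ... | tri> _ _ x<0 = negative (<0⇒0<- x<0)

  SignOf⇒s : ∀ u v {i} → SignOf (cross u v) i → s u v ≡ i
  SignOf⇒s u v σ = SignOf-unique (SignOf-sgn (cross u v)) σ

  wind≡windOf : ∀ 𝔩 u v {x y z} → SignOf (cross u v) x → SignOf (cross u 𝔩) y → SignOf (cross 𝔩 v) z →
                wind 𝔩 u v ≡ windOf x y z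
  wind≡windOf 𝔩 u v {x} {y} {z} sx sy sz = ≡.trans (≡.cong (λ x → windOf x (s u 𝔩) (s 𝔩 v)) (SignOf⇒s u v sx))
    (≡.cong₂ (windOf x) (SignOf⇒s u 𝔩 sy) (SignOf⇒s 𝔩 v sz))

  noGain : ∀ {x y z i j k} → x + y + z ≈ 0# → SignOf x i → SignOf y j → SignOf z k → NoGain i j k
  noGain {x} {y} {z} {i} {j} {k} sum≈0 sx sy sz i≥0 j≥0 k≥0 = ≡.cong₂ _∨_ (zero-part sx
      λ p → 0<⇒≉0 (+-pos-nonneg (+-pos-nonneg p (nonneg sy j≥0)) (nonneg sz k≥0)) sum≈0)
    (≡.cong₂ _∨_ (zero-part sy λ p → 0<⇒≉0 (+-pos-nonneg (0<-resp-≈ (+-comm y x) (+-pos-nonneg p (nonneg sx i≥0))) (nonneg sz k≥0)) sum≈0)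
      (zero-part sz λ p → 0<⇒≉0 (0<-resp-≈ (+-comm z (x + y)) (+-pos-nonneg p (+-nonneg (nonneg sx i≥0) (nonneg sy j≥0)))) sum≈0))
    where
    nonneg : ∀ {x i} → SignOf x i → isNegative i ≡ false → 0# ≤ x
    nonneg (positive p) _ = inj₁ p
    nonneg (null p) _     = inj₂ (sym p)
    nonneg (negative p) ()
    zero-part : ∀ {x i} → SignOf x i → ¬ (0# < x) → isPositive i ≡ false
    zero-part (positive p) ¬p = contradiction p ¬p
    zero-part (null _) _     = ≡.refl
    zero-part (negative _) _ = ≡.refl

  balanced : ∀ {x y z i j k} → x + y + z ≈ 0# → SignOf x i → SignOf y j → SignOf z k → Balanced i j k
  balanced {x} {y} {z} sum≈0 sx sy sz = noGain sum≈0 sx sy sz ,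
    noGain (trans (solve 3 (λ x y z → (:- x) :+ (:- y) :+ (:- z) := :- (x :+ y :+ z)) refl x y z) (-0≈0 sum≈0))
           (SignOf-neg sx) (SignOf-neg sy) (SignOf-neg sz)

  cross-flip : ∀ u v → cross u v ≈ cross (-ₚ v) u
  cross-flip (ux , uy) (vx , vy) = solve 4 (λ ux uy vx vy → ux :* vy :- uy :* vx := (:- vx) :* uy :- (:- vy) :* ux) refl ux uy vx vy

  SignOf-swap : ∀ u v {i} → SignOf (cross u v) i → SignOf (cross v u) (ℤ.- i)
  SignOf-swap u v σ = SignOf-resp-≈ (cross-anti u v) (SignOf-neg σ)

  module TurnSigns (e f : Point) (e≉0 : ¬ (e ≈ₚ origin)) (f≉0 : ¬ (f ≈ₚ origin))
    (no-backtracking : cross e f ≈ 0# → 0# < dot e f) where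

    private
      κ = cross e f
      0<ee = dot-self-pos e≉0
      0<ff = dot-self-pos f≉0

    module _ (𝔩 : Point) {a b : ℤ} (ea : SignOf (cross e 𝔩) a) (fb : SignOf (cross f 𝔩) b) (a≢0 : a ≢ 0ℤ) (b≢0 : b ≢ 0ℤ)
      {e′ f′ : Point} (e′≈ : e′ ≈ₚ -ₚ e) (f′≈ : f′ ≈ₚ -ₚ f) where

      straight-signs : ∀ {k} → SignOf κ k → k ≡ 0ℤ → a ≡ b
      straight-signs (null κ≈0) _ = SignOf-unique ea (scaled-sign (no-backtracking κ≈0) 0<ee
        (sym (trans (expand-cross e f 𝔩) (trans (+-congˡ (trans (-‿cong (*-≈0 (dot e 𝔩) κ≈0)) (solve 0 (:- con 0ℤ := con 0ℤ) refl))) (+-identityʳ _)))) fb)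

      wind-ef : ∀ {k} → SignOf κ k → wind 𝔩 e f ≡ windOf k a (ℤ.- b)
      wind-ef κk = wind≡windOf 𝔩 e f κk ea (SignOf-swap f 𝔩 fb)

      f′b : SignOf (cross f′ 𝔩) (ℤ.- b)
      f′b = SignOf-resp-≈ (sym (trans (cross-cong f′≈ (≈ₚ-refl {𝔩})) (cross-negˡ f 𝔩))) (SignOf-neg fb)

      𝔩e′ : SignOf (cross 𝔩 e′) a
      𝔩e′ = SignOf-resp-≈ (trans (cross-cong-neg (cross-negˡ e 𝔩)) (trans (cross-anti (-ₚ e) 𝔩) (cross-cong (≈ₚ-refl {𝔩}) (≈ₚ-sym e′≈)))) ea
        where
        cross-cong-neg : ∀ {x y} → x ≈ - y → y ≈ - x
        cross-cong-neg {x} {y} h = trans (solve 1 (λ y → y := :- (:- y)) refl y) (-‿cong (sym h))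

      straight-winds : (descent a xor descent b) xor (oddℤ (wind 𝔩 e f) xor oddℤ (wind 𝔩 f′ e′)) ≡ false
      straight-winds = from (signOf κ)
        where
        from : ∃[ k ] SignOf κ k → _
        from (k , κk) = ≡.trans
          (≡.cong ((descent a xor descent b) xor_) (≡.cong₂ (λ x y → oddℤ x xor oddℤ y) (wind-ef κk)
            (wind≡windOf 𝔩 f′ e′ (SignOf-resp-≈ (sym (trans (cross-cong f′≈ e′≈) (cross-neg f e))) (SignOf-swap e f κk)) f′b 𝔩e′)))
          (straight-table (SignOf⇒IsSign κk) (SignOf⇒IsSign ea) (SignOf⇒IsSign fb) a≢0 b≢0 (straight-signs κk))

    -- The two premises say that a ray from the corner in direction `w` overlaps neither edge there:
    -- `w` is no positive multiple of `-ₚ e`, along which the incoming edge lies, nor of `f`.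
    module Branch (w : Point)
      (¬along-e : cross e w ≈ 0# → 0# < dot e w)
      (¬along-f : cross f w ≈ 0# → 0# < - dot f w) where

      -- A `w` parallel to `e` points the same way, so (f, w) is oriented like (f, e).
      sign-fw : ∀ {k} → cross e w ≈ 0# → SignOf κ k → SignOf (cross f w) (ℤ.- k)
      sign-fw col σ = scaled-sign 0<ee (¬along-e col)
        (trans (expand-cross e f w) (trans (+-congʳ (*-≈0 (dot e f) col))
          (solve 2 (λ x y → con 0ℤ :- x :* y := x :* (:- y)) refl (dot e w) κ))) (SignOf-neg σ)

      sign-ew : ∀ {k} → cross f w ≈ 0# → SignOf κ k → SignOf (cross e w) (ℤ.- k)
      sign-ew col σ = scaled-sign 0<ff (¬along-f col)
        (trans (expand-cross f e w) (trans (+-congʳ (*-≈0 (dot f e) col))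
          (trans (solve 2 (λ x y → con 0ℤ :- x :* y := (:- x) :* y) refl (dot f w) (cross f e))
            (*-congˡ (sym (cross-anti e f)))))) (SignOf-neg σ)

      -- If everything were parallel, then `f` and `w` would both point along `e`, whereas `w` must
      -- point against `f`.
      not-straight : cross e w ≈ 0# → cross f w ≈ 0# → κ ≈ 0# → ⊥
      not-straight ew fw κ≈0 = 0<∧0<-⇒⊥ (*-cancel-pos 0<ee (0<-resp-≈
        (trans (solve 2 (λ x c → x := x :+ c :* con 0ℤ) refl (dot e f * dot e w) κ)
          (trans (+-congˡ (*-congˡ (sym ew))) (sym (expand-dot e f w))))
        (*-pos (no-backtracking κ≈0) (¬along-e ew)))) (¬along-f fw)

      module _ (𝔩 : Point) {k m n a b c : ℤ} (κk : SignOf κ k) (ewm : SignOf (cross e w) m) (fwn : SignOf (cross f w) n)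
        (ea : SignOf (cross e 𝔩) a) (fb : SignOf (cross f 𝔩) b) (wc : SignOf (cross w 𝔩) c)
        (a≢0 : a ≢ 0ℤ) (b≢0 : b ≢ 0ℤ) (c≢0 : c ≢ 0ℤ)
        {e′ f′ w′ : Point} (e′≈ : e′ ≈ₚ -ₚ e) (f′≈ : f′ ≈ₚ -ₚ f) (w′≈ : w′ ≈ₚ -ₚ w) where

        private
          identities : exitDefect k m n a b c ≡ leftOf k m n × entryDefect k m n a b c ≡ not (leftOf k m n)
          identities = branch-table (SignOf⇒IsSign κk) (SignOf⇒IsSign ewm) (SignOf⇒IsSign fwn)
            (SignOf⇒IsSign ea) (SignOf⇒IsSign fb) (SignOf⇒IsSign wc) a≢0 b≢0 c≢0
            (straight-signs 𝔩 ea fb a≢0 b≢0 e′≈ f′≈ κk)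
            (λ { ≡.refl → SignOf-unique fwn (sign-fw (null⇒ ewm) κk) })
            (λ { ≡.refl → SignOf-unique ewm (sign-ew (null⇒ fwn) κk) })
            (λ { (≡.refl , ≡.refl , ≡.refl) → not-straight (null⇒ ewm) (null⇒ fwn) (null⇒ κk) })
            (balanced (grassmann e f w 𝔩) (SignOf-* κk wc) (SignOf-neg (SignOf-* ewm fb)) (SignOf-* ea fwn))
            where
            null⇒ : ∀ {x} → SignOf x 0ℤ → x ≈ 0#
            null⇒ (null p) = p
            grassmann : ∀ e f w 𝔩 → cross e f * cross w 𝔩 + - (cross e w * cross f 𝔩) + cross e 𝔩 * cross f w ≈ 0#
            grassmann (ex , ey) (fx , fy) (wx , wy) (lx , ly) = solve 8 (λ ex ey fx fy wx wy lx ly →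
              (ex :* fy :- ey :* fx) :* (wx :* ly :- wy :* lx) :+ (:- ((ex :* wy :- ey :* wx) :* (fx :* ly :- fy :* lx))) :+
              (ex :* ly :- ey :* lx) :* (fx :* wy :- fy :* wx) := con 0ℤ) refl ex ey fx fy wx wy lx ly

          w′c : SignOf (cross w′ 𝔩) (ℤ.- c)
          w′c = SignOf-resp-≈ (sym (trans (cross-cong w′≈ (≈ₚ-refl {𝔩})) (cross-negˡ w 𝔩))) (SignOf-neg wc)

        exit-winds : (descent b xor oddℤ (wind 𝔩 e f)) xor (oddℤ (wind 𝔩 e w) xor oddℤ (wind 𝔩 f′ w)) ≡ leftOf k m n
        exit-winds = ≡.trans (≡.cong₂ (λ x y → (descent b xor oddℤ x) xor y) (wind-ef 𝔩 ea fb a≢0 b≢0 e′≈ f′≈ κk)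
          (≡.cong₂ (λ x y → oddℤ x xor oddℤ y) (wind≡windOf 𝔩 e w ewm ea (SignOf-swap w 𝔩 wc))
            (wind≡windOf 𝔩 f′ w (SignOf-resp-≈ (sym (trans (cross-cong f′≈ (≈ₚ-refl {w})) (cross-negˡ f w))) (SignOf-neg fwn))
              (f′b 𝔩 ea fb a≢0 b≢0 e′≈ f′≈) (SignOf-swap w 𝔩 wc)))) (proj₁ identities)

        entry-winds : (descent a xor oddℤ (wind 𝔩 e f)) xor (oddℤ (wind 𝔩 w′ f) xor oddℤ (wind 𝔩 w′ e′)) ≡ not (leftOf k m n)
        entry-winds = ≡.trans (≡.cong₂ (λ x y → (descent a xor oddℤ x) xor y) (wind-ef 𝔩 ea fb a≢0 b≢0 e′≈ f′≈ κk)
          (≡.cong₂ (λ x y → oddℤ x xor oddℤ y)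
            (wind≡windOf 𝔩 w′ f (SignOf-resp-≈ (trans (cross-flip f w) (cross-cong (≈ₚ-sym w′≈) (≈ₚ-refl {f}))) fwn) w′c (SignOf-swap f 𝔩 fb))
            (wind≡windOf 𝔩 w′ e′ (SignOf-resp-≈ (sym (trans (cross-cong w′≈ e′≈) (cross-neg w e))) (SignOf-swap e w ewm)) w′c (𝔩e′ 𝔩 ea fb a≢0 b≢0 e′≈ f′≈))))
          (proj₂ identities)

-- Sectors at a corner of a simple polygon

module CornerHeights {c ℓ₁ ℓ₂} (F : OrderedField c ℓ₁ ℓ₂) where
  open OrderedFieldProperties F
  open Plabic F
  open CrossingParity F
  open PlaneGeometry F
  open Segments F

  -- Counted from the start of the edge, so that small `τ` means close to the corner on the outgoing
  -- edge too.
  startPoint : (v q : Point) (ω τ δ : Carrier) → Point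
  startPoint v q ω τ δ = v +ₚ τ *ₚ (q -ₚ v) +ₚ δ *ₚ (ω *ₚ rotate90 (q -ₚ v))

  startPoint≈ : ∀ v q ω τ δ → startPoint v q ω τ δ ≈ₚ sidePoint v q ω (1# - τ) δ
  startPoint≈ (vx , vy) (qx , qy) ω τ δ = eq _ _ _ , eq _ _ _
    where
    eq : ∀ v q n → v + τ * (q - v) + δ * (ω * n) ≈ q - (1# - τ) * (q - v) + δ * (ω * n)
    eq v q n = solve 6 (λ v q n ω τ δ → v :+ τ :* (q :- v) :+ δ :* (ω :* n) := q :- (con 1ℤ :- τ) :* (q :- v) :+ δ :* (ω :* n)) refl v q n ω τ δ

  opaque
    unfolding height

    -- For `δ` small against `τ` the first summand decides the sign. It vanishes when `f` is
    -- parallel to the edge, and then the scalar product takes over.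
    height-end : ∀ ω p v f τ δ → height (side ω v f) (sidePoint p v ω τ δ) ≈
                 τ * (ω * cross (v -ₚ p) f) + (ω * ω) * (δ * dot (v -ₚ p) f)
    height-end ω (px , py) (vx , vy) (fx , fy) τ δ =
      solve 9 (λ ω px py vx vy fx fy τ δ → let ex = vx :- px ; ey = vy :- py in
        ω :* (:- fy) :* (vx :- τ :* ex :+ δ :* (ω :* (:- ey)) :- vx) :+
        ω :* fx :* (vy :- τ :* ey :+ δ :* (ω :* ex) :- vy) :=
        τ :* (ω :* (ex :* fy :- ey :* fx)) :+ (ω :* ω) :* (δ :* (ex :* fx :+ ey :* fy)))
        refl ω px py vx vy fx fy τ δ

    height-start : ∀ ω v q e τ δ → height (side ω v e) (startPoint v q ω τ δ) ≈
                   τ * (ω * cross e (q -ₚ v)) + (ω * ω) * (δ * dot e (q -ₚ v))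
    height-start ω (vx , vy) (qx , qy) (ex , ey) τ δ =
      solve 9 (λ ω vx vy qx qy ex ey τ δ → let fx = qx :- vx ; fy = qy :- vy in
        ω :* (:- ey) :* (vx :+ τ :* fx :+ δ :* (ω :* (:- fy)) :- vx) :+
        ω :* ex :* (vy :+ τ :* fy :+ δ :* (ω :* fx) :- vy) :=
        τ :* (ω :* (ex :* fy :- ey :* fx)) :+ (ω :* ω) :* (δ :* (ex :* fx :+ ey :* fy)))
        refl ω vx vy qx qy ex ey τ δ

    height-ray : ∀ ω v d w ε → height (side ω v d) (v +ₚ ε *ₚ w) ≈ ε * (ω * cross d w)
    height-ray ω (vx , vy) (dx , dy) (wx , wy) ε =
      solve 8 (λ ω vx vy dx dy wx wy ε →
        ω :* (:- dy) :* (vx :+ ε :* wx :- vx) :+ ω :* dx :* (vy :+ ε :* wy :- vy) :=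
        ε :* (ω :* (dx :* wy :- dy :* wx))) refl ω vx vy dx dy wx wy ε

    height-base : ∀ ω v d → height (side ω v d) v ≈ 0#
    height-base ω (vx , vy) (dx , dy) =
      solve 5 (λ ω vx vy dx dy → ω :* (:- dy) :* (vx :- vx) :+ ω :* dx :* (vy :- vy) := con 0ℤ) refl ω vx vy dx dy

    height-previous : ∀ ω p v d → height (side ω v d) p ≈ ω * cross (v -ₚ p) d
    height-previous ω (px , py) (vx , vy) (dx , dy) =
      solve 7 (λ ω px py vx vy dx dy → ω :* (:- dy) :* (px :- vx) :+ ω :* dx :* (py :- vy) :=
        ω :* ((vx :- px) :* dy :- (vy :- py) :* dx)) refl ω px py vx vy dx dy

    height-following : ∀ ω v q d → height (side ω v d) q ≈ ω * cross d (q -ₚ v)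
    height-following ω (vx , vy) (qx , qy) (dx , dy) =
      solve 7 (λ ω vx vy qx qy dx dy → ω :* (:- dy) :* (qx :- vx) :+ ω :* dx :* (qy :- vy) :=
        ω :* (dx :* (qy :- vy) :- dy :* (qx :- vx))) refl ω vx vy qx qy dx dy

module Corner {c ℓ₁ ℓ₂} (F : OrderedField c ℓ₁ ℓ₂) {m : ℕ}
  {P : Fin (suc m) → Plabic.Point F} (polygon : IsSimplePolygon F P) (i : Fin (suc m)) where
  open OrderedFieldProperties F
  open Plabic F
  open IsSimplePolygon polygon
  open EventuallyProperties F
  open CrossingParity F
  open PlaneGeometry F
  open Segments F
  open CornerHeights F
  open TurnVectors F
  open SimplePolygon F polygon

  j : Fin (suc m)
  j = next i

  v e f : Point
  v = P j
  e = edgeDir i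
  f = edgeDir j

  κ : Carrier
  κ = cross e f

  0<ee : 0# < dot e e
  0<ee = dot-self-pos (edgeDir≉0 i)

  0<ff : 0# < dot f f
  0<ff = dot-self-pos (edgeDir≉0 j)

  opaque
    -- One wall is fixed for each edge away from the corner. Points close to `v` then all lie ahead
    -- of the same walls, so that any two of them can be joined.
    barrier : ∀ g → ∃[ H ] (i ≢ g → j ≢ g → Separates H (P g) (P (next g)) × 0# < height H v)
    barrier g with i Fin.≟ g | j Fin.≟ g
    -- A default value; the premises exclude the two edges at the corner.
    ... | yes i≡g | _       = (origin , origin) , λ i≢g → contradiction i≡g i≢g
    ... | no _    | yes j≡g = (origin , origin) , λ _ j≢g → contradiction j≡g j≢g
    ... | no i≢g  | no j≢g  = from (separate (nondegenerate g) (vertex-off (λ g≡i → i≢g (≡.sym g≡i)) (λ g≡j → j≢g (≡.sym g≡j))))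
      where
      from : ∃[ H ] (Separates H (P g) (P (next g)) × 0# < height H v) →
             ∃[ H ] (i ≢ g → j ≢ g → Separates H (P g) (P (next g)) × 0# < height H v)
      from (H , sep , h) = H , λ _ _ → sep , h

  wall : Fin (suc m) → HalfPlane
  wall g = proj₁ (barrier g)

  Close : Point → Set ℓ₂
  Close x = ∀ g → i ≢ g → j ≢ g → 0# < height (wall g) x

  eventually²-close : ∀ (x : Carrier → Carrier → Point) →
    (∀ g → 0# < height (wall g) v → Eventually² λ τ δ → 0# < height (wall g) (x τ δ)) → Eventually² λ τ δ → Close (x τ δ)
  eventually²-close x f = eventually-map (λ τ _ h → eventually-≢ λ g i≢g → h g i≢g)
    (eventually-≢ λ g i≢g → one g i≢g)
    where
    one : ∀ g → i ≢ g → Eventually λ τ → Eventually λ δ → j ≢ g → 0# < height (wall g) (x τ δ)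
    one g i≢g with j Fin.≟ g
    ... | yes j≡g = always λ _ _ → always λ _ _ j≢g → contradiction j≡g j≢g
    ... | no j≢g  = eventually²-map (λ _ _ _ _ h _ → h) (f g (proj₂ (proj₂ (barrier g) i≢g j≢g)))

  close-end : ∀ ω → Eventually² λ τ δ → Close (sidePt i ω τ δ)
  close-end ω = eventually²-close (sidePt i ω) λ g → above-sidePoint (wall g) {P i} {v} ω

  startPt : (ω τ δ : Carrier) → Point
  startPt = startPoint v (P (next j))

  close-start : ∀ ω → Eventually² λ τ δ → Close (startPt ω τ δ)
  close-start ω = eventually²-close (startPt ω) λ g h →
    eventually-map (λ τ _ → eventually-above (wall g) {v +ₚ τ *ₚ f} (ω *ₚ rotate90 f)) (eventually-above (wall g) {v} f h)

  ray : Point → Carrier → Point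
  ray w ε = v +ₚ ε *ₚ w

  close-ray : ∀ w → Eventually λ ε → Close (ray w ε)
  -- A constant second parameter brings the ray into the form of a side point.
  close-ray w = eventually-map (λ ε _ h → proj₂ (proj₂ (eventually-∃ h)))
    (eventually²-close (λ ε _ → ray w ε) λ g h → eventually-map (λ ε _ h′ → always λ _ _ → h′) (eventually-above (wall g) {v} w h))

  -- The walls keep the segment off all other edges, so only the two edges at the corner have to be
  -- checked.
  join : ∀ x y → Close x → Close y → ¬ Meet (P i) v x y → ¬ Meet v (P (next j)) x y → parity x ≡ parity y
  join x y cx cy ¬i ¬j = parity-constant x y disjoint
    where
    disjoint : ∀ g → ¬ Meet (P g) (P (next g)) x y
    disjoint g with i Fin.≟ g | j Fin.≟ g
    ... | yes ≡.refl | _          = ¬i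
    ... | no _       | yes ≡.refl = ¬j
    ... | no i≢g     | no j≢g     =
      separated⇒disjoint (wall g) (proj₁ (proj₂ (barrier g) i≢g j≢g)) (cx g i≢g j≢g) (cy g i≢g j≢g)

  InSector : Carrier → Point → Set ℓ₂
  InSector ω x = 0# < height (side ω v e) x × 0# < height (side ω v f) x

  base-i : ∀ ω → Separates (side ω v e) (P i) v
  base-i ω = separates (≈0⇒0≤- (trans (height-previous ω (P i) v e) (*-≈0 ω (cross-self e)))) (≈0⇒0≤- (height-base ω v e))

  base-j : ∀ ω → Separates (side ω v f) v (P (next j))
  base-j ω = separates (≈0⇒0≤- (height-base ω v f)) (≈0⇒0≤- (trans (height-following ω v (P (next j)) f) (*-≈0 ω (cross-self f))))

  within-sector : ∀ {ω} x y → Close x → Close y → InSector ω x → InSector ω y → parity x ≡ parity y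
  within-sector {ω} x y cx cy (xe , xf) (ye , yf) = join x y cx cy
    (separated⇒disjoint (side ω v e) (base-i ω) xe ye) (separated⇒disjoint (side ω v f) (base-j ω) xf yf)

  -- The path turns towards the side `ω` or goes straight on. The sector between the edges on that
  -- side is then the intersection of half planes in `InSector`.
  Convex : Carrier → Set (ℓ₁ ⊔ ℓ₂)
  Convex ω = 0# < ω * κ ⊎ κ ≈ 0# × 0# < dot e f

  unit-scale : ∀ {ω x} → Unit ω → x ≈ ω * ω * x
  unit-scale ωω = trans (sym (*-identityˡ _)) (*-congʳ (sym ωω))

  eventually-mixed : ∀ {ω} → Unit ω → Convex ω → ∀ τ → 0# < τ →
    Eventually λ δ → 0# < τ * (ω * κ) + (ω * ω) * (δ * dot e f)
  eventually-mixed {ω} ωω (inj₁ 0<ωκ) τ 0<τ = eventually-map (λ δ _ → 0<-resp-≈ (+-congˡ (unit-scale ωω)))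
    (eventually-pos (dot e f) (*-pos 0<τ 0<ωκ))
  eventually-mixed {ω} ωω (inj₂ (κ≈0 , 0<ef)) τ 0<τ = always λ δ 0<δ → 0<-resp-≈
    (trans (unit-scale ωω) (trans (sym (+-identityˡ _)) (+-congʳ (sym (*-≈0 τ (*-≈0 ω κ≈0)))))) (*-pos 0<δ 0<ef)

  self-pos : ∀ {ω τ δ d} → Unit ω → 0# < dot d d → 0# < δ → 0# < τ * (ω * cross d d) + (ω * ω) * (δ * dot d d)
  self-pos {ω} {τ} {d = d} ωω dd 0<δ = 0<-resp-≈
    (trans (unit-scale ωω) (trans (sym (+-identityˡ _)) (+-congʳ (sym (*-≈0 τ (*-≈0 ω (cross-self d))))))) (*-pos 0<δ dd)

  end-ahead : ∀ {ω} → Unit ω → ∀ τ δ → 0# < δ → 0# < height (side ω v e) (sidePt i ω τ δ)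
  end-ahead {ω} ωω τ δ 0<δ = 0<-resp-≈ (sym (height-end ω (P i) v e τ δ)) (self-pos ωω 0<ee 0<δ)

  start-ahead : ∀ {ω} → Unit ω → ∀ τ δ → 0# < δ → 0# < height (side ω v f) (startPt ω τ δ)
  start-ahead {ω} ωω τ δ 0<δ = 0<-resp-≈ (sym (height-start ω v (P (next j)) f τ δ)) (self-pos ωω 0<ff 0<δ)

  sector-end : ∀ {ω} → Unit ω → Convex ω → Eventually² λ τ δ → InSector ω (sidePt i ω τ δ)
  sector-end {ω} ωω convex = always λ τ 0<τ → eventually-map
    (λ δ 0<δ h → end-ahead ωω τ δ 0<δ , 0<-resp-≈ (sym (height-end ω (P i) v f τ δ)) h)
    (eventually-mixed ωω convex τ 0<τ)

  sector-start : ∀ {ω} → Unit ω → Convex ω → Eventually² λ τ δ → InSector ω (startPt ω τ δ)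
  sector-start {ω} ωω convex = always λ τ 0<τ → eventually-map
    (λ δ 0<δ h → 0<-resp-≈ (sym (height-start ω v (P (next j)) e τ δ)) h , start-ahead ωω τ δ 0<δ)
    (eventually-mixed ωω convex τ 0<τ)

  ray-ahead : ∀ ω d w {ε} → 0# < ω * cross d w → 0# < ε → 0# < height (side ω v d) (ray w ε)
  ray-ahead ω d w {ε} h 0<ε = 0<-resp-≈ (sym (height-ray ω v d w ε)) (*-pos 0<ε h)

  parity-end : ∀ {ω b} → SideParity ω i b → Eventually² λ τ δ → parity (sidePt i ω τ δ) ≡ b
  parity-end h = eventually-map (λ τ _ → h τ) eventually-proper

  parity-start : ∀ {ω b} → SideParity ω j b → Eventually² λ τ δ → parity (startPt ω τ δ) ≡ b
  parity-start {ω} h = eventually-map (λ τ _ τ∈ → eventually-map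
    (λ δ _ p → ≡.trans (parity-cong (startPoint≈ v (P (next j)) ω τ δ)) p) (h (1# - τ) (1-proper τ∈))) eventually-proper

  -- Near the corner, side points of both edges enter the convex sector, where neither edge
  -- separates them.
  turn : ∀ {ω b b′} → Unit ω → Convex ω → SideParity ω i b → SideParity ω j b′ → b ≡ b′
  turn {ω} ωω convex pi pj = case eventually²-∃
    (eventually²-× (eventually²-× (parity-end pi) (parity-start pj))
      (eventually²-× (eventually²-× (close-end ω) (close-start ω)) (eventually²-× (sector-end ωω convex) (sector-start ωω convex))))
    of λ (τ , δ , (pe , ps) , (ce , cs) , (se , ss)) → ≡.trans (≡.sym pe) (≡.trans (within-sector {ω} _ _ ce cs se ss) ps)

  ray-in-sector : ∀ {ω b} w → Unit ω → Convex ω → SideParity ω i b →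
    0# < ω * cross e w → 0# < ω * cross f w → Eventually λ ε → parity (ray w ε) ≡ b
  ray-in-sector {ω} w ωω convex pi ew fw = case eventually²-∃
    (eventually²-× (parity-end pi) (eventually²-× (close-end ω) (sector-end ωω convex)))
    of λ (τ , δ , pe , ce , se) → eventually-map
      (λ ε 0<ε cr → ≡.trans (within-sector {ω} (ray w ε) (sidePt i ω τ δ) cr ce (ray-ahead ω e w ew 0<ε , ray-ahead ω f w fw 0<ε) se) pe)
      (close-ray w)

  -- When the path does not turn towards the side `ω`, edge `j` does not reach beyond the line of
  -- edge `i` on that side. Near `v` the open half plane ahead of this line is therefore free of
  -- both edges.
  ray-beside-end : ∀ {ω b} w → Unit ω → 0# ≤ - (ω * κ) → SideParity ω i b →
    0# < ω * cross e w → Eventually λ ε → parity (ray w ε) ≡ b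
  ray-beside-end {ω} w ωω reflex pi ew = case eventually²-∃
    (eventually²-× (parity-end pi) (eventually²-× (close-end ω) (always λ τ _ → always λ δ 0<δ → end-ahead ωω τ δ 0<δ)))
    of λ (τ , δ , pe , ce , he) → eventually-map
      (λ ε 0<ε cr → let hr = ray-ahead ω e w ew 0<ε in
        ≡.trans (join (ray w ε) (sidePt i ω τ δ) cr ce (separated⇒disjoint H (base-i ω) hr he) (separated⇒disjoint H base hr he)) pe)
      (close-ray w)
    where
    H : HalfPlane
    H = side ω v e
    base : Separates H v (P (next j))
    base = separates (≈0⇒0≤- (height-base ω v e)) (≤-respʳ-≈ (-‿cong (sym (height-following ω v (P (next j)) e))) reflex)

  -- The mirror case: edge `i` stays behind the line of edge `j`.
  ray-beside-start : ∀ {ω b} w → Unit ω → 0# ≤ - (ω * κ) → SideParity ω j b →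
    0# < ω * cross f w → Eventually λ ε → parity (ray w ε) ≡ b
  ray-beside-start {ω} w ωω reflex pj fw = case eventually²-∃
    (eventually²-× (parity-start pj) (eventually²-× (close-start ω) (always λ τ _ → always λ δ 0<δ → start-ahead ωω τ δ 0<δ)))
    of λ (τ , δ , ps , cs , hs) → eventually-map
      (λ ε 0<ε cr → let hr = ray-ahead ω f w fw 0<ε in
        ≡.trans (join (ray w ε) (startPt ω τ δ) cr cs (separated⇒disjoint H base hr hs) (separated⇒disjoint H (base-j ω) hr hs)) ps)
      (close-ray w)
    where
    H : HalfPlane
    H = side ω v f
    base : Separates H (P i) v
    base = separates (≤-respʳ-≈ (-‿cong (sym (height-previous ω (P i) v f))) reflex) (≈0⇒0≤- (height-base ω v f))

  -- Edges leaving the corner in the same direction would share a point in the interior of both.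
  no-backtracking : κ ≈ 0# → 0# < dot e f
  no-backtracking κ≈0 with signOf (dot e f)
  ... | _ , positive p = p
  ... | _ , null p     = contradiction p (dot≉0 (edgeDir≉0 i) (edgeDir≉0 j) κ≈0)
  ... | _ , negative p = ⊥-elim (impossible (rays-overlap v (λ v≈ → nondegenerate i (≈ₚ-sym v≈)) col opp))
    where
    col : cross (P i -ₚ v) f ≈ 0#
    col = trans (cross-cong (-ₚ-flip (P i) v) (≈ₚ-refl {f})) (trans (cross-negˡ e f) (-0≈0 κ≈0))
    opp : 0# < dot (P i -ₚ v) f
    opp = 0<-resp-≈ (sym (trans (dot-cong (-ₚ-flip (P i) v) (≈ₚ-refl {f})) (dot-negˡ e f))) p
    impossible : ∃[ t ] ∃[ u ] (Proper t × Proper u × along v (P i) t ≈ₚ along v (P (next j)) u) → ⊥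
    impossible (t , u , t∈ , u∈ , eq) =
      [ (λ (_ , z≈) → along≉end {v} {P i} (λ v≈ → nondegenerate i (≈ₚ-sym v≈)) (proj₂ t∈) z≈)
      , (λ (_ , z≈) → along≉start {v} {P i} (λ v≈ → nondegenerate i (≈ₚ-sym v≈)) (proj₁ t∈) z≈) ]′
      (simple (next≢ i) (∈-swap {v} {P i} (proper⇒∈ t∈)) (∈-resp-≈ {v} {P (next j)} (≈ₚ-sym eq) (proper⇒∈ u∈)))

  1*-pos : ∀ {x} → 0# < x → 0# < 1# * x
  1*-pos = 0<-resp-≈ (sym (*-identityˡ _))

  -1*-pos : ∀ {x} → 0# < - x → 0# < - 1# * x
  -1*-pos = 0<-resp-≈ (solve 1 (λ x → :- x := (:- con 1ℤ) :* x) refl _)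

  -- At least one side of the corner is convex and carries its parity over. The other side follows,
  -- since the two sides of an edge have opposite parities.
  sides-turn : ∀ {b} → SideParity 1# i b → SideParity (- 1#) i (not b) →
               SideParity 1# j b × SideParity (- 1#) j (not b)
  sides-turn {b} l r = from (sideParities j) (signOf κ)
    where
    from : ∃[ b′ ] (SideParity 1# j b′ × SideParity (- 1#) j (not b′)) → ∃[ k ] SignOf κ k →
           SideParity 1# j b × SideParity (- 1#) j (not b)
    from (b′ , l′ , r′) (_ , k) = carry (agree k)
      where
      carry : b ≡ b′ → SideParity 1# j b × SideParity (- 1#) j (not b)
      carry ≡.refl = l′ , r′
      agree : ∀ {k} → SignOf κ k → b ≡ b′
      agree (positive p) = turn {1#} {b} {b′} unit-1 (inj₁ (1*-pos p)) l l′
      agree (null p)     = turn {1#} {b} {b′} unit-1 (inj₂ (p , no-backtracking p)) l l′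
      agree (negative p) = Bool.not-injective (turn { - 1#} {not b} {not b′} unit--1 (inj₁ (-1*-pos p)) r r′)

  module _ (w : Point)
    (¬along-e : cross e w ≈ 0# → 0# < dot e w)
    (¬along-f : cross f w ≈ 0# → 0# < - dot f w) where

    open TurnSigns e f (edgeDir≉0 i) (edgeDir≉0 j) no-backtracking
    open Branch w ¬along-e ¬along-f

    -- The convex sector, together with one half plane for each edge on the reflex side, covers all
    -- directions that overlap neither edge. The remaining sign patterns contradict `sign-fw`,
    -- `sign-ew` or `not-straight`.
    ray-parity : ∀ {b k m n} → SideParity 1# i b → SideParity (- 1#) i (not b) →
      SignOf κ k → SignOf (cross e w) m → SignOf (cross f w) n →
      Eventually λ ε → parity (ray w ε) ≡ (if leftOf k m n then b else not b)
    ray-parity {b} l r = cases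
      where
      lj : SideParity 1# j b
      lj = proj₁ (sides-turn l r)
      rj : SideParity (- 1#) j (not b)
      rj = proj₂ (sides-turn l r)
      L R : Set _
      L = Eventually λ ε → parity (ray w ε) ≡ b
      R = Eventually λ ε → parity (ray w ε) ≡ not b
      convex⁺ : 0# < κ ⊎ κ ≈ 0# → Convex 1#
      convex⁺ = [ (λ p → inj₁ (1*-pos p)) , (λ p → inj₂ (p , no-backtracking p)) ]′
      reflex⁺ : 0# < κ ⊎ κ ≈ 0# → 0# ≤ - (- 1# * κ)
      reflex⁺ p = ≤-respʳ-≈ (solve 1 (λ x → x := :- ((:- con 1ℤ) :* x)) refl κ) ([ inj₁ , (λ z → inj₂ (sym z)) ]′ p)
      convex⁻ : 0# < - κ → Convex (- 1#)
      convex⁻ p = inj₁ (-1*-pos p)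
      reflex⁻ : 0# < - κ → 0# ≤ - (1# * κ)
      reflex⁻ p = inj₁ (0<-resp-≈ (-‿cong (sym (*-identityˡ κ))) p)
      inside⁺ : 0# < κ ⊎ κ ≈ 0# → 0# < cross e w → 0# < cross f w → L
      inside⁺ k m n = ray-in-sector w unit-1 (convex⁺ k) l (1*-pos m) (1*-pos n)
      besideEnd⁺ : 0# < κ ⊎ κ ≈ 0# → 0# < - cross e w → R
      besideEnd⁺ k m = ray-beside-end w unit--1 (reflex⁺ k) r (-1*-pos m)
      besideStart⁺ : 0# < κ ⊎ κ ≈ 0# → 0# < - cross f w → R
      besideStart⁺ k n = ray-beside-start w unit--1 (reflex⁺ k) rj (-1*-pos n)
      inside⁻ : 0# < - κ → 0# < - cross e w → 0# < - cross f w → R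
      inside⁻ k m n = ray-in-sector w unit--1 (convex⁻ k) r (-1*-pos m) (-1*-pos n)
      besideEnd⁻ : 0# < - κ → 0# < cross e w → L
      besideEnd⁻ k m = ray-beside-end w unit-1 (reflex⁻ k) l (1*-pos m)
      besideStart⁻ : 0# < - κ → 0# < cross f w → L
      besideStart⁻ k n = ray-beside-start w unit-1 (reflex⁻ k) lj (1*-pos n)
      clash : ∀ {a i j} {A : Set a} → SignOf (cross f w) i → SignOf (cross f w) j → i ≢ j → A
      clash p q i≢j = contradiction (SignOf-unique p q) i≢j
      clash′ : ∀ {a i j} {A : Set a} → SignOf (cross e w) i → SignOf (cross e w) j → i ≢ j → A
      clash′ p q i≢j = contradiction (SignOf-unique p q) i≢j
      cases : ∀ {k m n} → SignOf κ k → SignOf (cross e w) m → SignOf (cross f w) n →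
              Eventually λ ε → parity (ray w ε) ≡ (if leftOf k m n then b else not b)
      cases (positive k) (positive m) (positive n) = inside⁺ (inj₁ k) m n
      cases (positive k) (positive m) (negative n) = besideStart⁺ (inj₁ k) n
      cases (positive k) (negative m) _            = besideEnd⁺ (inj₁ k) m
      cases (positive k) (null m) (negative n)     = besideStart⁺ (inj₁ k) n
      cases (positive k) (null m) (positive n)     = clash (sign-fw m (positive k)) (positive n) λ ()
      cases (positive k) (null m) (null n)         = clash (sign-fw m (positive k)) (null n) λ ()
      cases (positive k) (positive m) (null n)     = clash′ (sign-ew n (positive k)) (positive m) λ ()
      cases (null k) (positive m) (positive n)     = inside⁺ (inj₂ k) m n
      cases (null k) (positive m) (negative n)     = besideStart⁺ (inj₂ k) n
      cases (null k) (negative m) _                = besideEnd⁺ (inj₂ k) m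
      cases (null k) (null m) (negative n)         = besideStart⁺ (inj₂ k) n
      cases (null k) (null m) (positive n)         = clash (sign-fw m (null k)) (positive n) λ ()
      cases (null k) (null m) (null n)             = ⊥-elim (not-straight m n k)
      cases (null k) (positive m) (null n)         = clash′ (sign-ew n (null k)) (positive m) λ ()
      cases (negative k) (positive m) _            = besideEnd⁻ k m
      cases (negative k) (null m) (positive n)     = besideStart⁻ k n
      cases (negative k) (negative m) (positive n) = besideStart⁻ k n
      cases (negative k) (negative m) (negative n) = inside⁻ k m n
      cases (negative k) (null m) (null n)         = clash (sign-fw m (negative k)) (null n) λ ()
      cases (negative k) (null m) (negative n)     = clash (sign-fw m (negative k)) (negative n) λ ()
      cases (negative k) (negative m) (null n)     = clash′ (sign-ew n (negative k)) (negative m) λ ()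

-- Transport of the linear relations under a reversal

module Signs {c ℓ₁ ℓ₂} (F : OrderedField c ℓ₁ ℓ₂) where
  open OrderedFieldProperties F
  open Plabic F

  sg : Bool → Carrier
  sg true  = - 1#
  sg false = 1#

  sg-xor : ∀ a b → sg (a xor b) ≈ sg a * sg b
  sg-xor true  true  = solve 0 (con 1ℤ := (:- con 1ℤ) :* (:- con 1ℤ)) refl
  sg-xor true  false = sym (*-identityʳ _)
  sg-xor false b     = sym (*-identityˡ _)

  sg-not : ∀ a → sg (not a) ≈ - sg a
  sg-not true  = solve 0 (con 1ℤ := :- (:- con 1ℤ)) refl
  sg-not false = refl

  sg-square : ∀ a → sg a * sg a ≈ 1#
  sg-square a = trans (sym (sg-xor a a)) (reflexive (≡.cong sg (Bool.xor-same a)))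

  sg-odd : ∀ n → (- 1#) ^ n ≈ sg (odd n)
  sg-odd zero    = refl
  sg-odd (suc n) = trans (*-congˡ (sg-odd n))
    (trans (solve 1 (λ x → (:- con 1ℤ) :* x := :- x) refl _) (sym (sg-not (odd n))))

  sg-≡ : ∀ {a b} → a ≡ b → sg a ≈ sg b
  sg-≡ e = reflexive (≡.cong sg e)

module Reversals {c ℓ₁ ℓ₂} (F : OrderedField c ℓ₁ ℓ₂) {n : ℕ} (𝔩 : Plabic.Point F) where
  open OrderedFieldProperties F
  open Plabic F
  open Signs F

  module _ (N : Network n) where
    open Network N

    edgeSign : Edge → Edge → Bool
    edgeSign e f = oddℤ (+ int N 𝔩 e ℤ.+ windₑ N 𝔩 e f)

    coefficient≈ : ∀ e f → coefficient N 𝔩 e f ≈ sg (edgeSign e f) * weight e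
    coefficient≈ e f = *-congʳ (sg-odd ℤ.∣ + int N 𝔩 e ℤ.+ windₑ N 𝔩 e f ∣)

  module _ (N : Network n) (src₂ tgt₂ : Network.Edge N → Network.Vertex N) (weight₂ : Network.Edge N → Carrier) where
    open Network N

    redirect : Network n
    redirect = record N { src = src₂ ; tgt = tgt₂ ; weight = weight₂ }

    -- The local data through which the relations of N and of its redirection
    -- along the edges in Q determine each other.  The condition is symmetric.
    record Reversal (Q : Edge → Bool) (γ : Edge → Bool) : Set (c ⊔ ℓ₁) where
      σ₁ : Edge → Edge → Bool
      σ₁ = edgeSign N

      σ₂ : Edge → Edge → Bool
      σ₂ = edgeSign redirect

      Incident : Edge → Vertex → Set
      Incident e v = src e ≡ v ⊎ tgt e ≡ v

      Linear : Fin #internal → Set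
      Linear v = degree (inj₂ v) ≡ 2 ⊎ colour v ≡ black

      Forking : Fin #internal → Set
      Forking v = degree (inj₂ v) ≡ 3 × colour v ≡ white

      field
        src-on     : ∀ {e} → Q e ≡ true → src₂ e ≡ tgt e
        tgt-on     : ∀ {e} → Q e ≡ true → tgt₂ e ≡ src e
        src-off    : ∀ {e} → Q e ≡ false → src₂ e ≡ src e
        tgt-off    : ∀ {e} → Q e ≡ false → tgt₂ e ≡ tgt e
        weight-on  : ∀ {e} → Q e ≡ true → weight e * weight₂ e ≈ 1#
        weight-off : ∀ {e} → Q e ≡ false → weight₂ e ≈ weight e
        int-eq     : ∀ e → int redirect 𝔩 e ≡ int N 𝔩 e
        degree-eq  : ∀ v → Network.degree redirect (inj₂ v) ≡ degree (inj₂ v)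
        ∂-avoids   : ∀ {e j} → Q e ≡ true → ¬ Incident e (inj₁ j)
        sink-γ     : ∀ {e j} → tgt e ≡ inj₁ j → γ e ≡ false
        out-of     : ∀ {e v} → Q e ≡ true → tgt e ≡ inj₂ v → ∃[ q ] (Q q ≡ true × src q ≡ inj₂ v)
        into       : ∀ {e v} → Q e ≡ true → src e ≡ inj₂ v → ∃[ p ] (Q p ≡ true × tgt p ≡ inj₂ v)
        in-unique  : ∀ {e e′ v} → Q e ≡ true → Q e′ ≡ true → tgt e ≡ inj₂ v → tgt e′ ≡ inj₂ v → e ≡ e′
        out-unique : ∀ {e e′ v} → Q e ≡ true → Q e′ ≡ true → src e ≡ inj₂ v → src e′ ≡ inj₂ v → e ≡ e′
        no-exit    : ∀ {e f v} → Linear v → Q e ≡ true → Q f ≡ false → src f ≡ inj₂ v → ¬ Incident e (inj₂ v)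
        no-entry   : ∀ {e f v} → Forking v → Q e ≡ true → Q f ≡ false → tgt f ≡ inj₂ v → ¬ Incident e (inj₂ v)
        one-exit   : ∀ {e f g v} → Forking v → Q e ≡ true → Q f ≡ false → Q g ≡ false → f ≢ g →
                     src f ≡ inj₂ v → src g ≡ inj₂ v → ¬ Incident e (inj₂ v)
        sign-off   : ∀ {e f} → Q e ≡ false → Q f ≡ false → σ₂ e f ≡ σ₁ e f
        γ-off      : ∀ {e f v} → Q e ≡ false → Q f ≡ false → tgt e ≡ inj₂ v → src f ≡ inj₂ v → γ e ≡ γ f
        -- The sign of `E q` after the relation of `p` has been substituted into the reversed one.
        γ-along    : ∀ {p q v} → Q p ≡ true → Q q ≡ true → tgt p ≡ inj₂ v → src q ≡ inj₂ v →
                     γ q ≡ σ₂ q p xor (γ p xor σ₁ p q)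
        γ-entry    : ∀ {e p q v} → Linear v → Q e ≡ false → Q p ≡ true → Q q ≡ true →
                     tgt e ≡ inj₂ v → tgt p ≡ inj₂ v → src q ≡ inj₂ v →
                     γ e ≡ (σ₂ e p xor γ p) xor (σ₁ p q xor σ₁ e q)
        -- The relation at a fork produces two terms in `E f`; opposite signs make them cancel.
        γ-exit     : ∀ {f p q v} → Forking v → Q f ≡ false → Q p ≡ true → Q q ≡ true →
                     src f ≡ inj₂ v → tgt p ≡ inj₂ v → src q ≡ inj₂ v →
                     σ₂ q p xor (γ p xor σ₁ p f) ≡ not (σ₂ q f xor γ f)

      on-tgt₂ : ∀ {e v} → Q e ≡ true → tgt₂ e ≡ v → src e ≡ v
      on-tgt₂ q = ≡.trans (≡.sym (tgt-on q))

      on-src₂ : ∀ {e v} → Q e ≡ true → src₂ e ≡ v → tgt e ≡ v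
      on-src₂ q = ≡.trans (≡.sym (src-on q))

      off-tgt₂ : ∀ {e v} → Q e ≡ false → tgt₂ e ≡ v → tgt e ≡ v
      off-tgt₂ q = ≡.trans (≡.sym (tgt-off q))

      off-src₂ : ∀ {e v} → Q e ≡ false → src₂ e ≡ v → src e ≡ v
      off-src₂ q = ≡.trans (≡.sym (src-off q))

      linear₂ : ∀ {v} → Network.degree redirect (inj₂ v) ≡ 2 ⊎ colour v ≡ black → Linear v
      linear₂ = map₁ (≡.trans (≡.sym (degree-eq _)))

    rescale : ∀ {d} → (Edge → Bool) → (Edge → Bool) → (Edge → Vector Carrier d) → Edge → Vector Carrier d
    rescale Q γ E e i = if Q e then (sg (γ e) * weight₂ e) * E e i else sg (γ e) * E e i

  -- Uniqueness requires the inverse rescaling to be a reversal as well. Its sign identities are the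
  -- original ones with `p` and `q` exchanged, after moving terms across by `γ-along`.
  reverse-symmetric : ∀ {N : Network n} {src₂ tgt₂ weight₂ Q γ} → Reversal N src₂ tgt₂ weight₂ Q γ →
    Reversal (redirect N src₂ tgt₂ weight₂) (Network.src N) (Network.tgt N) (Network.weight N) Q γ
  reverse-symmetric {N} {src₂} {tgt₂} {weight₂} {Q} {γ} R = record
    { src-on     = λ q → ≡.sym (tgt-on q)
    ; tgt-on     = λ q → ≡.sym (src-on q)
    ; src-off    = λ q → ≡.sym (src-off q)
    ; tgt-off    = λ q → ≡.sym (tgt-off q)
    ; weight-on  = λ q → trans (*-comm _ _) (weight-on q)
    ; weight-off = λ q → sym (weight-off q)
    ; int-eq     = λ e → ≡.sym (int-eq e)
    ; degree-eq  = λ v → ≡.sym (degree-eq v)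
    ; ∂-avoids   = λ q inc → ∂-avoids q (incident q inc)
    ; sink-γ     = sink
    ; out-of     = λ q t → let p , qp , tp = into q (on-tgt₂ q t) in p , qp , ≡.trans (src-on qp) tp
    ; into       = λ q t → let p , qp , tp = out-of q (on-src₂ q t) in p , qp , ≡.trans (tgt-on qp) tp
    ; in-unique  = λ q q′ t t′ → out-unique q q′ (on-tgt₂ q t) (on-tgt₂ q′ t′)
    ; out-unique = λ q q′ t t′ → in-unique q q′ (on-src₂ q t) (on-src₂ q′ t′)
    ; no-exit    = λ l q q′ t inc → no-exit (linear₂ l) q q′ (off-src₂ q′ t) (incident q inc)
    ; no-entry   = λ l q q′ t inc → no-entry (forking l) q q′ (off-tgt₂ q′ t) (incident q inc)
    ; one-exit   = λ l q q′ q″ f≢g t t′ inc → one-exit (forking l) q q′ q″ f≢g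
                     (off-src₂ q′ t) (off-src₂ q″ t′) (incident q inc)
    ; sign-off   = λ q q′ → ≡.sym (sign-off q q′)
    ; γ-off      = λ q q′ t t′ → γ-off q q′ (off-tgt₂ q t) (off-src₂ q′ t′)
    ; γ-along    = λ {p} {q} qp qq t t′ → along-eq (σ₂ p q) (γ q) (σ₁ q p) (γ p)
                     (γ-along qq qp (on-src₂ qq t′) (on-tgt₂ qp t))
    ; γ-entry    = λ {e} {p} {q} l qe qp qq te tp tq → entry-eq (γ e) (σ₂ e q) (σ₁ e p) (σ₁ q p) (σ₂ p q) (γ p) (γ q)
                     (γ-along qq qp (on-src₂ qq tq) (on-tgt₂ qp tp))
                     (γ-entry (linear₂ l) qe qq qp (off-tgt₂ qe te)
                       (on-src₂ qq tq) (on-tgt₂ qp tp))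
    ; γ-exit     = λ {f} {p} {q} l qf qp qq tf tp tq → exit-eq (σ₂ p q) (σ₁ q p) (σ₂ p f) (σ₁ q f) (γ p) (γ q) (γ f)
                     (γ-along qq qp (on-src₂ qq tq) (on-tgt₂ qp tp))
                     (γ-exit (forking l) qf qq qp (off-src₂ qf tf)
                       (on-src₂ qq tq) (on-tgt₂ qp tp))
    }
    where
    open Network N
    open Reversal R
    N₂ = redirect N src₂ tgt₂ weight₂

    incident : ∀ {e v} → Q e ≡ true → src₂ e ≡ v ⊎ tgt₂ e ≡ v → Incident e v
    incident q (inj₁ s) = inj₂ (on-src₂ q s)
    incident q (inj₂ t) = inj₁ (on-tgt₂ q t)

    forking : ∀ {v} → Network.degree N₂ (inj₂ v) ≡ 3 × colour v ≡ white → Forking v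
    forking (d , w) = ≡.trans (≡.sym (degree-eq _)) d , w

    sink : ∀ {e j} → tgt₂ e ≡ inj₁ j → γ e ≡ false
    sink {e} t with Q e in q
    ... | true  = contradiction (inj₁ (on-tgt₂ q t)) (∂-avoids q)
    ... | false = sink-γ (off-tgt₂ q t)

    along-eq : ∀ a b c d → d ≡ a xor (b xor c) → b ≡ c xor (d xor a)
    along-eq a b c _ ≡.refl = xor-solve 3 (λ a b c → b ⊜ c ⊕ ((a ⊕ (b ⊕ c)) ⊕ a)) ≡.refl a b c

    entry-eq : ∀ g a b c d γp γq → γp ≡ d xor (γq xor c) → g ≡ (a xor γq) xor (c xor b) → g ≡ (b xor γp) xor (d xor a)
    entry-eq _ a b c d _ γq ≡.refl ≡.refl =
      xor-solve 5 (λ a b c d q → (a ⊕ q) ⊕ (c ⊕ b) ⊜ (b ⊕ (d ⊕ (q ⊕ c))) ⊕ (d ⊕ a)) ≡.refl a b c d γq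

    exit-eq : ∀ s t u v γp γq γf → γp ≡ s xor (γq xor t) → s xor (γq xor v) ≡ not (u xor γf) →
              t xor (γp xor u) ≡ not (v xor γf)
    exit-eq s t u v _ γq γf ≡.refl h = ≡.trans
      (xor-solve 5 (λ s t u v q → t ⊕ ((s ⊕ (q ⊕ t)) ⊕ u) ⊜ (s ⊕ (q ⊕ v)) ⊕ (u ⊕ v)) ≡.refl s t u v γq)
      (≡.trans (≡.cong (_xor (u xor v)) h) (flip u v γf))
      where
      flip : ∀ u v f → not (u xor f) xor (u xor v) ≡ not (v xor f)
      flip = xor-solve 3 (λ u v f → (bit-con true ⊕ (u ⊕ f)) ⊕ (u ⊕ v) ⊜ bit-con true ⊕ (v ⊕ f)) ≡.refl

  -- At each vertex of the cycle the edges `p` and `q` exchange roles, so the old relation becomes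
  -- the new one when solved for the other edge. The reciprocal weight performs the division.
  reverse-solves : ∀ {d} (N : Network n) {src₂ tgt₂ weight₂ Q γ} →
    Reversal N src₂ tgt₂ weight₂ Q γ → (B : Fin n → Vector Carrier d) (E : Network.Edge N → Vector Carrier d) →
    Solves N 𝔩 B E → Solves (redirect N src₂ tgt₂ weight₂) 𝔩 B (rescale N src₂ tgt₂ weight₂ Q γ E)
  reverse-solves {d} N {src₂} {tgt₂} {weight₂} {Q} {γ} R B E S = record
    { sink = sink′ ; bivalentBlack = linear′ ; trivalentWhite = forking′ }
    where
    open Network N
    open Reversal R
    open Solves S
    N₂ : Network n
    N₂ = redirect N src₂ tgt₂ weight₂
    Ê : Edge → Vector Carrier d
    Ê = rescale N src₂ tgt₂ weight₂ Q γ E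

    Ê-on : ∀ {e} i → Q e ≡ true → Ê e i ≈ (sg (γ e) * weight₂ e) * E e i
    Ê-on i q rewrite q = refl

    Ê-off : ∀ {e} i → Q e ≡ false → Ê e i ≈ sg (γ e) * E e i
    Ê-off i q rewrite q = refl

    relation : ∀ {v e f} i → Linear v → tgt e ≡ inj₂ v → src f ≡ inj₂ v →
               E e i ≈ (sg (σ₁ e f) * weight e) * E f i
    relation {v} {e} {f} i l t s′ = trans (bivalentBlack v e f l t s′ i) (*-congʳ (coefficient≈ N e f))

    fork : ∀ {v e f g} i → Forking v → tgt e ≡ inj₂ v → src f ≡ inj₂ v → src g ≡ inj₂ v → f ≢ g →
           E e i ≈ (sg (σ₁ e f) * weight e) * E f i + (sg (σ₁ e g) * weight e) * E g i
    fork {v} {e} {f} {g} i (d , w) t sf sg′ f≢g = trans (trivalentWhite v e f g d w t sf sg′ f≢g i)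
      (+-cong (*-congʳ (coefficient≈ N e f)) (*-congʳ (coefficient≈ N e g)))

    pass : ∀ {e f v} i → Q e ≡ false → Q f ≡ false → tgt e ≡ inj₂ v → src f ≡ inj₂ v →
           sg (γ e) * ((sg (σ₁ e f) * weight e) * E f i) ≈ coefficient N₂ 𝔩 e f * Ê f i
    pass {e} {f} i qe qf t s′ = trans (trans
      (solve 4 (λ g s w x → g :* ((s :* w) :* x) := (s :* w) :* (g :* x)) refl _ _ _ _)
      (*-cong (*-cong (sg-≡ (≡.sym (sign-off qe qf))) (sym (weight-off qe))) (*-congʳ (sg-≡ (γ-off qe qf t s′)))))
      (*-cong (sym (coefficient≈ N₂ e f)) (sym (Ê-off i qf)))

    sink′ : ∀ e j → tgt₂ e ≡ inj₁ j → Ê e ≈ᵥ (-1^ (+ int N₂ 𝔩 e) * weight₂ e) *ᵥ B j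
    sink′ e j t i with Q e in q
    ... | true  = contradiction (inj₁ (on-tgt₂ q t)) (∂-avoids q)
    ... | false = trans (*-congʳ (sg-≡ (sink-γ (off-tgt₂ q t))))
      (trans (*-identityˡ _) (trans (sink e j (off-tgt₂ q t) i)
        (*-congʳ (*-cong (reflexive (≡.cong (λ k → -1^ (+ k)) (≡.sym (int-eq e)))) (sym (weight-off q))))))

    linear′ : ∀ v e f → Network.degree N₂ (inj₂ v) ≡ 2 ⊎ colour v ≡ black → tgt₂ e ≡ inj₂ v → src₂ f ≡ inj₂ v →
              Ê e ≈ᵥ coefficient N₂ 𝔩 e f *ᵥ Ê f
    linear′ v e f l te sf i = cases (Q e) (Q f) ≡.refl ≡.refl
      where
      cases : ∀ a b → Q e ≡ a → Q f ≡ b → Ê e i ≈ coefficient N₂ 𝔩 e f * Ê f i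
      cases false false qe qf = trans (Ê-off i qe) (trans (*-congˡ (relation i (linear₂ l) te′ sf′)) (pass i qe qf te′ sf′))
        where
        te′ = off-tgt₂ qe te
        sf′ = off-src₂ qf sf
      cases true false qe qf = contradiction (inj₁ (on-tgt₂ qe te))
        (no-exit (linear₂ l) qe qf (off-src₂ qf sf))
      cases true true qe qf = begin′
        where
        p = f
        q = e
        tp = on-src₂ qf sf
        tq = on-tgt₂ qe te
        begin′ : Ê q i ≈ coefficient N₂ 𝔩 q p * Ê p i
        begin′ = trans (Ê-on i qe) (trans (*-congʳ (*-congʳ (trans (sg-≡ (γ-along qf qe tp tq))
            (trans (sg-xor (σ₂ q p) _) (*-congˡ (sg-xor (γ p) (σ₁ p q)))))))
          (trans (trans (sym (*-identityˡ _)) (*-congʳ (sym (weight-on qf))))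
          (trans (solve 7 (λ w w′ a b c u x → (w :* w′) :* (((a :* (b :* c)) :* u) :* x) :=
              (a :* u) :* ((b :* w′) :* ((c :* w) :* x))) refl _ _ _ _ _ _ _)
            (*-cong (sym (coefficient≈ N₂ q p)) (trans (*-congˡ (sym (relation i (linear₂ l) tp tq))) (sym (Ê-on i qf)))))))
      -- Both `E e` and `E p` are multiples of `E q`, where `q` is the cycle edge that used to leave
      -- the vertex. Comparing them gives the relation between `e` and the reversed `p`.
      cases false true qe qf = from (out-of qf tp)
        where
        p = f
        tp = on-src₂ qf sf
        te′ = off-tgt₂ qe te
        from : ∃[ q ] (Q q ≡ true × src q ≡ inj₂ v) → Ê e i ≈ coefficient N₂ 𝔩 e p * Ê p i
        from (q , qq , tq) = trans (Ê-off i qe) (trans (*-congˡ (relation i (linear₂ l) te′ tq))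
          (trans (*-congʳ (trans (sg-≡ (γ-entry (linear₂ l) qe qf qq te′ tp tq))
              (trans (sg-xor (σ₂ e p xor γ p) (σ₁ p q xor σ₁ e q)) (*-cong (sg-xor (σ₂ e p) (γ p)) (sg-xor (σ₁ p q) (σ₁ e q))))))
          (trans (solve 6 (λ a b c k w x → ((a :* b) :* (c :* k)) :* ((k :* w) :* x) :=
              (k :* k) :* (con 1ℤ :* ((a :* w) :* (b :* (c :* x))))) refl _ _ _ _ _ _)
          (trans (*-cong (sg-square (σ₁ e q)) (*-congʳ (sym (weight-on qf))))
          (trans (solve 7 (λ w w′ a u b c x → con 1ℤ :* ((w :* w′) :* ((a :* u) :* (b :* (c :* x)))) :=
              (a :* u) :* ((b :* w′) :* ((c :* w) :* x))) refl _ _ _ _ _ _ _)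
            (*-cong (trans (*-congˡ (sym (weight-off qe))) (sym (coefficient≈ N₂ e p)))
                    (trans (*-congˡ (sym (relation i (linear₂ l) tp tq))) (sym (Ê-on i qf)))))))))

    forking′ : ∀ v e₃ e₁ e₂ → Network.degree N₂ (inj₂ v) ≡ 3 → colour v ≡ white → tgt₂ e₃ ≡ inj₂ v →
               src₂ e₁ ≡ inj₂ v → src₂ e₂ ≡ inj₂ v → e₁ ≢ e₂ →
               Ê e₃ ≈ᵥ coefficient N₂ 𝔩 e₃ e₁ *ᵥ Ê e₁ +ᵥ coefficient N₂ 𝔩 e₃ e₂ *ᵥ Ê e₂
    forking′ v e₃ e₁ e₂ d w t₃ s₁ s₂ e₁≢e₂ i = cases (Q e₃) (Q e₁) (Q e₂) ≡.refl ≡.refl ≡.refl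
      where
      fk : Forking v
      fk = ≡.trans (≡.sym (degree-eq _)) d , w

      -- The relation of `p` is substituted on the right. The weights of `p` multiply to 1, the
      -- terms in `E f` cancel by `γ-exit`, and the term in `E q` is left.
      exchange : ∀ {q p f} → Q q ≡ true → Q p ≡ true → Q f ≡ false →
                 tgt₂ q ≡ inj₂ v → src₂ p ≡ inj₂ v → src₂ f ≡ inj₂ v → 
                 Ê q i ≈ coefficient N₂ 𝔩 q p * Ê p i + coefficient N₂ 𝔩 q f * Ê f i
      exchange {q} {p} {f} qq qp qf tq₂ tp₂ tf₂ = sym (trans
          (+-cong (*-cong (coefficient≈ N₂ q p) (trans (Ê-on i qp) (*-congˡ (fork i fk tp tq tf q≢f))))
                  (*-cong (coefficient≈ N₂ q f) (Ê-off i qf)))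
          (trans (solve 11 (λ a u b w′ k w x c y o g →
              (a :* u) :* ((b :* w′) :* ((k :* w) :* x :+ (c :* w) :* y)) :+ (o :* u) :* (g :* y) :=
              (w :* w′) :* (((a :* (b :* k)) :* u) :* x :+ ((a :* (b :* c)) :* u) :* y) :+ ((o :* g) :* u) :* y)
              refl (sg (σ₂ q p)) (weight₂ q) (sg (γ p)) (weight₂ p) (sg (σ₁ p q)) (weight p) (E q i) (sg (σ₁ p f)) (E f i) (sg (σ₂ q f)) (sg (γ f)))
          (trans (+-congʳ (trans (*-cong (weight-on qp) (+-cong (*-congʳ (*-congʳ on)) (*-congʳ (*-congʳ off)))) refl))
          (trans (solve 5 (λ g u x y o → con 1ℤ :* ((g :* u) :* x :+ ((:- o) :* u) :* y) :+ (o :* u) :* y := (g :* u) :* x)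
              refl (sg (γ q)) (weight₂ q) (E q i) (E f i) (sg (σ₂ q f) * sg (γ f)))
            (sym (Ê-on i qq))))))
        where
        tq = on-tgt₂ qq tq₂
        tp = on-src₂ qp tp₂
        tf = off-src₂ qf tf₂
        q≢f : q ≢ f
        q≢f ≡.refl with ≡.trans (≡.sym qq) qf
        ... | ()
        on : sg (σ₂ q p) * (sg (γ p) * sg (σ₁ p q)) ≈ sg (γ q)
        on = trans (*-congˡ (sym (sg-xor (γ p) (σ₁ p q)))) (trans (sym (sg-xor (σ₂ q p) _)) (sg-≡ (≡.sym (γ-along qp qq tp tq))))
        off : sg (σ₂ q p) * (sg (γ p) * sg (σ₁ p f)) ≈ - (sg (σ₂ q f) * sg (γ f))
        off = trans (*-congˡ (sym (sg-xor (γ p) (σ₁ p f)))) (trans (sym (sg-xor (σ₂ q p) _))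
          (trans (sg-≡ (γ-exit fk qf qp qq tf tp tq)) (trans (sg-not (σ₂ q f xor γ f)) (-‿cong (sg-xor (σ₂ q f) (γ f))))))

      cases : ∀ a b c → Q e₃ ≡ a → Q e₁ ≡ b → Q e₂ ≡ c →
              Ê e₃ i ≈ coefficient N₂ 𝔩 e₃ e₁ * Ê e₁ i + coefficient N₂ 𝔩 e₃ e₂ * Ê e₂ i
      cases false true _ q₃ q₁ _ = contradiction (inj₂ (on-src₂ q₁ s₁))
        (no-entry fk q₁ q₃ (off-tgt₂ q₃ t₃))
      cases false false true q₃ _ q₂ = contradiction (inj₂ (on-src₂ q₂ s₂))
        (no-entry fk q₂ q₃ (off-tgt₂ q₃ t₃))
      cases false false false q₃ q₁ q₂ = trans (Ê-off i q₃) (trans (*-congˡ (fork i fk t₃′ s₁′ s₂′ e₁≢e₂))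
        (trans (distribˡ _ _ _) (+-cong (pass i q₃ q₁ t₃′ s₁′) (pass i q₃ q₂ t₃′ s₂′))))
        where
        t₃′ = off-tgt₂ q₃ t₃
        s₁′ = off-src₂ q₁ s₁
        s₂′ = off-src₂ q₂ s₂
      cases true true true q₃ q₁ q₂ = contradiction
        (in-unique q₁ q₂ (on-src₂ q₁ s₁) (on-src₂ q₂ s₂)) e₁≢e₂
      cases true false false q₃ q₁ q₂ = contradiction (inj₁ (on-tgt₂ q₃ t₃))
        (one-exit fk q₃ q₁ q₂ e₁≢e₂ (off-src₂ q₁ s₁) (off-src₂ q₂ s₂))
      cases true true false q₃ q₁ q₂ = exchange q₃ q₁ q₂ t₃ s₁ s₂
      cases true false true q₃ q₁ q₂ = trans (exchange q₃ q₂ q₁ t₃ s₂ s₁) (+-comm _ _)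

-- Lower bounds for counts

module Counting where
  open import Data.Nat using (_+_; _≤_)
  open Sum ℕ.+-0-commutativeMonoid using (sum; sum-cong-≗; sum-remove; ∑-distrib-+) public

  indicator : Bool → ℕ
  indicator b = if b then 1 else 0

  countFin≡sum : ∀ {m p} {P : Pred (Fin m) p} (P? : Decidable P) → countFin P? ≡ sum (λ i → indicator (does (P? i)))
  countFin≡sum P? = go id
    where
    -- Generalised from the identity, since the tail of `tabulate f` is `tabulate (f ∘ Fin.suc)`.
    go : ∀ {n} (f : Fin n → Fin _) → count P? (tabulate f) ≡ sum (λ i → indicator (does (P? (f i))))
    go {zero}  f = ≡.refl
    go {suc n} f with P? (f Fin.zero)
    ... | yes _ = ≡.cong suc (go (f ∘ Fin.suc))
    ... | no _  = go (f ∘ Fin.suc)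

  term≤sum : ∀ {n} (t : Vector ℕ n) i → t i ≤ sum t
  term≤sum {suc n} t i = ≡.subst (t i ≤_) (≡.sym (sum-remove {i = i} t)) (ℕ.m≤m+n _ _)

  removeAt-punchOut : ∀ {n} (t : Vector ℕ (suc n)) {i j} (i≢j : i ≢ j) → removeAt t i (punchOut i≢j) ≡ t j
  removeAt-punchOut t i≢j = ≡.cong t (Fin.punchIn-punchOut i≢j)

  two-terms≤sum : ∀ {n} (t : Vector ℕ n) {i j} → i ≢ j → t i + t j ≤ sum t
  two-terms≤sum {suc n} t {i} {j} i≢j = ≡.subst (t i + t j ≤_) (≡.sym (sum-remove {i = i} t))
    (ℕ.+-monoʳ-≤ (t i) (≡.subst (_≤ sum (removeAt t i)) (removeAt-punchOut t i≢j) (term≤sum (removeAt t i) (punchOut i≢j))))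

  three-terms≤sum : ∀ {n} (t : Vector ℕ n) {i j k} → i ≢ j → i ≢ k → j ≢ k → t i + (t j + t k) ≤ sum t
  three-terms≤sum {suc n} t {i} {j} {k} i≢j i≢k j≢k = ≡.subst (t i + (t j + t k) ≤_) (≡.sym (sum-remove {i = i} t))
    (ℕ.+-monoʳ-≤ (t i) (≡.subst₂ (λ x y → x + y ≤ sum (removeAt t i)) (removeAt-punchOut t i≢j) (removeAt-punchOut t i≢k)
      (two-terms≤sum (removeAt t i) λ eq → j≢k (Fin.punchOut-injective i≢j i≢k eq))))

  module _ {m p} {P : Pred (Fin m) p} (P? : Decidable P) where

    private
      one : ∀ {i} → P i → indicator (does (P? i)) ≡ 1
      one {i} pi = ≡.cong indicator (dec-true (P? i) pi)

    1≤countFin : ∀ {i} → P i → 1 ≤ countFin P?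
    1≤countFin {i} pi = ≡.subst₂ _≤_ (one pi) (≡.sym (countFin≡sum P?)) (term≤sum _ i)

    2≤countFin : ∀ {i j} → i ≢ j → P i → P j → 2 ≤ countFin P?
    2≤countFin i≢j pi pj = ≡.subst₂ _≤_ (≡.cong₂ _+_ (one pi) (one pj)) (≡.sym (countFin≡sum P?)) (two-terms≤sum _ i≢j)

    3≤countFin : ∀ {i j k} → i ≢ j → i ≢ k → j ≢ k → P i → P j → P k → 3 ≤ countFin P?
    3≤countFin i≢j i≢k j≢k pi pj pk = ≡.subst₂ _≤_ (≡.cong₂ _+_ (one pi) (≡.cong₂ _+_ (one pj) (one pk)))
      (≡.sym (countFin≡sum P?)) (three-terms≤sum _ i≢j i≢k j≢k)

  countFin-cong : ∀ {m p q} {P : Pred (Fin m) p} {Q : Pred (Fin m) q} (P? : Decidable P) (Q? : Decidable Q) →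
                  (∀ i → does (P? i) ≡ does (Q? i)) → countFin P? ≡ countFin Q?
  countFin-cong P? Q? eq = ≡.trans (countFin≡sum P?)
    (≡.trans (sum-cong-≗ λ i → ≡.cong indicator (eq i)) (≡.sym (countFin≡sum Q?)))

  countFin-+ : ∀ {m p q} {P : Pred (Fin m) p} {Q : Pred (Fin m) q} (P? : Decidable P) (Q? : Decidable Q) →
               countFin P? + countFin Q? ≡ sum (λ i → indicator (does (P? i)) + indicator (does (Q? i)))
  countFin-+ P? Q? = ≡.trans (≡.cong₂ _+_ (countFin≡sum P?) (countFin≡sum Q?)) 
    (≡.sym (∑-distrib-+ (λ i → indicator (does (P? i))) (λ i → indicator (does (Q? i)))))

open Counting

signBit : Sign → Bool
signBit Sign.+ = false
signBit Sign.- = true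

signBit-≢ : ∀ {σ τ} → σ ≢ τ → signBit σ ≡ not (signBit τ)
signBit-≢ {Sign.+} {Sign.+} h = contradiction ≡.refl h
signBit-≢ {Sign.+} {Sign.-} h = ≡.refl
signBit-≢ {Sign.-} {Sign.+} h = ≡.refl
signBit-≢ {Sign.-} {Sign.-} h = contradiction ≡.refl h

-- Directions of the edges of a plabic network

module NetworkGeometry {c ℓ₁ ℓ₂ ℓ} (F : OrderedField c ℓ₁ ℓ₂)
  {D : Plabic.Disk F ℓ} {k n : ℕ} {N : Plabic.Network F n} (plabic : Plabic.IsPlabicNetwork F D k N) where
  open OrderedFieldProperties F
  open Plabic F
  open EventuallyProperties F
  open CrossingParity F
  open PlaneGeometry F
  open Segments F
  open TurnVectors F
  open Disk D
  open Network N
  open IsPlabicNetwork plabic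

  src≉tgt : ∀ e → ¬ (pos (src e) ≈ₚ pos (tgt e))
  src≉tgt e eq = no-loops e (pos-injective _ _ eq)

  -- Forgets the direction, so that an edge can be viewed as leaving whichever of its ends is of
  -- interest.
  Joins : Edge → Vertex → Vertex → Set
  Joins e u v = src e ≡ u × tgt e ≡ v ⊎ src e ≡ v × tgt e ≡ u

  Joins-∈ : ∀ {e u v z} → Joins e u v → z ∈[ pos u , pos v ] → OnEdge e z
  Joins-∈ (inj₁ (≡.refl , ≡.refl)) z∈ = z∈
  Joins-∈ {u = u} {v} (inj₂ (≡.refl , ≡.refl)) z∈ = ∈-swap {pos u} {pos v} z∈

  Joins-ends : ∀ {e u v x} → Joins e u v → src e ≡ x ⊎ tgt e ≡ x → x ≡ u ⊎ x ≡ v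
  Joins-ends (inj₁ (≡.refl , ≡.refl)) (inj₁ ≡.refl) = inj₁ ≡.refl
  Joins-ends (inj₁ (≡.refl , ≡.refl)) (inj₂ ≡.refl) = inj₂ ≡.refl
  Joins-ends (inj₂ (≡.refl , ≡.refl)) (inj₁ ≡.refl) = inj₂ ≡.refl
  Joins-ends (inj₂ (≡.refl , ≡.refl)) (inj₂ ≡.refl) = inj₁ ≡.refl

  Joins-≉ : ∀ {e u v} → Joins e u v → ¬ (pos u ≈ₚ pos v)
  Joins-≉ {e} (inj₁ (≡.refl , ≡.refl)) eq = src≉tgt e eq
  Joins-≉ {e} (inj₂ (≡.refl , ≡.refl)) eq = src≉tgt e (≈ₚ-sym eq)

  -- Edges in the same direction from `v` would share a point that is proper on both, but by
  -- planarity a common point is an end.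
  not-overlapping : ∀ {e f v u u′} → e ≢ f → Joins e v u → Joins f v u′ →
    cross (pos u -ₚ pos v) (pos u′ -ₚ pos v) ≈ 0# → ¬ (0# < dot (pos u -ₚ pos v) (pos u′ -ₚ pos v))
  not-overlapping {e} {f} {v} {u} e≢f je jf col same = case rays-overlap (pos v) (Joins-≉ je) col same of
    λ (t , r , t∈ , r∈ , eq) →
      case planar e f _ e≢f (Joins-∈ je (proper⇒∈ t∈)) (Joins-∈ jf (∈-resp-≈ (≈ₚ-sym eq) (proper⇒∈ r∈))) of
      λ (x , xe , _ , z≈) → end t∈ (Joins-ends je xe) z≈
    where
    end : ∀ {t x} → Proper t → x ≡ v ⊎ x ≡ u → ¬ (along (pos v) (pos u) t ≈ₚ pos x)
    end t∈ (inj₁ ≡.refl) = along≉start (Joins-≉ je) (proj₁ t∈)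
    end t∈ (inj₂ ≡.refl) = along≉end (Joins-≉ je) (proj₂ t∈)

  eventually-near : ∀ {r} z w → 0# < r → Eventually λ ε → Near r z (z +ₚ ε *ₚ w)
  eventually-near {r} (zx , zy) (wx , wy) 0<r =
    eventually-map (λ _ _ ((a , b) , (c , d)) → (0<-⇒< (0<-resp-≈ (lower _ _ _) a) , 0<-⇒< (0<-resp-≈ (upper _ _ _) b)) ,
                                                (0<-⇒< (0<-resp-≈ (lower _ _ _) c) , 0<-⇒< (0<-resp-≈ (upper _ _ _) d)))
      (eventually-× (eventually-× (eventually-pos wx 0<r) (eventually-pos (- wx) 0<r))
                    (eventually-× (eventually-pos wy 0<r) (eventually-pos (- wy) 0<r)))
    where
    lower : ∀ ε w z → r + ε * w ≈ z + ε * w - z - - r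
    lower ε w z = solve 4 (λ r ε w z → r :+ ε :* w := z :+ ε :* w :- z :- (:- r)) refl r ε w z
    upper : ∀ ε w z → r + ε * - w ≈ r - (z + ε * w - z)
    upper ε w z = solve 4 (λ r ε w z → r :+ ε :* (:- w) := r :- (z :+ ε :* w :- z)) refl r ε w z

  boundary-onInterval : ∀ j → OnInterval (pos (inj₁ j))
  boundary-onInterval j = param j , proj₁ (param-range j) , proj₂ (param-range j) , pos-boundary j

  -- Near a point of the interval the domain is the open half plane to its right. One small `ε`
  -- therefore decides, and scaling does not affect the sign.
  boundary-inward : ∀ j w → (Eventually λ ε → Interior (pos (inj₁ j) +ₚ ε *ₚ w)) → 0# < - cross (B -ₚ A) w
  boundary-inward j w inside = case flat b (boundary-onInterval j) of λ (r , 0<r , iff) →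
    case eventually-∃ (eventually-× inside (eventually-near b w 0<r)) of λ (ε , 0<ε , inn , near) →
      *-cancel-pos 0<ε (0<-resp-≈ (eq (B -ₚ A) b w)
        (minus⇒ (≡.subst (SignOf _) (Equivalence.to (iff _ near) inn) (SignOf-sgn _))))
    where
    b : Point
    b = pos (inj₁ j)
    minus⇒ : ∀ {x} → SignOf x -1ℤ → 0# < - x
    minus⇒ (negative p) = p
    eq : ∀ {ε} u b w → - cross u (b +ₚ ε *ₚ w -ₚ b) ≈ ε * - cross u w
    eq {ε} (ux , uy) (bx , by) (wx , wy) = solve 7 (λ ux uy bx by wx wy ε →
      :- (ux :* (by :+ ε :* wy :- by) :- uy :* (bx :+ ε :* wx :- bx)) := ε :* (:- (ux :* wy :- uy :* wx)))
      refl ux uy bx by wx wy ε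

  edge-along : ∀ {e u v} → Joins e u v → ∀ t → Proper t → Interior (along (pos u) (pos v) t)
  edge-along {e} (inj₁ (≡.refl , ≡.refl)) t (a , b) = edges-inside e t a (0<-⇒< b)
  edge-along {e} {u} {v} (inj₂ (≡.refl , ≡.refl)) t (a , b) =
    resp (eq _ _ , eq _ _) (edges-inside e (1# - t) b (0<-⇒< (proj₂ (1-proper (a , b)))))
    where
    eq : ∀ p q → q + (1# - t) * (p - q) ≈ p + t * (q - p)
    eq p q = solve 3 (λ p q t → q :+ (con 1ℤ :- t) :* (p :- q) := p :+ t :* (q :- p)) refl p q t

  module _ {𝔩 : Point} (gauge : IsGaugeDirection D N 𝔩) where
    open IsGaugeDirection gauge

    -- `not-parallel` concerns internal edges only. At the boundary both the edge and 𝔩 point into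
    -- the disk, so parallel ones point the same way, and the ray would run into the internal
    -- vertex.
    boundary-transversal : ∀ {e j v} → Joins e (inj₁ j) (inj₂ v) → ¬ (cross (pos (inj₂ v) -ₚ pos (inj₁ j)) 𝔩 ≈ 0#)
    boundary-transversal {e} {j} {v} joins par = cases (signOf (dot d 𝔩))
      where
      b x d u : Point
      b = pos (inj₁ j)
      x = pos (inj₂ v)
      d = x -ₚ b
      u = B -ₚ A
      d≉0 : ¬ (d ≈ₚ origin)
      d≉0 = difference≉0 (Joins-≉ joins)

      d-inward : 0# < - cross u d
      d-inward = boundary-inward j d (eventually-map (λ ε _ → edge-along joins ε) eventually-proper)
      𝔩-inward : 0# < - cross u 𝔩
      𝔩-inward = boundary-inward j 𝔩 (points-inside j)

      expand : dot d d * cross u 𝔩 ≈ dot d 𝔩 * cross u d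
      expand = trans (expand-cross d u 𝔩) (trans (+-congʳ (*-≈0 _ par)) (trans (+-identityˡ _)
        (trans (solve 2 (λ x y → :- (x :* y) := x :* (:- y)) refl (dot d 𝔩) (cross d u)) (*-congˡ (cross-anti d u)))))

      impossible : 0# ≤ - dot d 𝔩 → ⊥
      impossible neg = 0<⇒≉0 (+-pos-nonneg (*-pos (dot-self-pos d≉0) 𝔩-inward) (*-nonneg neg (inj₁ d-inward)))
        (trans (solve 4 (λ a b c e → a :* (:- b) :+ (:- c) :* (:- e) := c :* e :- a :* b) refl _ _ _ _)
          (trans (+-congˡ (-‿cong expand)) (-‿inverseʳ _)))

      hit : 0# < dot 𝔩 d → ⊥
      hit 0<ld = avoids-internal j v (dot 𝔩 d * dot 𝔩 𝔩 ⁻¹) (inj₁ (*-pos 0<ld (⁻¹-pos (dot-self-pos 𝔩≉0))))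
        (-ₚ⇒+ₚ (parallel⇒multiple 𝔩≉0 (trans (sym (cross-anti d 𝔩)) (-0≈0 par))))
        where
        𝔩≉0 : ¬ (𝔩 ≈ₚ origin)
        𝔩≉0 (ex , ey) = 0<⇒≉0 0<ld (trans (+-cong (trans (*-congʳ ex) (zeroˡ _)) (trans (*-congʳ ey) (zeroˡ _))) (+-identityˡ 0#))

      cases : ∃[ i ] SignOf (dot d 𝔩) i → ⊥
      cases (_ , positive p) = hit (0<-resp-≈ (+-cong (*-comm _ _) (*-comm _ _)) p)
      cases (_ , null p)     = impossible (inj₂ (sym (-0≈0 p)))
      cases (_ , negative p) = impossible (inj₁ p)

    reversed : ∀ p q → cross (p -ₚ q) 𝔩 ≈ 0# → cross (q -ₚ p) 𝔩 ≈ 0#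
    reversed p q par = trans (cross-cong (-ₚ-flip q p) (≈ₚ-refl {𝔩})) (trans (cross-negˡ (p -ₚ q) 𝔩) (-0≈0 par))

    transversal : ∀ {e v u} → Joins e (inj₂ v) u → ¬ (cross (pos u -ₚ pos (inj₂ v)) 𝔩 ≈ 0#)
    transversal {e} {v} {inj₁ j} joins par = boundary-transversal (swap joins) (reversed (pos (inj₁ j)) (pos (inj₂ v)) par)
      where
      swap : Joins e (inj₂ v) (inj₁ j) → Joins e (inj₁ j) (inj₂ v)
      swap (inj₁ h) = inj₂ h
      swap (inj₂ h) = inj₁ h
    transversal {e} {v} {inj₂ u} (inj₁ (se , te)) par = not-parallel e v u se te (SignOf⇒s (dir e) 𝔩 (null
      (≡.subst₂ (λ a b → cross (pos b -ₚ pos a) 𝔩 ≈ 0#) (≡.sym se) (≡.sym te) par)))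
    transversal {e} {v} {inj₂ u} (inj₂ (se , te)) par = not-parallel e u v se te (SignOf⇒s (dir e) 𝔩 (null
      (≡.subst₂ (λ a b → cross (pos b -ₚ pos a) 𝔩 ≈ 0#) (≡.sym se) (≡.sym te) (reversed (pos (inj₂ u)) (pos (inj₂ v)) par))))

-- Marks and parities

module CycleGeometry {c ℓ₁ ℓ₂ ℓ} (F : OrderedField c ℓ₁ ℓ₂)
  {D : Plabic.Disk F ℓ} {k n : ℕ} {N : Plabic.Network F n} (plabic : Plabic.IsPlabicNetwork F D k N)
  (Q : Plabic.SimpleCycle F N) (M : Plabic.RegionMarking F D N Q) where
  open OrderedFieldProperties F
  open Plabic F
  open EventuallyProperties F
  open CrossingParity F
  open PlaneGeometry F
  open Segments F
  open TurnVectors F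
  open Disk D
  open Network N
  open IsPlabicNetwork plabic
  open NetworkGeometry F plabic
  open SimpleCycle Q renaming (simple to src-injective)
  open RegionMarking M

  P : Fin (suc length-1) → Point
  P i = pos (src (edge i))

  tgt-pos : ∀ i → pos (tgt (edge i)) ≡ P (next i)
  tgt-pos i = ≡.cong pos (directed i)

  toOnEdge : ∀ i {z} → z ∈[ P i , P (next i) ] → OnEdge (edge i) z
  toOnEdge i {z} = ≡.subst (λ q → z ∈[ P i , q ]) (≡.sym (tgt-pos i))

  fromOnEdge : ∀ i {z} → OnEdge (edge i) z → z ∈[ P i , P (next i) ]
  fromOnEdge i {z} = ≡.subst (λ q → z ∈[ P i , q ]) (tgt-pos i)

  nondegenerate : ∀ i → ¬ (P i ≈ₚ P (next i))
  nondegenerate i eq = src≉tgt (edge i) (≡.subst (λ q → P i ≈ₚ q) (≡.sym (tgt-pos i)) eq)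

  simple : ∀ {i j z} → i ≢ j → z ∈[ P i , P (next i) ] → z ∈[ P j , P (next j) ] →
           next j ≡ i × z ≈ₚ P i ⊎ next i ≡ j × z ≈ₚ P j
  simple {i} {j} {z} i≢j zi zj = cases (planar (edge i) (edge j) z
      (λ eq → i≢j (src-injective (≡.cong src eq))) (toOnEdge i zi) (toOnEdge j zj))
    where
    cases : ∃[ v ] ((src (edge i) ≡ v ⊎ tgt (edge i) ≡ v) × (src (edge j) ≡ v ⊎ tgt (edge j) ≡ v) × z ≈ₚ pos v) →
            next j ≡ i × z ≈ₚ P i ⊎ next i ≡ j × z ≈ₚ P j
    cases (v , inj₁ a , inj₁ b , _)  = contradiction (src-injective (≡.trans a (≡.sym b))) i≢j
    cases (v , inj₁ a , inj₂ b , z≈) = inj₁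
      (src-injective (≡.trans (≡.sym (directed j)) (≡.trans b (≡.sym a))) , ≡.subst (λ v → z ≈ₚ pos v) (≡.sym a) z≈)
    cases (v , inj₂ a , inj₁ b , z≈) = inj₂
      (src-injective (≡.trans (≡.sym (directed i)) (≡.trans a (≡.sym b))) , ≡.subst (λ v → z ≈ₚ pos v) (≡.sym b) z≈)
    cases (v , inj₂ a , inj₂ b , _)  = contradiction
      (next-injective (src-injective (≡.trans (≡.sym (directed i)) (≡.trans a (≡.trans (≡.sym b) (directed j)))))) i≢j

  polygon : IsSimplePolygon F P
  polygon = record { nondegenerate = nondegenerate ; simple = simple }

  open SimplePolygon F polygon public

  offCycle : ∀ {x} → Interior x → (∀ i → ¬ (x ∈[ P i , P (next i) ])) → OffCycle x
  offCycle inn off = inj₁ inn , λ (i , on) → off i (fromOnEdge i on)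

  path-parity : ∀ {x y} → PathIn OffCycle x y → parity x ≡ parity y
  path-parity Star.ε = ≡.refl
  path-parity {x} (_◅_ {j = y} step path) = ≡.trans
    (parity-constant x y λ i (z , on , z∈) → proj₂ (step z z∈) (i , toOnEdge i on)) (path-parity path)

  parity≢⇒mark≢ : ∀ {x y} → OffCycle x → OffCycle y → parity x ≢ parity y → mark x ≢ mark y
  parity≢⇒mark≢ ox oy h eq = h (path-parity (Equivalence.to (same-region _ _ ox oy) eq))

  sidePt-offCycle : ∀ i ω → Unit ω → ∀ {τ} → Proper τ → Eventually λ δ → OffCycle (sidePt i ω τ δ)
  sidePt-offCycle i ω ωω {τ} τ∈ = eventually-map
    (λ δ 0<δ (near , clear) → offCycle near λ g → avoids g δ 0<δ clear)
    (eventually-× inside (eventually-clear i ω τ∈))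
    where
    avoids : ∀ g δ → 0# < δ → Clear i ω τ δ → ¬ (sidePt i ω τ δ ∈[ P g , P (next g) ])
    avoids g δ 0<δ clear on with i Fin.≟ g
    ... | no i≢g = clear g i≢g (sidePt i ω τ δ , on , end∈ {footOf i τ})
    ... | yes ≡.refl = separated⇒disjoint (side ω (P i) (edgeDir i)) (side-base ω (P i) (P (next i))) above above
                         (sidePt i ω τ δ , on , start∈ {q = sidePt i ω τ δ})
      where
      above : 0# < height (side ω (P i) (edgeDir i)) (sidePt i ω τ δ)
      above = side-self ωω (P i) (P (next i)) (nondegenerate i) 0<δ
    foot-interior : Interior (footOf i τ)
    foot-interior = resp (≈ₚ-sym (foot≈along (P i) (P (next i)) τ))
      (edge-along {edge i} (inj₁ (≡.refl , directed i)) (1# - τ) (1-proper τ∈))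
    inside : Eventually λ δ → Interior (sidePt i ω τ δ)
    inside = case isOpen _ foot-interior of λ (r , 0<r , ball) →
      eventually-map (λ δ _ near → ball _ near) (eventually-near (footOf i τ) (ω *ₚ rotate90 (edgeDir i)) 0<r)

  -- Points of different parity have different marks, since equal marks give a path. The converse
  -- needs a third point: `y` and `z` on the two sides of an edge realise both parities, so a point
  -- with the parity of `y` differs from `z` in its mark, as `y` does, and there are only two marks.
  mark-parity : ∃[ β ] (∀ x → OffCycle x → signBit (mark x) ≡ parity x xor β)
  mark-parity = from (eventually-∃ (eventually-× (flips Fin.zero ½-proper)
      (eventually-× (sidePt-offCycle Fin.zero 1# unit-1 ½-proper) (sidePt-offCycle Fin.zero (- 1#) unit--1 ½-proper))))
    where
    from : ∃[ δ ] (0# < δ × parity (sidePt Fin.zero 1# ½ δ) ≡ not (parity (sidePt Fin.zero (- 1#) ½ δ)) ×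
                   OffCycle (sidePt Fin.zero 1# ½ δ) × OffCycle (sidePt Fin.zero (- 1#) ½ δ)) →
           ∃[ β ] (∀ x → OffCycle x → signBit (mark x) ≡ parity x xor β)
    from (δ , _ , opposite , oy , oz) = parity y xor signBit (mark y) , λ x ox → cases x ox (parity x Bool.≟ parity y)
      where
      y z : Point
      y = sidePt Fin.zero 1# ½ δ
      z = sidePt Fin.zero (- 1#) ½ δ
      y≢z : parity y ≢ parity z
      y≢z eq = Bool.not-¬ (≡.refl {x = parity z}) (≡.trans (≡.sym eq) opposite)
      cancel : ∀ a b → b ≡ a xor (a xor b)
      cancel true  b = ≡.sym (Bool.not-involutive b)
      cancel false b = ≡.refl
      cancel-not : ∀ a b → not b ≡ not a xor (a xor b)
      cancel-not true  b = ≡.refl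
      cancel-not false b = ≡.refl
      cases : ∀ x → OffCycle x → Dec (parity x ≡ parity y) → signBit (mark x) ≡ parity x xor (parity y xor signBit (mark y))
      cases x ox (yes eq) = ≡.trans
        (≡.trans (signBit-≢ (parity≢⇒mark≢ ox oz λ e → y≢z (≡.trans (≡.sym eq) e)))
          (≡.trans (≡.cong not (signBit-≢ (parity≢⇒mark≢ oz oy λ e → y≢z (≡.sym e)))) (Bool.not-involutive _)))
        (≡.trans (cancel (parity y) (signBit (mark y))) (≡.cong (_xor (parity y xor signBit (mark y))) (≡.sym eq)))
      cases x ox (no ne) = ≡.trans (signBit-≢ (parity≢⇒mark≢ ox oy ne))
        (≡.trans (cancel-not (parity y) (signBit (mark y)))
          (≡.cong (_xor (parity y xor signBit (mark y))) (≡.sym (Bool.¬-not ne))))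

  -- The offset between parity and mark. Its value is not computed: it cancels from the identities
  -- at internal vertices.
  β : Bool
  β = proj₁ mark-parity

  signBit-mark : ∀ {x σ} → OffCycle x → mark x ≡ σ → signBit σ ≡ parity x xor β
  signBit-mark ox ≡.refl = proj₂ mark-parity _ ox

  end-onCycle : ∀ {e u} → e ∈Q → src e ≡ u ⊎ tgt e ≡ u → VertexOf u
  end-onCycle (i , ≡.refl) (inj₁ eq) = i , eq
  end-onCycle (i , ≡.refl) (inj₂ eq) = next i , ≡.trans (≡.sym (directed i)) eq

  OffCycle-resp-≈ : ∀ {x y} → x ≈ₚ y → OffCycle x → OffCycle y
  OffCycle-resp-≈ {x} {y} x≈y (inDisk , off) = moved inDisk , λ (i , on) → off (i , ∈-resp-≈ (≈ₚ-sym x≈y) on)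
    where
    moved : InDisk x → InDisk y
    moved (inj₁ inn)               = inj₁ (resp x≈y inn)
    moved (inj₂ (t , 0<t , t<1 , x≈)) = inj₂ (t , 0<t , t<1 , ≈ₚ-trans (≈ₚ-sym x≈y) x≈)

  left-parity : ∀ 𝔩 {i b σ} → SideParity 1# i b → LeftRegion N 𝔩 Q M (edge i) σ → signBit σ ≡ b xor β
  left-parity 𝔩 {i} {b} {σ} side region = case eventually²-∃ (eventually²-× marked
      (eventually-map (λ τ _ τ∈ → eventually-× (side τ τ∈) (sidePt-offCycle i 1# unit-1 τ∈)) eventually-proper)) of
    λ (τ , δ , m , p , off) → ≡.trans
      (signBit-mark (OffCycle-resp-≈ (leftPoint≈ (P (next i)) τ δ) off) m)
      (≡.cong (_xor β) (≡.trans (≡.sym (parity-cong (leftPoint≈ (P (next i)) τ δ))) p))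
    where
    leftPoint : Point → Carrier → Carrier → Point
    leftPoint q τ δ = q -ₚ τ *ₚ (q -ₚ P i) +ₚ δ *ₚ rotate90 (q -ₚ P i)

    marked : Eventually² λ τ δ → mark (leftPoint (P (next i)) τ δ) ≡ σ
    marked = ≡.subst (λ q → Eventually² λ τ δ → mark (leftPoint q τ δ) ≡ σ) (tgt-pos i) region

    leftPoint≈ : ∀ q τ δ → sidePoint (P i) q 1# τ δ ≈ₚ leftPoint q τ δ
    leftPoint≈ q τ δ = +-congˡ (*-congˡ (*-identityˡ _)) , +-congˡ (*-congˡ (*-identityˡ _))

  cycle-meets-ends : ∀ {e i z} → ¬ (e ∈Q) → OnEdge e z → z ∈[ P i , P (next i) ] →
                     ∃[ u ] ((src e ≡ u ⊎ tgt e ≡ u) × VertexOf u × z ≈ₚ pos u)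
  cycle-meets-ends {e} {i} {z} e∉Q on-e on-i =
    case planar e (edge i) z (λ e≡ → e∉Q (i , ≡.sym e≡)) on-e (toOnEdge i on-i) of
    λ (u , e-u , i-u , z≈) → u , e-u , end-onCycle (i , ≡.refl) i-u , z≈

  vertex-offCycle : ∀ {e u} → ¬ (e ∈Q) → src e ≡ u ⊎ tgt e ≡ u → ¬ VertexOf u → OffCycle (pos u)
  vertex-offCycle {e} {u} e∉Q e-u ¬on = inDisk u , λ (i , on) → off (cycle-meets-ends {i = i} e∉Q (at-end e-u) (fromOnEdge i on))
    where
    inDisk : ∀ u → InDisk (pos u)
    inDisk (inj₁ j) = inj₂ (boundary-onInterval j)
    inDisk (inj₂ v) = inj₁ (pos-internal v)
    at-end : src e ≡ u ⊎ tgt e ≡ u → OnEdge e (pos u)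
    at-end (inj₁ ≡.refl) = start∈ {pos u}
    at-end (inj₂ ≡.refl) = end∈ {pos (src e)}
    off : ∃[ w ] ((src e ≡ w ⊎ tgt e ≡ w) × VertexOf w × pos u ≈ₚ pos w) → ⊥
    off (w , _ , on , u≈w) = ¬on (≡.subst VertexOf (≡.sym (pos-injective u w u≈w)) on)

  module _ {e : Edge} (e∉Q : ¬ (e ∈Q)) where

    onEdgeAt : Carrier → Point
    onEdgeAt t = along (pos (src e)) (pos (tgt e)) t

    -- An edge e ∉ Q meets the cycle at its ends only.
    Free : Carrier → Set _
    Free t = (VertexOf (src e) → 0# < t) × (VertexOf (tgt e) → 0# < 1# - t)

    proper⇒free : ∀ {t} → Proper t → Free t
    proper⇒free (a , b) = (λ _ → a) , (λ _ → b)

    free-off : ∀ {t i} → 0# ≤ t → t ≤ 1# → Free t → ¬ (onEdgeAt t ∈[ P i , P (next i) ])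
    free-off {t} {i} 0≤t t≤1 (fs , ft) on = ends (cycle-meets-ends {e} {i} e∉Q (t , 0≤t , t≤1 , ≈ₚ-refl) on)
      where
      ends : ∃[ u ] ((src e ≡ u ⊎ tgt e ≡ u) × VertexOf u × onEdgeAt t ≈ₚ pos u) → ⊥
      ends (u , inj₁ ≡.refl , on , z≈) = along≉start (src≉tgt e) (fs on) z≈
      ends (u , inj₂ ≡.refl , on , z≈) = along≉end (src≉tgt e) (ft on) z≈

    -- The conditions in `Free` are convex, so they hold on the whole segment between two free
    -- points.
    slide : ∀ {t r} → 0# ≤ t → t ≤ 1# → Free t → 0# ≤ r → r ≤ 1# → Free r → parity (onEdgeAt t) ≡ parity (onEdgeAt r)
    slide {t} {r} 0≤t t≤1 (fs , ft) 0≤r r≤1 (fs′ , ft′) = parity-constant _ _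
      λ i (z , on , (q , 0≤q , q≤1 , z≈)) → free-off {(1# - q) * t + q * r} {i}
        (convex-nonneg 0≤t 0≤r 0≤q q≤1)
        (0≤-⇒≤ (≤-respʳ-≈ (complement t r q) (convex-nonneg (≤⇒0≤- t≤1) (≤⇒0≤- r≤1) 0≤q q≤1)))
        ((λ on-src → convex-pos (fs on-src) (fs′ on-src) 0≤q q≤1) ,
         (λ on-tgt → 0<-resp-≈ (complement t r q) (convex-pos (ft on-tgt) (ft′ on-tgt) 0≤q q≤1)))
        (∈-resp-≈ (≈ₚ-trans z≈ (between _ _ t r q , between _ _ t r q)) on)
      where
      complement : ∀ t r q → (1# - q) * (1# - t) + q * (1# - r) ≈ 1# - ((1# - q) * t + q * r)
      complement = solve 3 (λ t r q → (con 1ℤ :- q) :* (con 1ℤ :- t) :+ q :* (con 1ℤ :- r) :=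
        con 1ℤ :- ((con 1ℤ :- q) :* t :+ q :* r)) refl
      between : ∀ a b t r q → a + t * (b - a) + q * (a + r * (b - a) - (a + t * (b - a))) ≈ a + ((1# - q) * t + q * r) * (b - a)
      between = solve 5 (λ a b t r q → a :+ t :* (b :- a) :+ q :* (a :+ r :* (b :- a) :- (a :+ t :* (b :- a))) :=
        a :+ ((con 1ℤ :- q) :* t :+ q :* r) :* (b :- a)) refl

    edgeParity : Bool
    edgeParity = parity (onEdgeAt ½)

    parity-onEdge : ∀ {t} → Proper t → parity (onEdgeAt t) ≡ edgeParity
    parity-onEdge {t} t∈ = slide (inj₁ (proj₁ t∈)) (inj₁ (0<-⇒< (proj₂ t∈))) (proper⇒free t∈)
      (inj₁ (proj₁ ½-proper)) (inj₁ (0<-⇒< (proj₂ ½-proper))) (proper⇒free ½-proper)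

    along-0 : ∀ {p q} → along p q 0# ≈ₚ p
    along-0 {p} {q} = eq _ _ , eq _ _
      where
      eq : ∀ p q → p + 0# * (q - p) ≈ p
      eq = solve 2 (λ p q → p :+ con 0ℤ :* (q :- p) := p) refl

    along-1 : ∀ {p q} → along p q 1# ≈ₚ q
    along-1 {p} {q} = eq _ _ , eq _ _
      where
      eq : ∀ p q → p + 1# * (q - p) ≈ q
      eq = solve 2 (λ p q → p :+ con 1ℤ :* (q :- p) := q) refl

    -- At an end off the cycle `Free` demands nothing, so the slide reaches the end itself.
    parity-vertex : ∀ {u} → src e ≡ u ⊎ tgt e ≡ u → ¬ VertexOf u → parity (pos u) ≡ edgeParity
    parity-vertex (inj₁ ≡.refl) ¬on = ≡.trans (parity-cong (≈ₚ-sym (along-0 {pos (src e)} {pos (tgt e)})))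
      (slide ≤-refl (inj₁ 0<1) ((λ on → contradiction on ¬on) , λ _ → 0<-resp-≈ (solve 0 (con 1ℤ := con 1ℤ :- con 0ℤ) refl) 0<1)
        (inj₁ (proj₁ ½-proper)) (inj₁ (0<-⇒< (proj₂ ½-proper))) (proper⇒free ½-proper))
    parity-vertex (inj₂ ≡.refl) ¬on = ≡.trans (parity-cong (≈ₚ-sym (along-1 {pos (src e)} {pos (tgt e)})))
      (slide (inj₁ 0<1) ≤-refl ((λ _ → 0<1) , λ on → contradiction on ¬on)
        (inj₁ (proj₁ ½-proper)) (inj₁ (0<-⇒< (proj₂ ½-proper))) (proper⇒free ½-proper))

    start-parity : ∀ 𝔩 {σ} → StartRegion N 𝔩 Q M e σ → signBit σ ≡ edgeParity xor β
    start-parity 𝔩 (off-cycle ¬on m) = ≡.trans (signBit-mark (vertex-offCycle e∉Q (inj₁ ≡.refl) ¬on) m)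
      (≡.cong (_xor β) (parity-vertex (inj₁ ≡.refl) ¬on))
    start-parity 𝔩 (on-cycle _ near) = case eventually-∃ (eventually-× near eventually-proper) of λ (t , _ , m , t∈) →
      ≡.trans
        (signBit-mark (offCycle (edge-along {e} (inj₁ (≡.refl , ≡.refl)) t t∈) λ i →
          free-off {t} {i} (inj₁ (proj₁ t∈)) (inj₁ (0<-⇒< (proj₂ t∈))) (proper⇒free t∈)) m)
        (≡.cong (_xor β) (parity-onEdge t∈))

    -- Here the convention enters that the region at the boundary is marked +; it keeps the boundary
    -- conditions unchanged.
    sink-parity : ∀ {j} → tgt e ≡ inj₁ j → ¬ VertexOf (inj₁ j) → edgeParity xor β ≡ false
    sink-parity {j} t ¬on = ≡.trans (≡.cong (_xor β) (≡.sym (parity-vertex (inj₂ t) ¬on)))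
      (≡.sym (signBit-mark (vertex-offCycle e∉Q (inj₂ t) ¬on) (external _ (boundary-onInterval j))))

odd-bit : ∀ σ → odd (bit σ) ≡ signBit σ
odd-bit Sign.+ = ≡.refl
odd-bit Sign.- = ≡.refl

-- Degrees along the cycle and the reversed network

module CycleStructure {c ℓ₁ ℓ₂ ℓ} (F : OrderedField c ℓ₁ ℓ₂)
  {D : Plabic.Disk F ℓ} {k n : ℕ} {N : Plabic.Network F n} (plabic : Plabic.IsPlabicNetwork F D k N)
  (Q : Plabic.SimpleCycle F N) where
  open OrderedFieldProperties F
  open Plabic F
  open Network N
  open IsPlabicNetwork plabic
  open SimpleCycle Q renaming (simple to src-injective)

  onQ : Edge → Bool
  onQ e = does (e ∈Q?)

  onQ⇒ : ∀ {e} → onQ e ≡ true → e ∈Q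
  onQ⇒ {e} = from (e ∈Q?)
    where
    from : ∀ {e} (d : Dec (e ∈Q)) → does d ≡ true → e ∈Q
    from (yes p) _ = p

  ¬onQ⇒ : ∀ {e} → onQ e ≡ false → ¬ (e ∈Q)
  ¬onQ⇒ {e} = from (e ∈Q?)
    where
    from : ∀ {e} (d : Dec (e ∈Q)) → does d ≡ false → ¬ (e ∈Q)
    from (no ¬p) _ = ¬p

  onQ≢ : ∀ {e f} → onQ e ≡ true → onQ f ≡ false → e ≢ f
  onQ≢ qe qf ≡.refl with ≡.trans (≡.sym qe) qf
  ... | ()

  edge-onQ : ∀ i → onQ (edge i) ≡ true
  edge-onQ i = dec-true (edge i ∈Q?) (i , ≡.refl)

  At : Edge → Vertex → Set
  At e u = src e ≡ u ⊎ tgt e ≡ u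

  -- A vertex of the cycle has one cycle edge arriving and one leaving; together with the degree
  -- conditions this limits the further edges at it.
  Passes : Vertex → Set
  Passes u = ∃[ i ] (tgt (edge i) ≡ u × src (edge (next i)) ≡ u)

  passing : ∀ {e u} → onQ e ≡ true → At e u → Passes u
  passing q at = from (onQ⇒ q) at
    where
    from : ∀ {e u} → e ∈Q → At e u → Passes u
    from (i , ≡.refl) (inj₂ t) = i , t , ≡.trans (≡.sym (directed i)) t
    from (i , ≡.refl) (inj₁ t) = prev i , ≡.trans (directed (prev i)) t′ , t′
      where t′ = ≡.trans (≡.cong (λ j → src (edge j)) (next-prev i)) t

  in≥1 : ∀ {e u} → tgt e ≡ u → 1 ℕ.≤ inDegree u
  in≥1 {u = u} t = 1≤countFin (λ e → tgt e ≟ᵛ u) t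

  out≥1 : ∀ {e u} → src e ≡ u → 1 ℕ.≤ outDegree u
  out≥1 {u = u} t = 1≤countFin (λ e → src e ≟ᵛ u) t

  in≥2 : ∀ {e f u} → e ≢ f → tgt e ≡ u → tgt f ≡ u → 2 ℕ.≤ inDegree u
  in≥2 {u = u} ne t t′ = 2≤countFin (λ e → tgt e ≟ᵛ u) ne t t′

  out≥2 : ∀ {e f u} → e ≢ f → src e ≡ u → src f ≡ u → 2 ℕ.≤ outDegree u
  out≥2 {u = u} ne t t′ = 2≤countFin (λ e → src e ≟ᵛ u) ne t t′

  out≥3 : ∀ {e f g u} → e ≢ f → e ≢ g → f ≢ g → src e ≡ u → src f ≡ u → src g ≡ u → 3 ℕ.≤ outDegree u
  out≥3 {u = u} ef eg fg t t′ t″ = 3≤countFin (λ e → src e ≟ᵛ u) ef eg fg t t′ t″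

  degree-bound : ∀ {u a b d} → a ℕ.≤ inDegree u → b ℕ.≤ outDegree u → degree u ≡ d → a ℕ.+ b ℕ.≤ d
  degree-bound {a = a} {b} p q eq = ≡.subst (a ℕ.+ b ℕ.≤_) eq (ℕ.+-mono-≤ p q)

  -- A vertex on the cycle has degree at least 2.
  avoids-boundary : ∀ {e j} → onQ e ≡ true → ¬ At e (inj₁ j)
  avoids-boundary {e} {j} q at = from (passing q at)
    where
    from : Passes (inj₁ j) → ⊥
    from (i , t , t′) = ℕ.<-irrefl ≡.refl (degree-bound (in≥1 t) (out≥1 t′) (boundary-degree j))

  boundary-off-cycle : ∀ j → ¬ VertexOf (inj₁ j)
  boundary-off-cycle j (i , eq) = avoids-boundary (edge-onQ i) (inj₁ eq)

  no-exit : ∀ {e f v} → degree (inj₂ v) ≡ 2 ⊎ colour v ≡ black → onQ e ≡ true → onQ f ≡ false →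
             src f ≡ inj₂ v → ¬ At e (inj₂ v)
  no-exit {e} {f} {v} linear qe qf sf at = from linear (passing qe at)
    where
    from : degree (inj₂ v) ≡ 2 ⊎ colour v ≡ black → Passes (inj₂ v) → ⊥
    from (inj₁ deg) (i , t , t′) = ℕ.<-irrefl ≡.refl
      (degree-bound (in≥1 t) (out≥2 (onQ≢ (edge-onQ (next i)) qf) t′ sf) deg)
    from (inj₂ bl) (i , t , t′) = ℕ.<-irrefl ≡.refl
      (≡.subst (2 ℕ.≤_) (black-out v bl) (out≥2 (onQ≢ (edge-onQ (next i)) qf) t′ sf))

  no-entry : ∀ {e f v} → degree (inj₂ v) ≡ 3 × colour v ≡ white → onQ e ≡ true → onQ f ≡ false →
              tgt f ≡ inj₂ v → ¬ At e (inj₂ v)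
  no-entry {e} {f} {v} (_ , wh) qe qf tf at = from (passing qe at)
    where
    from : Passes (inj₂ v) → ⊥
    from (i , t , _) = ℕ.<-irrefl ≡.refl (≡.subst (2 ℕ.≤_) (white-in v wh) (in≥2 (onQ≢ (edge-onQ i) qf) t tf))

  one-exit : ∀ {e f g v} → degree (inj₂ v) ≡ 3 × colour v ≡ white → onQ e ≡ true → onQ f ≡ false → onQ g ≡ false →
              f ≢ g → src f ≡ inj₂ v → src g ≡ inj₂ v → ¬ At e (inj₂ v)
  one-exit {e} {f} {g} {v} (deg , _) qe qf qg f≢g sf sg′ at = from (passing qe at)
    where
    from : Passes (inj₂ v) → ⊥
    from (i , t , t′) = ℕ.<-irrefl ≡.refl (degree-bound (in≥1 t)
      (out≥3 (onQ≢ (edge-onQ (next i)) qf) (onQ≢ (edge-onQ (next i)) qg) f≢g t′ sf sg′) deg)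

  -- Two edges on the cycle and two off it would give the vertex degree 4.
  transit-off : ∀ {e f v} → onQ e ≡ false → onQ f ≡ false → tgt e ≡ inj₂ v → src f ≡ inj₂ v → ¬ VertexOf (inj₂ v)
  transit-off {e} {f} {v} qe qf te sf (i , eq) = from (internal-degree v) (passing (edge-onQ i) (inj₁ eq))
    where
    ≤4 : Passes (inj₂ v) → ∀ {d} → degree (inj₂ v) ≡ d → 4 ℕ.≤ d
    ≤4 (i , t , t′) = degree-bound (in≥2 (onQ≢ (edge-onQ i) qe) t te) (out≥2 (onQ≢ (edge-onQ (next i)) qf) t′ sf)
    from : degree (inj₂ v) ≡ 2 ⊎ degree (inj₂ v) ≡ 3 → Passes (inj₂ v) → ⊥
    from (inj₁ d) h with ≤4 h d
    ... | s≤s (s≤s ())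
    from (inj₂ d) h with ≤4 h d
    ... | s≤s (s≤s (s≤s ()))

  Consecutive : Edge → Edge → Set
  Consecutive p q = ∃[ i ] (p ≡ edge i × q ≡ edge (next i))

  consecutive : ∀ {p q v} → onQ p ≡ true → onQ q ≡ true → tgt p ≡ v → src q ≡ v → Consecutive p q
  consecutive qp qq tp tq = from (onQ⇒ qp) (onQ⇒ qq) (≡.trans tp (≡.sym tq))
    where
    from : ∀ {p q} → p ∈Q → q ∈Q → tgt p ≡ src q → Consecutive p q
    from (i , ≡.refl) (j , ≡.refl) eq = i , ≡.refl , ≡.cong edge (src-injective (≡.trans (≡.sym eq) (directed i)))

  in-unique : ∀ {e f v} → onQ e ≡ true → onQ f ≡ true → tgt e ≡ v → tgt f ≡ v → e ≡ f
  in-unique qe qf te tf = from (onQ⇒ qe) (onQ⇒ qf) (≡.trans te (≡.sym tf))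
    where
    from : ∀ {e f} → e ∈Q → f ∈Q → tgt e ≡ tgt f → e ≡ f
    from (i , ≡.refl) (j , ≡.refl) eq =
      ≡.cong edge (next-injective (src-injective (≡.trans (≡.sym (directed i)) (≡.trans eq (directed j)))))

  out-unique : ∀ {e f v} → onQ e ≡ true → onQ f ≡ true → src e ≡ v → src f ≡ v → e ≡ f
  out-unique qe qf te tf = from (onQ⇒ qe) (onQ⇒ qf) (≡.trans te (≡.sym tf))
    where
    from : ∀ {e f} → e ∈Q → f ∈Q → src e ≡ src f → e ≡ f
    from (i , ≡.refl) (j , ≡.refl) eq = ≡.cong edge (src-injective eq)

  N̂ : Network n
  N̂ = changeOrientation N Q

  src-on : ∀ {e} → onQ e ≡ true → Network.src N̂ e ≡ tgt e
  src-on {e} q = ≡.cong (λ b → if b then tgt e else src e) q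

  src-off : ∀ {e} → onQ e ≡ false → Network.src N̂ e ≡ src e
  src-off {e} q = ≡.cong (λ b → if b then tgt e else src e) q

  tgt-on : ∀ {e} → onQ e ≡ true → Network.tgt N̂ e ≡ src e
  tgt-on {e} q = ≡.cong (λ b → if b then src e else tgt e) q

  tgt-off : ∀ {e} → onQ e ≡ false → Network.tgt N̂ e ≡ tgt e
  tgt-off {e} q = ≡.cong (λ b → if b then src e else tgt e) q

  weight-on : ∀ {e} → onQ e ≡ true → weight e * Network.weight N̂ e ≈ 1#
  weight-on {e} q = trans (*-congˡ (reflexive (≡.cong (λ b → if b then weight e ⁻¹ else weight e) q)))
    (⁻¹-inverseʳ (0<⇒≉0 (weight-pos e)))

  weight-off : ∀ {e} → onQ e ≡ false → Network.weight N̂ e ≈ weight e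
  weight-off {e} q = reflexive (≡.cong (λ b → if b then weight e ⁻¹ else weight e) q)

  -- Reversing an edge exchanges its contributions to the two degrees, so only their sum is
  -- preserved.
  degree-eq : ∀ u → Network.degree N̂ u ≡ degree u
  degree-eq u = ≡.trans (countFin-+ (λ e → tgt₂ e ≟ᵛ u) (λ e → src₂ e ≟ᵛ u))
    (≡.trans (sum-cong-≗ λ e → swap (onQ e)) (≡.sym (countFin-+ (λ e → tgt e ≟ᵛ u) (λ e → src e ≟ᵛ u))))
    where
    src₂ = Network.src N̂
    tgt₂ = Network.tgt N̂
    swap : ∀ b {x y : Vertex} →
      indicator (does ((if b then x else y) ≟ᵛ u)) ℕ.+ indicator (does ((if b then y else x) ≟ᵛ u)) ≡
      indicator (does (y ≟ᵛ u)) ℕ.+ indicator (does (x ≟ᵛ u))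
    swap true {x} {y} = ℕ.+-comm (indicator (does (x ≟ᵛ u))) _
    swap false        = ≡.refl

-- Sign identities at the vertices of the cycle

module CycleReversal {c ℓ₁ ℓ₂ ℓ} (F : OrderedField c ℓ₁ ℓ₂)
  {D : Plabic.Disk F ℓ} {k n : ℕ} {N : Plabic.Network F n} (plabic : Plabic.IsPlabicNetwork F D k N)
  {𝔩 : Plabic.Point F} (gauge : Plabic.IsGaugeDirection F D N 𝔩)
  (Q : Plabic.SimpleCycle F N) (M : Plabic.RegionMarking F D N Q)
  (γ : Plabic.Network.Edge N → ℕ) (index : ∀ e → Plabic.IndexIs F N 𝔩 Q M e (γ e)) where
  open OrderedFieldProperties F
  open Plabic F
  open EventuallyProperties F
  open CrossingParity F
  open PlaneGeometry F
  open Segments F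
  open TurnVectors F
  open Network N
  open IsPlabicNetwork plabic
  open NetworkGeometry F plabic
  open SimpleCycle Q renaming (simple to src-injective)
  open CycleStructure F plabic Q
  open CycleGeometry F plabic Q M
  open Reversals F {n} 𝔩

  src₂ tgt₂ : Edge → Vertex
  src₂ = Network.src N̂
  tgt₂ = Network.tgt N̂

  isSource₂? = Network.isSource? N̂

  Crosses-swap : ∀ {b p q} → Crosses 𝔩 b p q → Crosses 𝔩 b q p
  Crosses-swap {b} {p} {q} (crosses transversal (t , 0<t , on)) =
    crosses (λ par → transversal (≡.trans (SignOf⇒s (q -ₚ p) 𝔩 (SignOf-resp-≈ (sym (trans (cross-cong (-ₚ-flip q p) (≈ₚ-refl {𝔩})) (cross-negˡ (p -ₚ q) 𝔩))) (SignOf-neg (SignOf-sgn _))))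
                                          (≡.cong (λ i → ℤ.- i) par)))
      (t , 0<t , ∈-swap {p} {q} on)

  source⇔ : ∀ j → Network.IsSource N̂ j ⇔ IsSource j
  source⇔ j = mk⇔ (λ (e , eq) → from e eq (onQ e) ≡.refl) (λ (e , eq) → to e eq (onQ e) ≡.refl)
    where
    from : ∀ e → src₂ e ≡ inj₁ j → ∀ b → onQ e ≡ b → IsSource j
    from e eq true  q = contradiction (inj₂ (≡.trans (≡.sym (src-on q)) eq)) (avoids-boundary q)
    from e eq false q = e , ≡.trans (≡.sym (src-off q)) eq
    to : ∀ e → src e ≡ inj₁ j → ∀ b → onQ e ≡ b → Network.IsSource N̂ j
    to e eq true  q = contradiction (inj₁ eq) (avoids-boundary q)
    to e eq false q = e , ≡.trans (src-off q) eq

  -- The cycle avoids the boundary, so the sources and their rays stay the same, and crossing a ray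
  -- does not depend on the direction of the edge.
  int-eq : ∀ e → int N̂ 𝔩 e ≡ int N 𝔩 e
  int-eq e = countFin-cong
    (λ j → isSource₂? j ×-dec crosses? 𝔩 (pos (inj₁ j)) (pos (src₂ e)) (pos (tgt₂ e)))
    (λ j → isSource? j ×-dec crosses? 𝔩 (pos (inj₁ j)) (pos (src e)) (pos (tgt e)))
    λ j → ≡.cong₂ _∧_ (does-⇔ (source⇔ j) (isSource₂? j) (isSource? j))
      (does-⇔ (crosses⇔ j (onQ e) ≡.refl) (crosses? 𝔩 (pos (inj₁ j)) (pos (src₂ e)) (pos (tgt₂ e)))
                                        (crosses? 𝔩 (pos (inj₁ j)) (pos (src e)) (pos (tgt e))))
    where
    crosses⇔ : ∀ j b → onQ e ≡ b → Crosses 𝔩 (pos (inj₁ j)) (pos (src₂ e)) (pos (tgt₂ e)) ⇔ Crosses 𝔩 (pos (inj₁ j)) (pos (src e)) (pos (tgt e))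
    crosses⇔ j true q = ≡.subst₂ (λ u v → Crosses 𝔩 (pos (inj₁ j)) (pos u) (pos v) ⇔ _) (≡.sym (src-on q)) (≡.sym (tgt-on q))
      (mk⇔ Crosses-swap Crosses-swap)
    crosses⇔ j false q = ≡.subst₂ (λ u v → Crosses 𝔩 (pos (inj₁ j)) (pos u) (pos v) ⇔ _) (≡.sym (src-off q)) (≡.sym (tgt-off q))
      (mk⇔ (λ x → x) (λ x → x))

  dir₂ : Edge → Point
  dir₂ = Network.dir N̂

  dir₂-on : ∀ {e} → onQ e ≡ true → dir₂ e ≈ₚ -ₚ dir e
  dir₂-on {e} q = ≡.subst₂ (λ u v → pos v -ₚ pos u ≈ₚ -ₚ dir e) (≡.sym (src-on q)) (≡.sym (tgt-on q)) (-ₚ-flip (pos (src e)) (pos (tgt e)))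

  dir₂-off : ∀ {e} → onQ e ≡ false → dir₂ e ≡ dir e
  dir₂-off q = ≡.cong₂ (λ u v → pos v -ₚ pos u) (src-off q) (tgt-off q)

  ι γ̄ : Edge → Bool
  ι e = odd (int N 𝔩 e)
  γ̄ e = odd (γ e)

  σ₁ σ₂ : Edge → Edge → Bool
  σ₁ = edgeSign N
  σ₂ = edgeSign N̂

  σ₁≡ : ∀ e f → σ₁ e f ≡ ι e xor oddℤ (wind 𝔩 (dir e) (dir f))
  σ₁≡ e f = oddℤ-+ (int N 𝔩 e) (wind 𝔩 (dir e) (dir f))

  σ₂≡ : ∀ e f → σ₂ e f ≡ ι e xor oddℤ (wind 𝔩 (dir₂ e) (dir₂ f))
  σ₂≡ e f = ≡.trans (oddℤ-+ (int N̂ 𝔩 e) (wind 𝔩 (dir₂ e) (dir₂ f))) (≡.cong (λ i → odd i xor oddℤ (wind 𝔩 (dir₂ e) (dir₂ f))) (int-eq e))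

  γ-on-cycle : ∀ {i b} → SideParity 1# i b →
               γ̄ (edge i) ≡ ((b xor β) xor descent (s (dir (edge i)) 𝔩)) xor ι (edge i)
  γ-on-cycle {i} {b} side = from (index (edge i))
    where
    from : ∀ {g} → IndexIs N 𝔩 Q M (edge i) g → odd g ≡ ((b xor β) xor descent (s (dir (edge i)) 𝔩)) xor ι (edge i)
    from (off-cycle e∉Q _) = contradiction (i , ≡.refl) e∉Q
    from (on-cycle {σ} _ region) = ≡.trans (odd-+ (bit σ ℕ.+ γ₂ N 𝔩 Q M (edge i)) (int N 𝔩 (edge i))) (≡.cong (_xor ι (edge i))
      (≡.trans (odd-+ (bit σ) (γ₂ N 𝔩 Q M (edge i))) (≡.cong (_xor descent (s (dir (edge i)) 𝔩))
        (≡.trans (odd-bit σ) (left-parity 𝔩 side region)))))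

  γ-off-cycle : ∀ {e} (e∉Q : ¬ (e ∈Q)) → γ̄ e ≡ edgeParity e∉Q xor β
  γ-off-cycle {e} e∉Q = from (index e)
    where
    from : ∀ {g} → IndexIs N 𝔩 Q M e g → odd g ≡ edgeParity e∉Q xor β
    from (off-cycle {σ} _ start) = ≡.trans (odd-bit σ) (start-parity e∉Q 𝔩 start)
    from (on-cycle e∈Q _)        = contradiction e∈Q e∉Q

  s≢0 : ∀ {u} → ¬ (cross u 𝔩 ≈ 0#) → s u 𝔩 ≢ 0ℤ
  s≢0 {u} ≉0 eq = ≉0 (null⇒ (≡.subst (SignOf (cross u 𝔩)) eq (SignOf-sgn _)))
    where
    null⇒ : ∀ {x} → SignOf x 0ℤ → x ≈ 0#
    null⇒ (null p) = p

  module CycleCorner {i : Fin (suc length-1)} {o} (at : tgt (edge i) ≡ inj₂ o) where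
    open Corner F polygon i

    p q : Edge
    p = edge i
    q = edge j

    src-q : src q ≡ inj₂ o
    src-q = ≡.trans (≡.sym (directed i)) at

    dir-p : dir p ≡ e
    dir-p = ≡.cong (λ x → x -ₚ P i) (tgt-pos i)

    dir-q : dir q ≡ f
    dir-q = ≡.cong (λ x → x -ₚ P j) (tgt-pos j)

    p⁻ : dir₂ p ≈ₚ -ₚ e
    p⁻ = ≡.subst (λ d → dir₂ p ≈ₚ -ₚ d) dir-p (dir₂-on (edge-onQ i))

    q⁻ : dir₂ q ≈ₚ -ₚ f
    q⁻ = ≡.subst (λ d → dir₂ q ≈ₚ -ₚ d) dir-q (dir₂-on (edge-onQ j))

    a b : ℤ
    a = s e 𝔩
    b = s f 𝔩

    a≢0 : a ≢ 0ℤ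
    a≢0 = s≢0 λ par → transversal gauge {p} {o} {src p} (inj₂ (≡.refl , at))
      (trans (cross-cong (-ₚ-flip (P i) (pos (inj₂ o))) (≈ₚ-refl {𝔩}))
        (trans (cross-negˡ (pos (inj₂ o) -ₚ P i) 𝔩)
          (-0≈0 (≡.subst (λ x → cross (pos x -ₚ P i) 𝔩 ≈ 0#) src-q par))))

    b≢0 : b ≢ 0ℤ
    b≢0 = s≢0 λ par → transversal gauge {q} {o} {tgt q} (inj₁ (src-q , ≡.refl))
      (≡.subst₂ (λ x y → cross (x -ₚ pos y) 𝔩 ≈ 0#) (≡.sym (tgt-pos j)) src-q par)

    open TurnSigns e f (edgeDir≉0 i) (edgeDir≉0 j) no-backtracking

    W : Point → Point → Bool
    W x y = oddℤ (wind 𝔩 x y)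

    straight : (descent a xor descent b) xor (W e f xor W (dir₂ q) (dir₂ p)) ≡ false
    straight = straight-winds 𝔩 (SignOf-sgn _) (SignOf-sgn _) a≢0 b≢0 p⁻ q⁻

    σ₁-pq : σ₁ p q ≡ ι p xor W e f
    σ₁-pq = ≡.trans (σ₁≡ p q) (≡.cong₂ (λ x y → ι p xor W x y) dir-p dir-q)

    left : Bool
    left = proj₁ (sideParities i)

    left-i : SideParity 1# i left
    left-i = proj₁ (proj₂ (sideParities i))

    right-i : SideParity (- 1#) i (not left)
    right-i = proj₂ (proj₂ (sideParities i))

    γ̄-p : γ̄ p ≡ ((left xor β) xor descent a) xor ι p
    γ̄-p = ≡.trans (γ-on-cycle left-i) (≡.cong (λ x → ((left xor β) xor descent (s x 𝔩)) xor ι p) dir-p)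

    γ̄-q : γ̄ q ≡ ((left xor β) xor descent b) xor ι q
    γ̄-q = ≡.trans (γ-on-cycle (proj₁ (sides-turn left-i right-i))) (≡.cong (λ x → ((left xor β) xor descent (s x 𝔩)) xor ι q) dir-q)

    -- Both edges have the same parity on their left, and each `int` occurs twice. What remains is
    -- `straight`.
    along-identity : γ̄ q ≡ σ₂ q p xor (γ̄ p xor σ₁ p q)
    along-identity = ≡.trans γ̄-q (≡.trans (algebra (left xor β) (descent a) (descent b) (W e f) (W (dir₂ q) (dir₂ p)) (ι p) (ι q) straight)
      (≡.sym (≡.cong₂ _xor_ (σ₂≡ q p) (≡.cong₂ _xor_ γ̄-p σ₁-pq))))
      where
      algebra : ∀ l a b w w′ x y → (a xor b) xor (w xor w′) ≡ false →
                (l xor b) xor y ≡ (y xor w′) xor (((l xor a) xor x) xor (x xor w))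
      algebra l a b w w′ x y h = xor-false⇒≡ _ _ (≡.trans
        (xor-solve 7 (λ l a b w w′ x y → ((l ⊕ b) ⊕ y) ⊕ ((y ⊕ w′) ⊕ (((l ⊕ a) ⊕ x) ⊕ (x ⊕ w))) ⊜ (a ⊕ b) ⊕ (w ⊕ w′))
          ≡.refl l a b w w′ x y) h)

    module CycleBranch {g u} (qg : onQ g ≡ false) (joins : Joins g (src q) u) where

      g∉Q : ¬ (g ∈Q)
      g∉Q = ¬onQ⇒ qg

      w : Point
      w = pos u -ₚ v

      w≉0 : ¬ (w ≈ₚ origin)
      w≉0 = difference≉0 (Joins-≉ joins)

      -- Otherwise `g` would run back over the incoming cycle edge.
      ¬along-e : cross e w ≈ 0# → 0# < dot e w
      ¬along-e col = cases (signOf (dot e w))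
        where
        backwards : cross (P i -ₚ v) w ≈ 0# → ¬ (0# < dot (P i -ₚ v) w)
        backwards = not-overlapping {p} {g} {src q} {src p} {u} (onQ≢ (edge-onQ i) qg) (inj₂ (≡.refl , directed i)) joins
        cases : ∃[ t ] SignOf (dot e w) t → 0# < dot e w
        cases (_ , positive h) = h
        cases (_ , null h)     = contradiction h (dot≉0 (edgeDir≉0 i) w≉0 col)
        cases (_ , negative h) = contradiction (0<-resp-≈ (sym (trans (dot-cong (-ₚ-flip (P i) v) (≈ₚ-refl {w})) (dot-negˡ e w))) h)
          (backwards (trans (cross-cong (-ₚ-flip (P i) v) (≈ₚ-refl {w})) (trans (cross-negˡ e w) (-0≈0 col))))

      ¬along-f : cross f w ≈ 0# → 0# < - dot f w
      ¬along-f col = cases (signOf (dot f w))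
        where
        forwards : cross f w ≈ 0# → ¬ (0# < dot f w)
        forwards = ≡.subst (λ x → cross (x -ₚ v) w ≈ 0# → ¬ (0# < dot (x -ₚ v) w)) (tgt-pos j)
          (not-overlapping {q} {g} {src q} {tgt q} {u} (onQ≢ (edge-onQ j) qg) (inj₁ (≡.refl , ≡.refl)) joins)
        cases : ∃[ t ] SignOf (dot f w) t → 0# < - dot f w
        cases (_ , positive h) = contradiction h (forwards col)
        cases (_ , null h)     = contradiction h (dot≉0 (edgeDir≉0 j) w≉0 col)
        cases (_ , negative h) = h

      turnsLeft : Bool
      turnsLeft = leftOf (s e f) (s e w) (s f w)

      parity-ray : ∀ {t} → Proper t → parity (ray w t) ≡ edgeParity g∉Q
      parity-ray {t} t∈ = from joins
        where
        reverse : ∀ a b → along b a t ≈ₚ along a b (1# - t)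
        reverse (ax , ay) (bx , by) = eq ax bx , eq ay by
          where
          eq : ∀ a b → b + t * (a - b) ≈ a + (1# - t) * (b - a)
          eq a b = solve 3 (λ a b t → b :+ t :* (a :- b) := a :+ (con 1ℤ :- t) :* (b :- a)) refl a b t
        from : Joins g (src q) u → parity (along (P j) (pos u) t) ≡ edgeParity g∉Q
        from (inj₁ (sg′ , tg)) = ≡.subst₂ (λ x y → parity (along (pos x) (pos y) t) ≡ edgeParity g∉Q) sg′ tg (parity-onEdge g∉Q t∈)
        from (inj₂ (sg′ , tg)) = ≡.subst₂ (λ x y → parity (along (pos y) (pos x) t) ≡ edgeParity g∉Q) sg′ tg
          (≡.trans (parity-cong (reverse (pos (src g)) (pos (tgt g)))) (parity-onEdge g∉Q (1-proper t∈)))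

      -- A point of `g` near the corner decides, because the parity is constant along the open edge.
      edgeParity-left : edgeParity g∉Q ≡ left xor not turnsLeft
      edgeParity-left = case eventually-∃ (eventually-× near eventually-proper) of λ (t , _ , h , t∈) →
        ≡.trans (≡.sym (parity-ray t∈)) (≡.trans h (choose turnsLeft left))
        where
        near : Eventually λ t → parity (ray w t) ≡ (if turnsLeft then left else not left)
        near = ray-parity w ¬along-e ¬along-f left-i right-i (SignOf-sgn _) (SignOf-sgn _) (SignOf-sgn _)
        choose : ∀ b c → (if b then c else not c) ≡ c xor not b
        choose true  c = ≡.sym (Bool.xor-identityʳ c)
        choose false c = Bool.xor-comm true c

      γ̄-g : γ̄ g ≡ (left xor not turnsLeft) xor β
      γ̄-g = ≡.trans (γ-off-cycle g∉Q) (≡.cong (_xor β) edgeParity-left)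

      w≢0 : s w 𝔩 ≢ 0ℤ
      w≢0 = s≢0 λ par → transversal gauge {g} {o} {u} (≡.subst (λ x → Joins g x u) src-q joins)
        (≡.subst (λ x → cross (pos u -ₚ pos x) 𝔩 ≈ 0#) src-q par)

      open Branch w ¬along-e ¬along-f

      module Winds {w′ : Point} (w′≈ : w′ ≈ₚ -ₚ w) where

        exit-sum : (descent b xor W e f) xor (W e w xor W (dir₂ q) w) ≡ turnsLeft
        exit-sum = exit-winds 𝔩 (SignOf-sgn _) (SignOf-sgn _) (SignOf-sgn _) (SignOf-sgn _) (SignOf-sgn _) (SignOf-sgn _)
          a≢0 b≢0 w≢0 {dir₂ p} {dir₂ q} {w′} p⁻ q⁻ w′≈

        entry-sum : (descent a xor W e f) xor (W w′ f xor W w′ (dir₂ p)) ≡ not turnsLeft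
        entry-sum = entry-winds 𝔩 (SignOf-sgn _) (SignOf-sgn _) (SignOf-sgn _) (SignOf-sgn _) (SignOf-sgn _) (SignOf-sgn _)
          a≢0 b≢0 w≢0 {dir₂ p} {dir₂ q} {w′} p⁻ q⁻ w′≈

    -- Replacing `turnsLeft` by `exit-sum` trades `descent a` for `descent b`, and the difference is
    -- `straight`.
    exit-identity : ∀ {g} → onQ g ≡ false → src g ≡ inj₂ o →
                    σ₂ q p xor (γ̄ p xor σ₁ p g) ≡ not (σ₂ q g xor γ̄ g)
    exit-identity {g} qg sg′ = ≡.trans (≡.cong₂ _xor_ (σ₂≡ q p) (≡.cong₂ _xor_ γ̄-p σ₁-pg))
      (≡.trans (algebra left β (descent a) (descent b) (W e f) (W (dir₂ q) (dir₂ p)) (W e w) (W (dir₂ q) w) turnsLeft (ι p) (ι q)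
          straight (Winds.exit-sum (≈ₚ-refl { -ₚ w})))
        (≡.cong not (≡.sym (≡.cong₂ _xor_ σ₂-qg γ̄-g))))
      where
      open CycleBranch {g} {tgt g} qg (inj₁ (≡.trans sg′ (≡.sym src-q) , ≡.refl))
      dir-g : dir g ≡ w
      dir-g = ≡.cong (λ x → pos (tgt g) -ₚ pos x) (≡.trans sg′ (≡.sym src-q))
      σ₁-pg : σ₁ p g ≡ ι p xor W e w
      σ₁-pg = ≡.trans (σ₁≡ p g) (≡.cong₂ (λ x y → ι p xor W x y) dir-p dir-g)
      σ₂-qg : σ₂ q g ≡ ι q xor W (dir₂ q) w
      σ₂-qg = ≡.trans (σ₂≡ q g) (≡.cong (λ y → ι q xor W (dir₂ q) y) (≡.trans (dir₂-off qg) dir-g))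
      algebra : ∀ l B a b c c′ m r t x y → (a xor b) xor (c xor c′) ≡ false → (b xor c) xor (m xor r) ≡ t →
                (y xor c′) xor ((((l xor B) xor a) xor x) xor (x xor m)) ≡ not ((y xor r) xor ((l xor not t) xor B))
      algebra l B a b c c′ m r _ x y h ≡.refl = xor-false⇒≡ _ _ (≡.trans
        (xor-solve 10 (λ l B a b c c′ m r x y →
          ((y ⊕ c′) ⊕ ((((l ⊕ B) ⊕ a) ⊕ x) ⊕ (x ⊕ m))) ⊕
          (bit-con true ⊕ ((y ⊕ r) ⊕ ((l ⊕ (bit-con true ⊕ ((b ⊕ c) ⊕ (m ⊕ r)))) ⊕ B))) ⊜ (a ⊕ b) ⊕ (c ⊕ c′))
          ≡.refl l B a b c c′ m r x y) h)

    -- Since `g` keeps its direction, its own `int` occurs twice on the right, and `entry-sum`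
    -- accounts for the rest.
    entry-identity : ∀ {g} → onQ g ≡ false → tgt g ≡ inj₂ o →
                     γ̄ g ≡ (σ₂ g p xor γ̄ p) xor (σ₁ p q xor σ₁ g q)
    entry-identity {g} qg tg = ≡.trans γ̄-g
      (≡.trans (algebra left β (descent a) (W e f) (W (dir g) f) (W (dir g) (dir₂ p)) turnsLeft (ι p) (ι g) (Winds.entry-sum dir-g))
        (≡.sym (≡.cong₂ _xor_ (≡.cong₂ _xor_ σ₂-gp γ̄-p) (≡.cong₂ _xor_ σ₁-pq σ₁-gq))))
      where
      open CycleBranch {g} {src g} qg (inj₂ (≡.refl , ≡.trans tg (≡.sym src-q)))
      dir-g : dir g ≈ₚ -ₚ w
      dir-g = ≡.subst (λ x → dir g ≈ₚ -ₚ (pos (src g) -ₚ pos x)) (≡.trans tg (≡.sym src-q)) (-ₚ-flip (pos (tgt g)) (pos (src g)))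
      σ₂-gp : σ₂ g p ≡ ι g xor W (dir g) (dir₂ p)
      σ₂-gp = ≡.trans (σ₂≡ g p) (≡.cong (λ x → ι g xor W x (dir₂ p)) (dir₂-off qg))
      σ₁-gq : σ₁ g q ≡ ι g xor W (dir g) f
      σ₁-gq = ≡.trans (σ₁≡ g q) (≡.cong (λ y → ι g xor W (dir g) y) dir-q)
      algebra : ∀ l B a c m r t x y → (a xor c) xor (m xor r) ≡ not t →
                (l xor not t) xor B ≡ ((y xor r) xor (((l xor B) xor a) xor x)) xor ((x xor c) xor (y xor m))
      algebra l B a c m r t x y h = ≡.trans (≡.cong (λ z → (l xor z) xor B) (≡.sym h))
        (xor-solve 8 (λ l B a c m r x y → (l ⊕ ((a ⊕ c) ⊕ (m ⊕ r))) ⊕ B ⊜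
          ((y ⊕ r) ⊕ (((l ⊕ B) ⊕ a) ⊕ x)) ⊕ ((x ⊕ c) ⊕ (y ⊕ m))) ≡.refl l B a c m r x y)

  sign-off : ∀ {e f} → onQ e ≡ false → onQ f ≡ false → σ₂ e f ≡ σ₁ e f
  sign-off {e} {f} qe qf = ≡.trans (σ₂≡ e f)
    (≡.trans (≡.cong₂ (λ x y → ι e xor oddℤ (wind 𝔩 x y)) (dir₂-off qe) (dir₂-off qf)) (≡.sym (σ₁≡ e f)))

  -- The common vertex is off the cycle, so both edges take the parity of that vertex.
  γ-transit : ∀ {e f v} → onQ e ≡ false → onQ f ≡ false → tgt e ≡ inj₂ v → src f ≡ inj₂ v → γ̄ e ≡ γ̄ f
  γ-transit {e} {f} qe qf te sf = ≡.trans (γ-off-cycle (¬onQ⇒ qe)) (≡.trans (≡.cong (_xor β)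
    (≡.trans (≡.sym (parity-vertex (¬onQ⇒ qe) (inj₂ te) off)) (parity-vertex (¬onQ⇒ qf) (inj₁ sf) off))) (≡.sym (γ-off-cycle (¬onQ⇒ qf))))
    where
    off : ¬ VertexOf (inj₂ _)
    off = transit-off qe qf te sf

  γ-sink : ∀ {e j} → tgt e ≡ inj₁ j → γ̄ e ≡ false
  γ-sink {e} {j} t = cases (onQ e) ≡.refl
    where
    cases : ∀ b → onQ e ≡ b → γ̄ e ≡ false
    cases true q  = contradiction (inj₂ t) (avoids-boundary q)
    cases false q = ≡.trans (γ-off-cycle (¬onQ⇒ q)) (sink-parity (¬onQ⇒ q) t (boundary-off-cycle j))

  along-cycle : ∀ {p q v} → onQ p ≡ true → onQ q ≡ true → tgt p ≡ inj₂ v → src q ≡ inj₂ v →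
                γ̄ q ≡ σ₂ q p xor (γ̄ p xor σ₁ p q)
  along-cycle qp qq tp sq = from (consecutive qp qq tp sq) tp
    where
    from : ∀ {p q v} → Consecutive p q → tgt p ≡ inj₂ v → γ̄ q ≡ σ₂ q p xor (γ̄ p xor σ₁ p q)
    from (i , ≡.refl , ≡.refl) at = CycleCorner.along-identity at

  entering : ∀ {e p q v} → onQ e ≡ false → onQ p ≡ true → onQ q ≡ true → tgt e ≡ inj₂ v → tgt p ≡ inj₂ v → src q ≡ inj₂ v →
             γ̄ e ≡ (σ₂ e p xor γ̄ p) xor (σ₁ p q xor σ₁ e q)
  entering {e} qe qp qq te tp sq = from (consecutive qp qq tp sq) te tp
    where
    from : ∀ {p q v} → Consecutive p q → tgt e ≡ inj₂ v → tgt p ≡ inj₂ v →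
           γ̄ e ≡ (σ₂ e p xor γ̄ p) xor (σ₁ p q xor σ₁ e q)
    from (i , ≡.refl , ≡.refl) te at = CycleCorner.entry-identity at qe te

  exiting : ∀ {f p q v} → onQ f ≡ false → onQ p ≡ true → onQ q ≡ true → src f ≡ inj₂ v → tgt p ≡ inj₂ v → src q ≡ inj₂ v →
            σ₂ q p xor (γ̄ p xor σ₁ p f) ≡ not (σ₂ q f xor γ̄ f)
  exiting {f} qf qp qq sf tp sq = from (consecutive qp qq tp sq) sf tp
    where
    from : ∀ {p q v} → Consecutive p q → src f ≡ inj₂ v → tgt p ≡ inj₂ v →
           σ₂ q p xor (γ̄ p xor σ₁ p f) ≡ not (σ₂ q f xor γ̄ f)
    from (i , ≡.refl , ≡.refl) sf at = CycleCorner.exit-identity at qf sf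

  reversal : Reversal N src₂ tgt₂ (Network.weight N̂) onQ γ̄
  reversal = record
    { src-on     = src-on
    ; tgt-on     = tgt-on
    ; src-off    = src-off
    ; tgt-off    = tgt-off
    ; weight-on  = weight-on
    ; weight-off = weight-off
    ; int-eq     = int-eq
    ; degree-eq  = λ v → degree-eq (inj₂ v)
    ; ∂-avoids   = avoids-boundary
    ; sink-γ     = γ-sink
    ; out-of     = λ q t → let i , _ , t′ = passing q (inj₂ t) in edge (next i) , edge-onQ (next i) , t′
    ; into       = λ q t → let i , t′ , _ = passing q (inj₁ t) in edge i , edge-onQ i , t′
    ; in-unique  = in-unique
    ; out-unique = out-unique
    ; no-exit    = no-exit
    ; no-entry   = no-entry
    ; one-exit   = one-exit
    ; sign-off   = sign-off
    ; γ-off      = γ-transit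
    ; γ-along    = along-cycle
    ; γ-entry    = λ _ → entering
    ; γ-exit     = λ _ → exiting
    }

  open Signs F

  Solves-resp-≈ : ∀ {d} {N : Network n} {B : Fin n → Vector Carrier d} {E E′ : Network.Edge N → Vector Carrier d} →
                  (∀ e → E e ≈ᵥ E′ e) → Solves N 𝔩 B E → Solves N 𝔩 B E′
  Solves-resp-≈ E≈ S = record
    { sink           = λ e j t x → trans (sym (E≈ e x)) (sink e j t x)
    ; bivalentBlack  = λ v e f l t t′ x → trans (sym (E≈ e x)) (trans (bivalentBlack v e f l t t′ x) (*-congˡ (E≈ f x)))
    ; trivalentWhite = λ v e₃ e₁ e₂ d w t t₁ t₂ ne x → trans (sym (E≈ e₃ x))
        (trans (trivalentWhite v e₃ e₁ e₂ d w t t₁ t₂ ne x) (+-cong (*-congˡ (E≈ e₁ x)) (*-congˡ (E≈ e₂ x))))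
    }
    where open Solves S

  forward backward : ∀ {d} → (Edge → Vector Carrier d) → Edge → Vector Carrier d
  forward  = rescale N src₂ tgt₂ (Network.weight N̂) onQ γ̄
  backward = rescale N̂ src tgt weight onQ γ̄

  forward-backward : ∀ {d} (E : Edge → Vector Carrier d) e → forward (backward E) e ≈ᵥ E e
  forward-backward E e x with onQ e in q
  ... | true  = trans (solve 4 (λ g u w y → (g :* u) :* ((g :* w) :* y) := (g :* g) :* ((w :* u) :* y)) refl _ _ _ _)
    (trans (*-cong (sg-square (γ̄ e)) (*-congʳ (trans (*-congˡ (reflexive (≡.cong (λ b → if b then weight e ⁻¹ else weight e) (≡.sym q)))) (weight-on q))))
      (trans (*-identityˡ _) (*-identityˡ _)))
  ... | false = trans (sym (*-assoc _ _ _)) (trans (*-congʳ (sg-square (γ̄ e))) (*-identityˡ _))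

  forward-cong : ∀ {d} {E E′ : Edge → Vector Carrier d} → (∀ e → E e ≈ᵥ E′ e) → ∀ e → forward E e ≈ᵥ forward E′ e
  forward-cong E≈ e x with onQ e
  ... | true  = *-congˡ (E≈ e x)
  ... | false = *-congˡ (E≈ e x)

  forward≈transformed : ∀ {d} (E : Edge → Vector Carrier d) e → forward E e ≈ᵥ transformed N Q γ E e
  forward≈transformed E e x with onQ e in q
  ... | true  = *-congʳ (*-cong (sym (sg-odd (γ e))) refl)
  ... | false = *-congʳ (sym (sg-odd (γ e)))

  edgeVectorSystem : ∀ {d} {B : Fin n → Vector Carrier d} {E} → IsEdgeVectorSystem N 𝔩 B E →
                     IsEdgeVectorSystem N̂ 𝔩 B (transformed N Q γ E)
  edgeVectorSystem {B = B} {E} system = record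
    { solves = Solves-resp-≈ (forward≈transformed E) (reverse-solves N reversal B E solves)
    -- A competitor `E′` is pulled back to the initial network, identified there with `E`, and
    -- pushed forward again.
    ; unique = λ E′ S′ e x → trans (sym (forward-backward E′ e x))
        (trans (forward-cong (unique (backward E′) (reverse-solves N̂ (reverse-symmetric reversal) B E′ S′)) e x)
          (forward≈transformed E e x))
    }
    where open IsEdgeVectorSystem system

open import Data.Nat using (_<_)

lemma5p7 : ∀ {c ℓ₁ ℓ₂ ℓ : Level} (F : OrderedField c ℓ₁ ℓ₂) →
    let open Plabic F in
    (D : Disk ℓ) {k n : ℕ} → 0 < k → k < n →
    (N : Network n) → IsPlabicNetwork D k N →
    (𝔩 : Point) → IsGaugeDirection D N 𝔩 →
    (E : Network.Edge N → Vector (OrderedField.Carrier F) n) →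
    IsEdgeVectorSystem N 𝔩 basis E →
    (Q₀ : SimpleCycle N) (M : RegionMarking D N Q₀) →
    (γ : Network.Edge N → ℕ) → (∀ e → IndexIs N 𝔩 Q₀ M e (γ e)) →
    IsEdgeVectorSystem (changeOrientation N Q₀) 𝔩 basis (transformed N Q₀ γ E)
lemma5p7 F D _ _ N plabic 𝔩 gauge E system Q₀ M γ index =
  CycleReversal.edgeVectorSystem F plabic gauge Q₀ M γ index system
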